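{- Let $s,m$ be positive integers. (1) Let $S=\{a_1<a_2<\cdots<a_m\}$ be a set of $m$ non-negative integers, and for a prime $p$ let $\alpha_s(S,p)$ be the number of chains of subgroups $A_m\subseteq A_{m-1}\subseteq\cdots\subseteq A_1\subseteq\mathbb{Z}^s$ with $[\mathbb{Z}^s:A_i]=p^{a_i}$ for $1\le i\le m$. Then $\alpha_s(S,p)$ is a polynomial in $p$ with non-negative integer coefficients (i.e. there is a polynomial $f\in\mathbb{Z}_{\ge 0}[x]$, depending only on $s$ and $S$, with $\alpha_s(S,p)=f(p)$ for every prime $p$). (2) Let $\underline{\lambda}^{(1)}\subseteq\underline{\lambda}^{(2)}\subseteq\cdots\subseteq\underline{\lambda}^{(m)}$ be partitions, each having at most $s$ parts, and for a prime $p$ let $\alpha_s(\underline{\lambda}^{(1)},\ldots,\underline{\lambda}^{(m)},p)$ be the number of chains of finite index subgroups $A_m\subseteq A_{m-1}\subseteq\cdots\subseteq A_1\subseteq\mathbb{Z}^s$ such that $\mathbb{Z}^s/A_i$ is a finite abelian $p$-group of type $\underline{\lambda}^{(i)}$ for $1\le i\le m$. Then $\alpha_s(\underline{\lambda}^{(1)},\ldots,\underline{\lambda}^{(m)},p)$ is a polynomial in $p$ with non-negative integer coefficients (depending only on $s$ and the partitions), and its sequence of coefficients is unimodal.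
   Context: A partition is a finite non-increasing sequence of positive integers (the empty partition allowed). For partitions $\underline{\lambda}=(\lambda_1\geq\cdots\geq\lambda_k)$ and $\underline{\mu}=(\mu_1\geq\cdots\geq\mu_l)$, $\underline{\mu}\subseteq\underline{\lambda}$ means $l\le k$ and $\mu_i\le\lambda_i$ for $1\le i\le l$. A finite abelian $p$-group is of type $\underline{\lambda}$ if it is isomorphic to $\bigoplus_{i=1}^k\mathbb{Z}/p^{\lambda_i}\mathbb{Z}$. A sequence $c_0,\ldots,c_M$ of reals is unimodal if there is an index $0\le j\le M$ with $c_0\le c_1\le\cdots\le c_j\ge c_{j+1}\ge\cdots\ge c_M$. -}

module Defs where

open import Data.Nat as ℕ using (ℕ; zero; suc; _^_)
open import Data.Integer as ℤ using (ℤ; +_)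
open import Data.Integer.Divisibility using () renaming (_∣_ to _∣ℤ_)
open import Data.Fin as Fin using (Fin)
open import Data.Vec using (Vec; []; _∷_; zipWith; map; replicate; lookup)
open import Data.List using (List; []; _∷_; length)
open import Data.List.Relation.Unary.All using (All)
open import Data.List.Relation.Unary.Linked using (Linked)
open import Data.Bool using (Bool; true)
open import Data.Product using (Σ; ∃; _×_)
open import Data.Unit using (⊤)
open import Data.Empty using (⊥)
open import Relation.Binary.PropositionalEquality using (_≡_)
open import Function.Bundles using (_⇔_)

_+ᵥ_ : ∀ {s} → Vec ℤ s → Vec ℤ s → Vec ℤ s
_+ᵥ_ = zipWith ℤ._+_

-ᵥ_ : ∀ {s} → Vec ℤ s → Vec ℤ s
-ᵥ_ = map (λ z → ℤ.- z)

_-ᵥ_ : ∀ {s} → Vec ℤ s → Vec ℤ s → Vec ℤ s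
x -ᵥ y = x +ᵥ (-ᵥ y)

0ᵥ : ∀ {s} → Vec ℤ s
0ᵥ {s} = replicate s (+ 0)

record Subgroup (s : ℕ) : Set where
  field
    mem   : Vec ℤ s → Bool
    0∈    : mem 0ᵥ ≡ true
    +∈    : ∀ x y → mem x ≡ true → mem y ≡ true → mem (x +ᵥ y) ≡ true
    -∈    : ∀ x → mem x ≡ true → mem (-ᵥ x) ≡ true
open Subgroup public

_⊆G_ : ∀ {s} → Subgroup s → Subgroup s → Set
A ⊆G B = ∀ x → mem A x ≡ true → mem B x ≡ true

QRel : ∀ {s} → Subgroup s → Vec ℤ s → Vec ℤ s → Set
QRel A x y = mem A (x -ᵥ y) ≡ true

HasCard : (X : Set) → (X → X → Set) → ℕ → Set
HasCard X _≈_ n =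
  Σ (Fin n → X) λ f →
    (∀ i j → f i ≈ f j → i ≡ j) × (∀ x → ∃ λ i → f i ≈ x)

HasIndex : ∀ {s} → Subgroup s → ℕ → Set
HasIndex {s} A n = HasCard (Vec ℤ s) (QRel A) n

IsPartition : List ℕ → Set
IsPartition l = Linked ℕ._≥_ l × All (ℕ._<_ 0) l

_⊆P_ : List ℕ → List ℕ → Set
[] ⊆P _ = ⊤
(x ∷ xs) ⊆P [] = ⊥
(x ∷ xs) ⊆P (y ∷ ys) = (x ℕ.≤ y) × (xs ⊆P ys)

-- the group ⊕_i ℤ/p^{λ_i}, represented as ℤ^k modulo ⊕_i p^{λ_i} ℤ
ModRel : (p : ℕ) (l : List ℕ) → Vec ℤ (length l) → Vec ℤ (length l) → Set
ModRel p [] [] [] = ⊤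
ModRel p (a ∷ as) (x ∷ xs) (y ∷ ys) =
  ((+ (p ^ a)) ∣ℤ (x ℤ.- y)) × ModRel p as xs ys

-- ℤ^s / A is isomorphic (as a group) to ⊕_i ℤ/p^{λ_i}:
-- ψ induces a well-defined, injective, surjective homomorphism ℤ^s/A → ⊕ ℤ/p^{λ_i}
HasType : ∀ {s} (p : ℕ) → Subgroup s → List ℕ → Set
HasType {s} p A l =
  Σ (Vec ℤ s → Vec ℤ (length l)) λ ψ →
    (∀ x y → ModRel p l (ψ (x +ᵥ y)) (ψ x +ᵥ ψ y)) ×
    (∀ x y → ModRel p l (ψ x) (ψ y) ⇔ QRel A x y) ×
    (∀ z → ∃ λ x → ModRel p l (ψ x) z)

-- Chains A_m ⊆ ... ⊆ A_1 ⊆ ℤ^s (indexed A (Fin 0) = A_1, ..., A (Fin (m-1)) = A_m)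
-- with a condition on each A_i

record Chain (s m : ℕ) (cond : Fin m → Subgroup s → Set) : Set where
  field
    A      : Fin m → Subgroup s
    nested : ∀ i j → i Fin.≤ j → A j ⊆G A i
    conds  : ∀ i → cond i (A i)
open Chain public

ChainEq : ∀ {s m cond} → Chain s m cond → Chain s m cond → Set
ChainEq C D = ∀ i x → mem (A C i) x ≡ mem (A D i) x

NumChains : (s m : ℕ) → (Fin m → Subgroup s → Set) → ℕ → Set
NumChains s m cond n = HasCard (Chain s m cond) ChainEq n

evalPoly : List ℕ → ℕ → ℕ
evalPoly [] x = 0
evalPoly (c ∷ cs) x = c ℕ.+ x ℕ.* evalPoly cs x

coeff : List ℕ → ℕ → ℕ
coeff [] i = 0
coeff (c ∷ cs) zero = c
coeff (c ∷ cs) (suc i) = coeff cs i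

Unimodal : List ℕ → Set
Unimodal f = ∃ λ j → j ℕ.< length f ×
  (∀ i → i ℕ.< j → coeff f i ℕ.≤ coeff f (suc i)) ×
  (∀ i → j ℕ.≤ i → suc i ℕ.< length f → coeff f (suc i) ℕ.≤ coeff f i)

{-# OPTIONS --safe #-}
module Submission where

-- For a subgroup A of L = ℤˢ put A : p = {x | p x ∈ A}.  The ranks of A, A : p, A : p², … modulo pL
-- record the conjugate of the type of L/A, and B ↦ B : p removes the first column.  If C = B : p then
-- pC ⊆ B ⊆ C and B ∩ pL = pC, so over a fixed C the subgroups B ⊇ A with B : p = C are the subspaces
-- of C/(A + pC) of a given dimension meeting a given subspace trivially; their number is a power of p
-- times a Gaussian binomial coefficient.  Choosing A_m first, then A_{m-1} ⊇ A_m, and so on, the number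
-- of chains of given types is a product of such factors; the number of chains of given indices is the
-- sum of these products over all compatible types.
--
-- Unimodality: a product of Gaussian binomials and powers of p is the graded character of a tensor
-- product of sl₂-modules (0/1-words with operators moving a letter to a neighbouring place).  Below the
-- middle degree the raising operator is injective, above it the lowering operator is, and an
-- injective integer matrix has at least as many rows as columns.

open import Defs
open import Algebra.Bundles using (CommutativeMonoid)
import Algebra.Properties.CommutativeMonoid.Sum as MonoidSum
open import Data.Bool using (Bool; true; false; if_then_else_)
import Data.Bool.Properties as Boolₚ
open import Data.Empty using (⊥; ⊥-elim)
open import Data.Fin as Fin using (Fin; zero; suc; toℕ; fromℕ; fromℕ<; inject₁; _↑ˡ_; _↑ʳ_)
open import Data.Fin.Permutation using (permutation)
import Data.Fin.Properties as Finₚ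
open import Data.Fin.Relation.Unary.Top using (view; ‵fromℕ; ‵inject₁)
open import Data.Integer as ℤ using (ℤ; +_; -[1+_]; 0ℤ; 1ℤ)
open import Data.Integer.Divisibility.Signed using (_∣_; divides; _∣?_; ∣ᵤ⇒∣; ∣⇒∣ᵤ; ∣m∣n⇒∣m+n; ∣m⇒∣-m)
open import Data.Integer.DivMod using (_/ℕ_; n%ℕd<d; a≡a%ℕn+[a/ℕn]*n)
import Data.Integer.Properties as ℤₚ
open import Data.Integer.Tactic.RingSolver using (solve-∀)
open import Data.List as List using (List; []; _∷_; _++_; length; filter; applyUpTo; cartesianProduct; cartesianProductWith)
open import Data.List.Membership.Propositional using () renaming (_∈_ to _∈ˡ_; _∉_ to _∉ˡ_)
open import Data.List.Membership.Propositional.Properties using (∈-filter⁺; ∈-filter⁻; ∈-map⁺; ∈-map⁻; ∈-++⁺ˡ; ∈-++⁺ʳ; ∈-++⁻; ∈-cartesianProduct⁺; ∈-cartesianProduct⁻)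
import Data.List.Properties as Listₚ
open import Data.List.Relation.Unary.All as All using (All; []; _∷_)
import Data.List.Relation.Unary.All.Properties as Allₚ
open import Data.List.Relation.Unary.Any using (here; there)
open import Data.List.Relation.Unary.Unique.Propositional using (Unique; []; _∷_)
import Data.List.Relation.Unary.Unique.Propositional.Properties as Uniqueₚ
open import Data.Nat as ℕ using (ℕ; zero; suc; NonZero; _^_; _≤_; _<_)
open import Data.Nat.Coprimality using (prime⇒coprime; coprime-Bézout)
open import Data.Nat.Divisibility using (divides; >⇒∤)
open import Data.Nat.GCD using (module Bézout)
import Data.Nat.ListAction as ListAction
open import Data.Nat.Primality using (Prime; prime⇒nonZero; prime⇒nonTrivial)
import Data.Nat.Properties as ℕₚ
open import Data.Nat.Tactic.RingSolver using () renaming (solve-∀ to ℕ-solve-∀)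
open import Data.Product using (Σ; ∃; ∃₂; _×_; _,_; proj₁; proj₂)
open import Data.Product.Properties using () renaming (≡-dec to ×-≡-dec)
open import Data.Sum using (_⊎_; inj₁; inj₂)
open import Data.Unit using (⊤; tt)
open import Data.Vec as Vec using (Vec; []; _∷_; map; replicate; lookup; zipWith; fromList; insertAt; removeAt)
import Data.Vec.Properties as Vecₚ
open import Function using (_∘_; mk⇔; module Equivalence)
open import Relation.Binary.Definitions using (DecidableEquality; tri<; tri≈; tri>)
open import Relation.Binary.PropositionalEquality as ≡ using (_≡_; refl; sym; trans; cong; cong₂; subst; subst₂; module ≡-Reasoning)
open import Relation.Nullary using (¬_; Dec; yes; no; does)
open import Relation.Nullary.Decidable using (dec-true; map′; _×-dec_)

-- Cardinalities up to an equivalence relation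

-- Subgroups come with a Boolean membership test and without bases, so dimension is replaced
-- everywhere by a `Flag`, an explicit ladder of subgroups with steps of order p. A flag makes
-- quantifiers over V/U finite searches and exhibits the p^n cosets of U in V, from which uniqueness
-- and additivity of lengths follow. The number of admissible B above A depends on A only through
-- its ranks; this is what makes the chain count a product. The chain is started above the zero
-- subgroup, whose ranks all vanish, so that A_m too is counted as a subgroup above a known one. All
-- rank sequences have a common length read off from the exponents or the partitions, and p enters a
-- count only as the base of powers, so one list of exponents serves every prime. A product of
-- unimodal polynomials need not be unimodal. This is why the factors are realised as sl₂-modules:
-- tensor products remain such modules, the centres D/2 being added. In part (1) the summands may
-- have different centres, so a sum is kept only as a list of exponents.

module _ {X : Set} {_≈_ : X → X → Set} where

  hc-empty : (X → ⊥) → HasCard X _≈_ 0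
  hc-empty e = (λ ()) , (λ ()) , λ x → ⊥-elim (e x)

  hc-singleton : (x₀ : X) → (∀ x → x₀ ≈ x) → HasCard X _≈_ 1
  hc-singleton x₀ h = (λ _ → x₀) , (λ { zero zero _ → refl }) , λ x → zero , h x

  hc-map : ∀ {n} {Y : Set} {_~_ : Y → Y → Set} → HasCard X _≈_ n → (f : X → Y) →
           (∀ {x y} → x ≈ y → f x ~ f y) → (∀ {x y} → f x ~ f y → x ≈ y) →
           (∀ {x y z} → x ~ y → y ~ z → x ~ z) → (∀ y → ∃ λ x → f x ~ y) → HasCard Y _~_ n
  hc-map (g , g-inj , g-sur) f f-resp f-inj ~-trans f-sur =
    f ∘ g , (λ i j e → g-inj i j (f-inj e)) ,
    λ y → let x , fx~y = f-sur y ; i , e = g-sur x in i , ~-trans (f-resp e) fx~y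

  hc-⊎ : ∀ {m n} {P : X → Set} → (∀ x → Dec (P x)) → (∀ {x y} → x ≈ y → P x → P y) →
         (∀ {x y} → x ≈ y → y ≈ x) →
         HasCard (Σ X P) (λ x y → proj₁ x ≈ proj₁ y) m →
         HasCard (Σ X (λ x → ¬ P x)) (λ x y → proj₁ x ≈ proj₁ y) n →
         HasCard X _≈_ (m ℕ.+ n)
  hc-⊎ {m} {n} {P} P? resp ≈-sym (f , f-inj , f-sur) (g , g-inj , g-sur) = fg ∘ Fin.splitAt m , inj , sur
    where
    fg : Fin m ⊎ Fin n → X
    fg (inj₁ i) = proj₁ (f i)
    fg (inj₂ i) = proj₁ (g i)
    inj′ : ∀ a b → fg a ≈ fg b → a ≡ b
    inj′ (inj₁ i) (inj₁ j) e = cong inj₁ (f-inj i j e)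
    inj′ (inj₁ i) (inj₂ j) e = ⊥-elim (proj₂ (g j) (resp e (proj₂ (f i))))
    inj′ (inj₂ i) (inj₁ j) e = ⊥-elim (proj₂ (g i) (resp (≈-sym e) (proj₂ (f j))))
    inj′ (inj₂ i) (inj₂ j) e = cong inj₂ (g-inj i j e)
    inj : ∀ i j → fg (Fin.splitAt m i) ≈ fg (Fin.splitAt m j) → i ≡ j
    inj i j e = trans (sym (Finₚ.join-splitAt m n i))
                  (trans (cong (Fin.join m n) (inj′ (Fin.splitAt m i) (Fin.splitAt m j) e)) (Finₚ.join-splitAt m n j))
    sur : ∀ x → ∃ λ i → fg (Fin.splitAt m i) ≈ x
    sur x with P? x
    ... | yes px = let i , e = f-sur (x , px) in
                   i ↑ˡ n , subst (λ z → fg z ≈ x) (sym (Finₚ.splitAt-↑ˡ m i n)) e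
    ... | no ¬px = let i , e = g-sur (x , ¬px) in
                   m ↑ʳ i , subst (λ z → fg z ≈ x) (sym (Finₚ.splitAt-↑ʳ m n i)) e

  private
    hc-≤ : (∀ {x y} → x ≈ y → y ≈ x) → (∀ {x y z} → x ≈ y → y ≈ z → x ≈ z) →
           ∀ {m n} → HasCard X _≈_ m → HasCard X _≈_ n → m ℕ.≤ n
    hc-≤ ≈-sym ≈-trans (f , f-inj , f-sur) (g , g-inj , g-sur) =
      Finₚ.injective⇒≤ {f = λ i → proj₁ (g-sur (f i))} λ {i} {j} e →
        f-inj i j (≈-trans (≈-sym (proj₂ (g-sur (f i))))
                    (subst (λ z → g z ≈ f j) (sym e) (proj₂ (g-sur (f j)))))

  hc-unique : (∀ {x y} → x ≈ y → y ≈ x) → (∀ {x y z} → x ≈ y → y ≈ z → x ≈ z) →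
              ∀ {m n} → HasCard X _≈_ m → HasCard X _≈_ n → m ≡ n
  hc-unique s t h k = ℕₚ.≤-antisym (hc-≤ s t h k) (hc-≤ s t k h)

sumF : ∀ {m} → (Fin m → ℕ) → ℕ
sumF {zero}  k = 0
sumF {suc m} k = k zero ℕ.+ sumF (k ∘ suc)

private
  joinΣ : ∀ {m} (k : Fin m → ℕ) → Σ (Fin m) (Fin ∘ k) → Fin (sumF k)
  joinΣ k (zero  , j) = j ↑ˡ _
  joinΣ k (suc i , j) = k zero ↑ʳ joinΣ (k ∘ suc) (i , j)

  splitΣ : ∀ {m} (k : Fin m → ℕ) → Fin (sumF k) → Σ (Fin m) (Fin ∘ k)
  splitΣ {suc m} k a with Fin.splitAt (k zero) a
  ... | inj₁ j = zero , j
  ... | inj₂ b = let i , j = splitΣ (k ∘ suc) b in suc i , j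

  join-splitΣ : ∀ {m} (k : Fin m → ℕ) a → joinΣ k (splitΣ k a) ≡ a
  join-splitΣ {suc m} k a with Fin.splitAt (k zero) a in eq
  ... | inj₁ j = Finₚ.splitAt⁻¹-↑ˡ eq
  ... | inj₂ b = trans (cong (k zero ↑ʳ_) (join-splitΣ (k ∘ suc) b)) (Finₚ.splitAt⁻¹-↑ʳ eq)

  split-joinΣ : ∀ {m} (k : Fin m → ℕ) ij → splitΣ k (joinΣ k ij) ≡ ij
  split-joinΣ {suc m} k (zero  , j) rewrite Finₚ.splitAt-↑ˡ (k zero) j (sumF (k ∘ suc)) = refl
  split-joinΣ {suc m} k (suc i , j)
    rewrite Finₚ.splitAt-↑ʳ (k zero) (sumF (k ∘ suc)) (joinΣ (k ∘ suc) (i , j))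
          | split-joinΣ (k ∘ suc) (i , j) = refl

-- Counting along the fibres of `π`. The fibres are taken over the representatives listed by `hB`,
-- and in most uses all of them have the same size, which turns the sum into a product by
-- `sumF-const`.
hc-Σ : ∀ {X B : Set} {_≈_ : X → X → Set} {_~_ : B → B → Set} {m} {k : Fin m → ℕ} →
       (∀ {a b} → a ~ b → b ~ a) → (∀ {a b c} → a ~ b → b ~ c → a ~ c) →
       (hB : HasCard B _~_ m) (π : X → B) → (∀ {x y} → x ≈ y → π x ~ π y) →
       (∀ i → HasCard (Σ X λ x → proj₁ hB i ~ π x) (λ x y → proj₁ x ≈ proj₁ y) (k i)) →
       HasCard X _≈_ (sumF k)
hc-Σ {X} {_≈_ = _≈_} {_~_} {m} {k} ~-sym ~-trans (b , b-inj , b-sur) π resp fib =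
  f ∘ splitΣ k , inj , sur
  where
  f : Σ (Fin m) (Fin ∘ k) → X
  f (i , j) = proj₁ (proj₁ (fib i) j)
  over : ∀ ij → b (proj₁ ij) ~ π (f ij)
  over (i , j) = proj₂ (proj₁ (fib i) j)
  inj′ : ∀ x y → f x ≈ f y → x ≡ y
  inj′ (i , j) (i′ , j′) e
    with refl ← b-inj i i′ (~-trans (over (i , j)) (~-trans (resp e) (~-sym (over (i′ , j′)))))
    = cong (i ,_) (proj₁ (proj₂ (fib i)) j j′ e)
  inj : ∀ x y → f (splitΣ k x) ≈ f (splitΣ k y) → x ≡ y
  inj x y e = trans (sym (join-splitΣ k x)) (trans (cong (joinΣ k) (inj′ (splitΣ k x) (splitΣ k y) e)) (join-splitΣ k y))
  sur : ∀ x → ∃ λ a → f (splitΣ k a) ≈ x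
  sur x = let i , e = b-sur (π x) ; j , e′ = proj₂ (proj₂ (fib i)) (x , e) in
          joinΣ k (i , j) , subst (λ z → f z ≈ x) (sym (split-joinΣ k (i , j))) e′

sumF-const : ∀ m k → sumF {m} (λ _ → k) ≡ m ℕ.* k
sumF-const zero    k = refl
sumF-const (suc m) k = cong (k ℕ.+_) (sumF-const m k)

hc-filter : ∀ {X : Set} {_≈_ : X → X → Set} {n} {P : X → Set} →
            (∀ x → Dec (P x)) → (∀ {x y} → x ≈ y → P x → P y) → (∀ {x y} → x ≈ y → y ≈ x) →
            HasCard X _≈_ n → ∃ λ m → HasCard (Σ X P) (λ x y → proj₁ x ≈ proj₁ y) m
hc-filter {X} {_≈_} {n} {P} P? resp ≈-sym (f , f-inj , f-sur) =
  let m , g , g-inj , g-P , g-sur = select n (λ i → P? (f i)) in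
  m , (λ j → f (g j) , g-P j) , (λ i j e → g-inj i j (f-inj _ _ e)) ,
  λ x → let i , e = f-sur (proj₁ x) ; j , gj≡i = g-sur i (resp (≈-sym e) (proj₂ x)) in
        j , subst (λ z → f z ≈ proj₁ x) (sym gj≡i) e
  where
  select : ∀ n {Q : Fin n → Set} → (∀ i → Dec (Q i)) →
           ∃ λ m → Σ (Fin m → Fin n) λ g → (∀ i j → g i ≡ g j → i ≡ j) × (∀ i → Q (g i)) ×
             (∀ i → Q i → ∃ λ j → g j ≡ i)
  select zero    Q? = 0 , (λ ()) , (λ ()) , (λ ()) , λ ()
  select (suc n) {Q} Q? with select n (Q? ∘ suc) | Q? zero
  ... | m , g , g-inj , g-Q , g-sur | yes q₀ = suc m , h , h-inj , h-Q , h-sur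
    where
    h : Fin (suc m) → Fin (suc n)
    h zero    = zero
    h (suc j) = suc (g j)
    h-inj : ∀ i j → h i ≡ h j → i ≡ j
    h-inj zero    zero    e = refl
    h-inj (suc i) (suc j) e = cong suc (g-inj i j (Finₚ.suc-injective e))
    h-Q : ∀ i → Q (h i)
    h-Q zero    = q₀
    h-Q (suc j) = g-Q j
    h-sur : ∀ i → Q i → ∃ λ j → h j ≡ i
    h-sur zero    q = zero , refl
    h-sur (suc i) q = let j , e = g-sur i q in suc j , cong suc e
  ... | m , g , g-inj , g-Q , g-sur | no ¬q₀ =
    m , suc ∘ g , (λ i j e → g-inj i j (Finₚ.suc-injective e)) , g-Q , sur
    where
    sur : ∀ i → Q i → ∃ λ j → suc (g j) ≡ i
    sur zero    q = ⊥-elim (¬q₀ q)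
    sur (suc i) q = let j , e = g-sur i q in j , cong suc e

-- Subgroups of ℤˢ

infixl 21 _*ᵥ_
infix 4 _∈_ _∉_ _⊑_ _≐_ _∈?_

_*ᵥ_ : ∀ {s} → ℤ → Vec ℤ s → Vec ℤ s
k *ᵥ x = map (k ℤ.*_) x

1*ᵥ : ∀ {s} (x : Vec ℤ s) → 1ℤ *ᵥ x ≡ x
1*ᵥ []       = refl
1*ᵥ (x ∷ xs) = cong₂ _∷_ (ℤₚ.*-identityˡ x) (1*ᵥ xs)

0*ᵥ : ∀ {s} (x : Vec ℤ s) → 0ℤ *ᵥ x ≡ 0ᵥ
0*ᵥ []       = refl
0*ᵥ (x ∷ xs) = cong₂ _∷_ refl (0*ᵥ xs)

*ᵥ-0 : ∀ {s} k → k *ᵥ 0ᵥ {s} ≡ 0ᵥ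
*ᵥ-0 {zero}  k = refl
*ᵥ-0 {suc s} k = cong₂ _∷_ (ℤₚ.*-zeroʳ k) (*ᵥ-0 k)

*ᵥ-assoc : ∀ {s} j k (x : Vec ℤ s) → (j ℤ.* k) *ᵥ x ≡ j *ᵥ (k *ᵥ x)
*ᵥ-assoc j k []       = refl
*ᵥ-assoc j k (x ∷ xs) = cong₂ _∷_ (ℤₚ.*-assoc j k x) (*ᵥ-assoc j k xs)

*ᵥ-distribʳ : ∀ {s} j k (x : Vec ℤ s) → (j ℤ.+ k) *ᵥ x ≡ j *ᵥ x +ᵥ k *ᵥ x
*ᵥ-distribʳ j k []       = refl
*ᵥ-distribʳ j k (x ∷ xs) = cong₂ _∷_ (ℤₚ.*-distribʳ-+ x j k) (*ᵥ-distribʳ j k xs)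

*ᵥ-distribˡ : ∀ {s} k (x y : Vec ℤ s) → k *ᵥ (x +ᵥ y) ≡ k *ᵥ x +ᵥ k *ᵥ y
*ᵥ-distribˡ k []       []       = refl
*ᵥ-distribˡ k (x ∷ xs) (y ∷ ys) = cong₂ _∷_ (ℤₚ.*-distribˡ-+ k x y) (*ᵥ-distribˡ k xs ys)

*ᵥ-neg : ∀ {s} k (x : Vec ℤ s) → k *ᵥ (-ᵥ x) ≡ -ᵥ (k *ᵥ x)
*ᵥ-neg k []       = refl
*ᵥ-neg k (x ∷ xs) = cong₂ _∷_ (sym (ℤₚ.neg-distribʳ-* k x)) (*ᵥ-neg k xs)

neg-*ᵥ : ∀ {s} k (x : Vec ℤ s) → -ᵥ (k *ᵥ x) ≡ (ℤ.- k) *ᵥ x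
neg-*ᵥ k []       = refl
neg-*ᵥ k (x ∷ xs) = cong₂ _∷_ (ℤₚ.neg-distribˡ-* k x) (neg-*ᵥ k xs)

*ᵥ-comm : ∀ {s} j k (x : Vec ℤ s) → j *ᵥ (k *ᵥ x) ≡ k *ᵥ (j *ᵥ x)
*ᵥ-comm j k x = trans (sym (*ᵥ-assoc j k x)) (trans (cong (_*ᵥ x) (ℤₚ.*-comm j k)) (*ᵥ-assoc k j x))

suc-*ᵥ : ∀ {s} n (x : Vec ℤ s) → (+ suc n) *ᵥ x ≡ x +ᵥ (+ n) *ᵥ x
suc-*ᵥ n []       = refl
suc-*ᵥ n (x ∷ xs) = cong₂ _∷_ (ℤₚ.suc-* (+ n) x) (suc-*ᵥ n xs)

x-x : ∀ {s} (x : Vec ℤ s) → x -ᵥ x ≡ 0ᵥ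
x-x []       = refl
x-x (x ∷ xs) = cong₂ _∷_ (ℤₚ.+-inverseʳ x) (x-x xs)

x-0 : ∀ {s} (x : Vec ℤ s) → x -ᵥ 0ᵥ ≡ x
x-0 []       = refl
x-0 (x ∷ xs) = cong₂ _∷_ (ℤₚ.+-identityʳ x) (x-0 xs)

+-0ᵥ : ∀ {s} (x : Vec ℤ s) → x +ᵥ 0ᵥ ≡ x
+-0ᵥ []       = refl
+-0ᵥ (x ∷ xs) = cong₂ _∷_ (ℤₚ.+-identityʳ x) (+-0ᵥ xs)

+ᵥ-comm : ∀ {s} (x y : Vec ℤ s) → x +ᵥ y ≡ y +ᵥ x
+ᵥ-comm []       []       = refl
+ᵥ-comm (x ∷ xs) (y ∷ ys) = cong₂ _∷_ (ℤₚ.+-comm x y) (+ᵥ-comm xs ys)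

+ᵥ-assoc : ∀ {s} (x y z : Vec ℤ s) → (x +ᵥ y) +ᵥ z ≡ x +ᵥ (y +ᵥ z)
+ᵥ-assoc []       []       []       = refl
+ᵥ-assoc (x ∷ xs) (y ∷ ys) (z ∷ zs) = cong₂ _∷_ (ℤₚ.+-assoc x y z) (+ᵥ-assoc xs ys zs)

0-+ᵥ : ∀ {s} (x : Vec ℤ s) → 0ᵥ +ᵥ x ≡ x
0-+ᵥ x = trans (+ᵥ-comm 0ᵥ x) (+-0ᵥ x)

private
  ℤ-neg-diff : ∀ x y → ℤ.- (x ℤ.+ ℤ.- y) ≡ y ℤ.+ ℤ.- x
  ℤ-neg-diff = solve-∀
  ℤ-diff-+-diff : ∀ x y z → (x ℤ.+ ℤ.- y) ℤ.+ (y ℤ.+ ℤ.- z) ≡ x ℤ.+ ℤ.- z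
  ℤ-diff-+-diff = solve-∀
  ℤ-diff-interchange : ∀ x y z w → (x ℤ.+ ℤ.- y) ℤ.+ (z ℤ.+ ℤ.- w) ≡ (x ℤ.+ z) ℤ.+ ℤ.- (y ℤ.+ w)
  ℤ-diff-interchange = solve-∀
  ℤ-diff-cancel : ∀ x y → (x ℤ.+ ℤ.- y) ℤ.+ y ≡ x
  ℤ-diff-cancel = solve-∀

neg-diff : ∀ {s} (x y : Vec ℤ s) → -ᵥ (x -ᵥ y) ≡ y -ᵥ x
neg-diff []       []       = refl
neg-diff (x ∷ xs) (y ∷ ys) = cong₂ _∷_ (ℤ-neg-diff x y) (neg-diff xs ys)

diff-+-diff : ∀ {s} (x y z : Vec ℤ s) → (x -ᵥ y) +ᵥ (y -ᵥ z) ≡ x -ᵥ z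
diff-+-diff []       []       []       = refl
diff-+-diff (x ∷ xs) (y ∷ ys) (z ∷ zs) = cong₂ _∷_ (ℤ-diff-+-diff x y z) (diff-+-diff xs ys zs)

diff-interchange : ∀ {s} (x y z w : Vec ℤ s) → (x -ᵥ y) +ᵥ (z -ᵥ w) ≡ (x +ᵥ z) -ᵥ (y +ᵥ w)
diff-interchange []       []       []       []       = refl
diff-interchange (x ∷ xs) (y ∷ ys) (z ∷ zs) (w ∷ ws) =
  cong₂ _∷_ (ℤ-diff-interchange x y z w) (diff-interchange xs ys zs ws)

*ᵥ-diff : ∀ {s} k (x y : Vec ℤ s) → k *ᵥ (x -ᵥ y) ≡ k *ᵥ x -ᵥ k *ᵥ y
*ᵥ-diff k x y = trans (*ᵥ-distribˡ k x (-ᵥ y)) (cong (k *ᵥ x +ᵥ_) (*ᵥ-neg k y))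

diff-cancel : ∀ {s} (x y : Vec ℤ s) → (x -ᵥ y) +ᵥ y ≡ x
diff-cancel []       []       = refl
diff-cancel (x ∷ xs) (y ∷ ys) = cong₂ _∷_ (ℤ-diff-cancel x y) (diff-cancel xs ys)

x+y-x : ∀ {s} (x y : Vec ℤ s) → (x +ᵥ y) -ᵥ x ≡ y
x+y-x x y = trans (cong (_-ᵥ x) (+ᵥ-comm x y)) (trans (+ᵥ-assoc y x (-ᵥ x)) (trans (cong (y +ᵥ_) (x-x x)) (+-0ᵥ y)))

_≟ᵥ_ : ∀ {s} (x y : Vec ℤ s) → Dec (x ≡ y)
_≟ᵥ_ = Vecₚ.≡-dec ℤ._≟_

-- A record instead of the bare equation, so that `x` and `A` can be inferred from a membership
-- type. `_≐_` and `_≈[_]_` are records for the same reason.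
record _∈_ {s} (x : Vec ℤ s) (A : Subgroup s) : Set where
  constructor ⟨_⟩
  field holds : mem A x ≡ true
open _∈_ public

_∉_ : ∀ {s} → Vec ℤ s → Subgroup s → Set
x ∉ A = ¬ (x ∈ A)

_∈?_ : ∀ {s} (x : Vec ℤ s) (A : Subgroup s) → Dec (x ∈ A)
x ∈? A = map′ ⟨_⟩ holds (mem A x Boolₚ.≟ true)

_⊑_ : ∀ {s} → Subgroup s → Subgroup s → Set
A ⊑ B = ∀ {x} → x ∈ A → x ∈ B

record _≐_ {s} (A B : Subgroup s) : Set where
  constructor _,_
  field
    fwd : A ⊑ B
    bwd : B ⊑ A
open _≐_ public

≐-refl : ∀ {s} {A : Subgroup s} → A ≐ A
≐-refl = (λ z → z) , (λ z → z)

≐-sym : ∀ {s} {A B : Subgroup s} → A ≐ B → B ≐ A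
≐-sym (f , g) = g , f

≐-trans : ∀ {s} {A B C : Subgroup s} → A ≐ B → B ≐ C → A ≐ C
≐-trans (f , g) (f′ , g′) = (λ z → f′ (f z)) , (λ z → g (g′ z))

≐⇒mem : ∀ {s} {A B : Subgroup s} → A ≐ B → ∀ x → mem A x ≡ mem B x
≐⇒mem {A = A} {B} (f , g) x with mem A x in a | mem B x in b
... | true  | true  = refl
... | false | false = refl
... | true  | false = trans (sym (holds (f ⟨ a ⟩))) b
... | false | true  = trans (sym a) (holds (g ⟨ b ⟩))

mem⇒≐ : ∀ {s} {A B : Subgroup s} → (∀ x → mem A x ≡ mem B x) → A ≐ B
mem⇒≐ h = (λ {x} z → ⟨ trans (sym (h x)) (holds z) ⟩) , (λ {x} z → ⟨ trans (h x) (holds z) ⟩)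

module _ {s} {A : Subgroup s} where

  ∈-resp : ∀ {x y} → x ≡ y → x ∈ A → y ∈ A
  ∈-resp = subst (_∈ A)

  0-∈ : 0ᵥ ∈ A
  0-∈ = ⟨ 0∈ A ⟩

  +-∈ : ∀ {x y} → x ∈ A → y ∈ A → x +ᵥ y ∈ A
  +-∈ ⟨ a ⟩ ⟨ b ⟩ = ⟨ +∈ A _ _ a b ⟩

  neg-∈ : ∀ {x} → x ∈ A → -ᵥ x ∈ A
  neg-∈ ⟨ a ⟩ = ⟨ -∈ A _ a ⟩

  private
    ℕ*-∈ : ∀ {x} n → x ∈ A → (+ n) *ᵥ x ∈ A
    ℕ*-∈ zero    a = ∈-resp (sym (0*ᵥ _)) 0-∈
    ℕ*-∈ (suc n) a = ∈-resp (sym (suc-*ᵥ n _)) (+-∈ a (ℕ*-∈ n a))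

  *-∈ : ∀ {x} k → x ∈ A → k *ᵥ x ∈ A
  *-∈ (+ n)    a = ℕ*-∈ n a
  *-∈ -[1+ n ] a = ∈-resp (neg-*ᵥ (+ suc n) _) (neg-∈ (ℕ*-∈ (suc n) a))

record _≈[_]_ {s} (x : Vec ℤ s) (A : Subgroup s) (y : Vec ℤ s) : Set where
  constructor ⟪_⟫
  field diff : x -ᵥ y ∈ A
open _≈[_]_ public
infix 4 _≈[_]_

module _ {s} {A : Subgroup s} where

  ≈-refl : ∀ {x} → x ≈[ A ] x
  ≈-refl {x} = ⟪ ∈-resp (sym (x-x x)) 0-∈ ⟫

  ≡⇒≈ : ∀ {x y} → x ≡ y → x ≈[ A ] y
  ≡⇒≈ refl = ≈-refl

  ≈-sym : ∀ {x y} → x ≈[ A ] y → y ≈[ A ] x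
  ≈-sym {x} {y} ⟪ d ⟫ = ⟪ ∈-resp (neg-diff x y) (neg-∈ d) ⟫

  ≈-trans : ∀ {x y z} → x ≈[ A ] y → y ≈[ A ] z → x ≈[ A ] z
  ≈-trans ⟪ d ⟫ ⟪ e ⟫ = ⟪ ∈-resp (diff-+-diff _ _ _) (+-∈ d e) ⟫

  ≈-+ : ∀ {x y z w} → x ≈[ A ] y → z ≈[ A ] w → x +ᵥ z ≈[ A ] y +ᵥ w
  ≈-+ ⟪ d ⟫ ⟪ e ⟫ = ⟪ ∈-resp (diff-interchange _ _ _ _) (+-∈ d e) ⟫

  ≈-* : ∀ {x y} k → x ≈[ A ] y → k *ᵥ x ≈[ A ] k *ᵥ y
  ≈-* k ⟪ d ⟫ = ⟪ ∈-resp (*ᵥ-diff k _ _) (*-∈ k d) ⟫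

  ≈-∈ : ∀ {x y} → x ≈[ A ] y → y ∈ A → x ∈ A
  ≈-∈ ⟪ d ⟫ b = ∈-resp (diff-cancel _ _) (+-∈ d b)

  ∈⇒≈0 : ∀ {x} → x ∈ A → x ≈[ A ] 0ᵥ
  ∈⇒≈0 a = ⟪ ∈-resp (sym (x-0 _)) a ⟫

  ≈0⇒∈ : ∀ {x} → x ≈[ A ] 0ᵥ → x ∈ A
  ≈0⇒∈ h = ≈-∈ h 0-∈

  ≈-+∈ : ∀ {x y} → y ∈ A → x +ᵥ y ≈[ A ] x
  ≈-+∈ y∈A = ≈-trans (≈-+ ≈-refl (∈⇒≈0 y∈A)) (≡⇒≈ (+-0ᵥ _))

  diff-∈ : ∀ {x y} → x ∈ A → y ∈ A → x -ᵥ y ∈ A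
  diff-∈ a b = +-∈ a (neg-∈ b)

≈-mono : ∀ {s} {A B : Subgroup s} → A ⊑ B → ∀ {x y} → x ≈[ A ] y → x ≈[ B ] y
≈-mono h ⟪ d ⟫ = ⟪ h d ⟫

-- Membership in a `Subgroup` is Boolean, so every subgroup constructed below needs a decision
-- procedure; this is the interface through which it is supplied.
record DecSubgroup (s : ℕ) : Set₁ where
  field
    P  : Vec ℤ s → Set
    P? : ∀ x → Dec (P x)
    P0 : P 0ᵥ
    P+ : ∀ {x y} → P x → P y → P (x +ᵥ y)
    P- : ∀ {x} → P x → P (-ᵥ x)

module _ {s} (R : DecSubgroup s) where
  open DecSubgroup R

  private
    out : ∀ {x} → does (P? x) ≡ true → P x
    out {x} e with P? x
    ... | yes px = px

  subgroup : Subgroup s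
  subgroup = record
    { mem = λ x → does (P? x)
    ; 0∈  = dec-true (P? _) P0
    ; +∈  = λ x y a b → dec-true (P? _) (P+ (out a) (out b))
    ; -∈  = λ x a → dec-true (P? _) (P- (out a))
    }

  to-subgroup : ∀ {x} → P x → x ∈ subgroup
  to-subgroup px = ⟨ dec-true (P? _) px ⟩

  from-subgroup : ∀ {x} → x ∈ subgroup → P x
  from-subgroup ⟨ e ⟩ = out e

full : ∀ {s} → Subgroup s
full = record { mem = λ _ → true ; 0∈ = refl ; +∈ = λ _ _ _ _ → refl ; -∈ = λ _ _ → refl }

∈-full : ∀ {s} {x : Vec ℤ s} → x ∈ full
∈-full = ⟨ refl ⟩

private
  trivial-dec : ∀ {s} → DecSubgroup s
  trivial-dec = record
    { P = _≡ 0ᵥ ; P? = _≟ᵥ 0ᵥ ; P0 = refl ; P+ = λ { refl refl → +-0ᵥ 0ᵥ }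
    ; P- = λ { refl → trans (sym (0-+ᵥ (-ᵥ 0ᵥ))) (x-x 0ᵥ) } }

  ∩-dec : ∀ {s} → Subgroup s → Subgroup s → DecSubgroup s
  ∩-dec A B = record
    { P = λ x → (x ∈ A) × (x ∈ B) ; P? = λ x → (x ∈? A) ×-dec (x ∈? B) ; P0 = 0-∈ , 0-∈
    ; P+ = λ { (a , b) (a′ , b′) → +-∈ a a′ , +-∈ b b′ } ; P- = λ { (a , b) → neg-∈ a , neg-∈ b } }

infixr 6 _∩_

-- Opaque, since otherwise `A ∩ B` would unfold to its decision procedure and unification could not
-- recover `A` and `B`.
abstract
  trivial : ∀ {s} → Subgroup s
  trivial = subgroup trivial-dec

  trivial⇒0 : ∀ {s} {x : Vec ℤ s} → x ∈ trivial → x ≡ 0ᵥ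
  trivial⇒0 = from-subgroup trivial-dec

  _∩_ : ∀ {s} → Subgroup s → Subgroup s → Subgroup s
  A ∩ B = subgroup (∩-dec A B)

  to-∩ : ∀ {s} {A B : Subgroup s} {x} → x ∈ A → x ∈ B → x ∈ A ∩ B
  to-∩ {A = A} {B} a b = to-subgroup (∩-dec A B) (a , b)

  ∩-fst : ∀ {s} {A B : Subgroup s} {x} → x ∈ A ∩ B → x ∈ A
  ∩-fst {A = A} {B} h = proj₁ (from-subgroup (∩-dec A B) h)

  ∩-snd : ∀ {s} {A B : Subgroup s} {x} → x ∈ A ∩ B → x ∈ B
  ∩-snd {A = A} {B} h = proj₂ (from-subgroup (∩-dec A B) h)

-- Residues of integers and invertibility modulo p

module _ (n : ℕ) .{{_ : NonZero n}} where

  ℤ-residue : ∀ j → ∃₂ λ (r : Fin n) l → j ≡ + toℕ r ℤ.+ l ℤ.* + n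
  ℤ-residue j = fromℕ< (n%ℕd<d j n) , j /ℕ n ,
    trans (a≡a%ℕn+[a/ℕn]*n j n) (cong (λ z → + z ℤ.+ j /ℕ n ℤ.* + n) (sym (Finₚ.toℕ-fromℕ< (n%ℕd<d j n))))

  -- Two residues differ by less than n in absolute value, and the only such multiple of n is 0.
  ℤ-residue-unique : ∀ (r r′ : Fin n) l → + toℕ r ℤ.- + toℕ r′ ≡ l ℤ.* + n → r ≡ r′
  ℤ-residue-unique r r′ l e = Finₚ.toℕ-injective (ℤₚ.+-injective (ℤₚ.i-j≡0⇒i≡j _ _ (ℤₚ.∣i∣≡0⇒i≡0 d≡0)))
    where
    d = ℤ.∣ + toℕ r ℤ.- + toℕ r′ ∣
    d<n : d ℕ.< n
    d<n = ℕₚ.≤-<-trans (subst (ℕ._≤ toℕ r ℕ.⊔ toℕ r′) (cong ℤ.∣_∣ (sym (ℤₚ.m-n≡m⊖n (toℕ r) (toℕ r′)))) (ℤₚ.∣m⊝n∣≤m⊔n (toℕ r) (toℕ r′)))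
            (ℕₚ.⊔-lub (Finₚ.toℕ<n r) (Finₚ.toℕ<n r′))
    d≡0 : d ≡ 0
    d≡0 with d in eq
    ... | zero  = refl
    ... | suc k = ⊥-elim (>⇒∤ (subst (ℕ._< n) eq d<n)
                    (divides ℤ.∣ l ∣ (trans (sym eq) (trans (cong ℤ.∣_∣ e) (ℤₚ.abs-* l (+ n))))))

module Lattice (p : ℕ) (pr : Prime p) where

  instance
    p≢0 : NonZero p
    p≢0 = prime⇒nonZero pr

  q : ℤ
  q = + p

  residue : ∀ j → ∃₂ λ (r : Fin p) l → j ≡ + toℕ r ℤ.+ l ℤ.* q
  residue = ℤ-residue p

  residue-unique : ∀ (r r′ : Fin p) l → + toℕ r ℤ.- + toℕ r′ ≡ l ℤ.* q → r ≡ r′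
  residue-unique = ℤ-residue-unique p

  -- This is where primality makes ℤ/p a field: a nonzero residue is coprime to p, and Bézout
  -- supplies its inverse, with two cases for the sign of the Bézout identity.
  multiple⊎invertible : ∀ j → (∃ λ l → j ≡ l ℤ.* q) ⊎ (∃₂ λ k l → k ℤ.* j ≡ 1ℤ ℤ.+ l ℤ.* q)
  multiple⊎invertible j with residue j
  ... | r , l , e with toℕ r | Finₚ.toℕ<n r
  ...   | zero  | _   = inj₁ (l , trans e (ℤₚ.+-identityˡ _))
  ...   | suc m | m<p with coprime-Bézout (prime⇒coprime pr m<p)
  ...     | Bézout.+- x y eq = inj₂ (ℤ.- + y , ℤ.- + x ℤ.- + y ℤ.* l , (begin
      ℤ.- + y ℤ.* j                                        ≡⟨ cong (ℤ.- + y ℤ.*_) e ⟩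
      ℤ.- + y ℤ.* (+ suc m ℤ.+ l ℤ.* q)                     ≡⟨ lem (+ y) (+ suc m) l q ⟩
      1ℤ ℤ.- (1ℤ ℤ.+ + y ℤ.* + suc m) ℤ.- + y ℤ.* l ℤ.* q   ≡⟨ cong (λ z → 1ℤ ℤ.- z ℤ.- + y ℤ.* l ℤ.* q) eq′ ⟩
      1ℤ ℤ.- + x ℤ.* q ℤ.- + y ℤ.* l ℤ.* q                  ≡⟨ lem₂ (+ x) (+ y) l q ⟩
      1ℤ ℤ.+ (ℤ.- + x ℤ.- + y ℤ.* l) ℤ.* q                  ∎))
    where
    open ≡-Reasoning
    eq′ : 1ℤ ℤ.+ + y ℤ.* + suc m ≡ + x ℤ.* q
    eq′ = trans (cong (λ z → 1ℤ ℤ.+ z) (sym (ℤₚ.pos-* y (suc m)))) (trans (cong +_ eq) (ℤₚ.pos-* x p))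
    lem : ∀ y m l q → ℤ.- y ℤ.* (m ℤ.+ l ℤ.* q) ≡ 1ℤ ℤ.- (1ℤ ℤ.+ y ℤ.* m) ℤ.- y ℤ.* l ℤ.* q
    lem = solve-∀
    lem₂ : ∀ x y l q → 1ℤ ℤ.- x ℤ.* q ℤ.- y ℤ.* l ℤ.* q ≡ 1ℤ ℤ.+ (ℤ.- x ℤ.- y ℤ.* l) ℤ.* q
    lem₂ = solve-∀
  ...     | Bézout.-+ x y eq = inj₂ (+ y , + x ℤ.+ + y ℤ.* l , (begin
      + y ℤ.* j                                ≡⟨ cong (+ y ℤ.*_) e ⟩
      + y ℤ.* (+ suc m ℤ.+ l ℤ.* q)             ≡⟨ ℤₚ.*-distribˡ-+ (+ y) (+ suc m) (l ℤ.* q) ⟩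
      + y ℤ.* + suc m ℤ.+ + y ℤ.* (l ℤ.* q)     ≡⟨ cong (ℤ._+ + y ℤ.* (l ℤ.* q)) eq′ ⟩
      1ℤ ℤ.+ + x ℤ.* q ℤ.+ + y ℤ.* (l ℤ.* q)    ≡⟨ lem (+ x) (+ y) l q ⟩
      1ℤ ℤ.+ (+ x ℤ.+ + y ℤ.* l) ℤ.* q          ∎))
    where
    open ≡-Reasoning
    eq′ : + y ℤ.* + suc m ≡ 1ℤ ℤ.+ + x ℤ.* q
    eq′ = trans (sym (ℤₚ.pos-* y (suc m))) (trans (cong +_ (sym eq)) (cong (λ z → 1ℤ ℤ.+ z) (ℤₚ.pos-* x p)))
    lem : ∀ x y l q → 1ℤ ℤ.+ x ℤ.* q ℤ.+ y ℤ.* (l ℤ.* q) ≡ 1ℤ ℤ.+ (x ℤ.+ y ℤ.* l) ℤ.* q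
    lem = solve-∀

-- Chains of subgroups of index p

module Flags (p : ℕ) (pr : Prime p) where
  open Lattice p pr

  q*-injective : ∀ {s} {x y : Vec ℤ s} → q *ᵥ x ≡ q *ᵥ y → x ≡ y
  q*-injective {x = []}    {[]}    e = refl
  q*-injective {x = x ∷ xs} {y ∷ ys} e =
    cong₂ _∷_ (ℤₚ.*-cancelˡ-≡ q x y (Vecₚ.∷-injectiveˡ e)) (q*-injective (Vecₚ.∷-injectiveʳ e))

  divide? : ∀ {s} (x : Vec ℤ s) → Dec (∃ λ y → x ≡ q *ᵥ y)
  divide? [] = yes ([] , refl)
  divide? (a ∷ x) with residue a | divide? x
  ... | _ | no ¬d = no λ { (y ∷ ys , e) → ¬d (ys , Vecₚ.∷-injectiveʳ e) }
  ... | r , l , e | yes (y , e′) with toℕ r in r≡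
  ...   | zero  = yes (l ∷ y , cong₂ _∷_ (trans e (trans (ℤₚ.+-identityˡ _) (ℤₚ.*-comm l q))) e′)
  ...   | suc m = no λ { (b ∷ _ , eq) → nope b (Vecₚ.∷-injectiveˡ eq) }
    where
    0F : Fin p
    0F = fromℕ< {0} (ℕ.>-nonZero⁻¹ p)
    toℕ-0F : toℕ 0F ≡ 0
    toℕ-0F = Finₚ.toℕ-fromℕ< (ℕ.>-nonZero⁻¹ p)
    lem : ∀ m b l q → m ℤ.+ l ℤ.* q ≡ q ℤ.* b → m ℤ.- + 0 ≡ (b ℤ.- l) ℤ.* q
    lem m b l q e = trans (lem₁ m l q) (trans (cong (ℤ._- l ℤ.* q) e) (lem₂ b l q))
      where
      lem₁ : ∀ m l q → m ℤ.- + 0 ≡ m ℤ.+ l ℤ.* q ℤ.- l ℤ.* q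
      lem₁ = solve-∀
      lem₂ : ∀ b l q → q ℤ.* b ℤ.- l ℤ.* q ≡ (b ℤ.- l) ℤ.* q
      lem₂ = solve-∀
    nope : ∀ b → ¬ (a ≡ q ℤ.* b)
    nope b eq with residue-unique r 0F (b ℤ.- l)
                     (trans (cong₂ (λ u v → + u ℤ.- + v) r≡ toℕ-0F) (lem (+ suc m) b l q (trans (sym e) eq)))
    ... | refl with trans (sym r≡) toℕ-0F
    ...   | ()

  private
    colon-dec : ∀ {s} → Subgroup s → DecSubgroup s
    colon-dec A = record
      { P = λ x → q *ᵥ x ∈ A ; P? = λ x → q *ᵥ x ∈? A ; P0 = ∈-resp (sym (*ᵥ-0 q)) 0-∈
      ; P+ = λ a b → ∈-resp (sym (*ᵥ-distribˡ q _ _)) (+-∈ a b)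
      ; P- = λ a → ∈-resp (sym (*ᵥ-neg q _)) (neg-∈ a) }

  abstract
    colon : ∀ {s} → Subgroup s → Subgroup s
    colon A = subgroup (colon-dec A)

    to-colon : ∀ {s} {A : Subgroup s} {x} → q *ᵥ x ∈ A → x ∈ colon A
    to-colon {A = A} = to-subgroup (colon-dec A)

    from-colon : ∀ {s} {A : Subgroup s} {x} → x ∈ colon A → q *ᵥ x ∈ A
    from-colon {A = A} = from-subgroup (colon-dec A)

  colon-⊒ : ∀ {s} {A : Subgroup s} → A ⊑ colon A
  colon-⊒ a = to-colon (*-∈ q a)

  colon-mono : ∀ {s} {A B : Subgroup s} → A ⊑ B → colon A ⊑ colon B
  colon-mono h x = to-colon (h (from-colon x))

  private
    dilate-dec : ∀ {s} → Subgroup s → DecSubgroup s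
    dilate-dec A = record
      { P = λ x → ∃ λ y → x ≡ q *ᵥ y × y ∈ A ; P? = dec ; P0 = 0ᵥ , sym (*ᵥ-0 q) , 0-∈
      ; P+ = λ { (y , refl , a) (z , refl , b) → y +ᵥ z , sym (*ᵥ-distribˡ q y z) , +-∈ a b }
      ; P- = λ { (y , refl , a) → -ᵥ y , sym (*ᵥ-neg q y) , neg-∈ a } }
      where
      dec : ∀ x → Dec (∃ λ y → x ≡ q *ᵥ y × y ∈ A)
      dec x with divide? x
      ... | no ¬d = no λ { (y , e , _) → ¬d (y , e) }
      ... | yes (y , e) with y ∈? A
      ...   | yes a = yes (y , e , a)
      ...   | no ¬a = no λ { (z , e′ , a) → ¬a (∈-resp (q*-injective (trans (sym e′) e)) a) }

  abstract
    dilate : ∀ {s} → Subgroup s → Subgroup s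
    dilate A = subgroup (dilate-dec A)

    to-dilate : ∀ {s} {A : Subgroup s} {x} → x ∈ A → q *ᵥ x ∈ dilate A
    to-dilate {A = A} a = to-subgroup (dilate-dec A) (_ , refl , a)

    from-dilate : ∀ {s} {A : Subgroup s} {x} → x ∈ dilate A → ∃ λ y → x ≡ q *ᵥ y × y ∈ A
    from-dilate {A = A} = from-subgroup (dilate-dec A)

  from-dilate* : ∀ {s} {A : Subgroup s} {x} → q *ᵥ x ∈ dilate A → x ∈ A
  from-dilate* h with from-dilate h
  ... | y , e , a = ∈-resp (sym (q*-injective e)) a

  dilate-mono : ∀ {s} {A B : Subgroup s} → A ⊑ B → dilate A ⊑ dilate B
  dilate-mono h x with from-dilate x
  ... | y , refl , a = to-dilate (h a)

  dilate-⊑ : ∀ {s} {A : Subgroup s} → dilate A ⊑ A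
  dilate-⊑ x with from-dilate x
  ... | y , refl , a = *-∈ q a

  -- Multiplication by p identifies A : p with the multiples of p that lie in A. Through this the
  -- rank of A, a length over `A ∩ pL`, becomes a length over p(A : p) and can be compared with
  -- dilated flags of A : p.
  dilate-colon : ∀ {s} {A : Subgroup s} → dilate (colon A) ≐ A ∩ dilate full
  dilate-colon {A = A} = (λ h → f (from-dilate h)) , (λ h → g (∩-fst h) (from-dilate (∩-snd h)))
    where
    f : ∀ {x} → (∃ λ y → x ≡ q *ᵥ y × y ∈ colon A) → x ∈ A ∩ dilate full
    f (y , refl , a) = to-∩ (from-colon a) (to-dilate ∈-full)
    g : ∀ {x} → x ∈ A → (∃ λ y → x ≡ q *ᵥ y × y ∈ full) → x ∈ dilate (colon A)
    g a (y , refl , _) = to-dilate (to-colon a)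

  module _ {s} (U : Subgroup s) (v : Vec ℤ s) (qv∈U : q *ᵥ v ∈ U) where

    private
      Q : Vec ℤ s → Set
      Q x = ∃ λ j → x ≈[ U ] j *ᵥ v

      reduce : ∀ {x} → Q x → ∃ λ (r : Fin p) → x ≈[ U ] (+ toℕ r) *ᵥ v
      reduce (j , e) with residue j
      ... | r , l , refl = r , ≈-trans e (≈-trans (≡⇒≈ (*ᵥ-distribʳ (+ toℕ r) (l ℤ.* q) v))
              (≈-+∈ (∈-resp (sym (*ᵥ-assoc l q v)) (*-∈ l qv∈U))))

      -- As pv ∈ U, the p residues of the coefficient exhaust the multiples of v modulo U, which
      -- leaves a finite search.
      Q? : ∀ x → Dec (Q x)
      Q? x = map′ (λ { (r , ⟨ d ⟩) → + toℕ r , ⟪ ⟨ d ⟩ ⟫ }) (λ y → let r , e = reduce y in r , diff e)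
               (Finₚ.any? (λ r → x -ᵥ (+ toℕ r) *ᵥ v ∈? U))

      Q+ : ∀ {x y} → Q x → Q y → Q (x +ᵥ y)
      Q+ (j , e) (k , f) = j ℤ.+ k , ≈-trans (≈-+ e f) (≡⇒≈ (sym (*ᵥ-distribʳ j k v)))

      Q0 : Q 0ᵥ
      Q0 = 0ℤ , ≡⇒≈ (sym (0*ᵥ v))

      Q- : ∀ {x} → Q x → Q (-ᵥ x)
      Q- {x} (j , e) = ℤ.- j , ≈-trans (≡⇒≈ (trans (cong -ᵥ_ (sym (1*ᵥ x))) (neg-*ᵥ 1ℤ x)))
        (≈-trans (≈-* (ℤ.- 1ℤ) e) (≡⇒≈ (trans (sym (neg-*ᵥ 1ℤ _)) (trans (cong -ᵥ_ (1*ᵥ _)) (neg-*ᵥ j v)))))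

      adjoin-dec : DecSubgroup s
      adjoin-dec = record { P = Q ; P? = Q? ; P0 = Q0 ; P+ = Q+ ; P- = Q- }

    abstract
      adjoin : Subgroup s
      adjoin = subgroup adjoin-dec

      to-adjoin : ∀ {x} j → x ≈[ U ] j *ᵥ v → x ∈ adjoin
      to-adjoin j e = to-subgroup adjoin-dec (j , e)

      from-adjoin : ∀ {x} → x ∈ adjoin → ∃ λ j → x ≈[ U ] j *ᵥ v
      from-adjoin = from-subgroup adjoin-dec

    ⊑-adjoin : U ⊑ adjoin
    ⊑-adjoin a = to-adjoin 0ℤ (≈-trans (∈⇒≈0 a) (≡⇒≈ (sym (0*ᵥ v))))

    ∈-adjoin : v ∈ adjoin
    ∈-adjoin = to-adjoin 1ℤ (≡⇒≈ (sym (1*ᵥ v)))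

    adjoin-least : ∀ {B} → U ⊑ B → v ∈ B → adjoin ⊑ B
    adjoin-least h b x = let j , e = from-adjoin x in ≈-∈ (≈-mono h e) (*-∈ j b)

  -- V/U is cyclic of order p, generated by the class of `v`. The generator is a parameter because
  -- later arguments replace it by a more convenient one.
  record Step {s} (U V : Subgroup s) (v : Vec ℤ s) : Set where
    field
      below   : U ⊑ V
      gen∈    : v ∈ V
      q*gen∈  : q *ᵥ v ∈ U
      gen∉    : v ∉ U
      span    : ∀ {x} → x ∈ V → ∃ λ j → x ≈[ U ] j *ᵥ v
  open Step public

  adjoin-step : ∀ {s} {U : Subgroup s} {v} (qv : q *ᵥ v ∈ U) → v ∉ U → Step U (adjoin U v qv) v
  adjoin-step qv v∉ = record { below = ⊑-adjoin _ _ qv ; gen∈ = ∈-adjoin _ _ qv ; q*gen∈ = qv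
                             ; gen∉ = v∉ ; span = from-adjoin _ _ qv }

  step-resp : ∀ {s} {U U′ V V′ : Subgroup s} {v} → U ≐ U′ → V ≐ V′ → Step U V v → Step U′ V′ v
  step-resp (u , u′) (w , w′) st = record
    { below = λ a → w (below st (u′ a)) ; gen∈ = w (gen∈ st) ; q*gen∈ = u (q*gen∈ st)
    ; gen∉ = λ a → gen∉ st (u′ a) ; span = λ a → let j , e = span st (w′ a) in j , ≈-mono u e }

  module _ {s} {U V : Subgroup s} {v} (st : Step U V v) where

    -- If j were invertible modulo p, then multiplying by its inverse would put v into U.
    multiple-of-gen∈ : ∀ {j} → j *ᵥ v ∈ U → ∃ λ l → j ≡ l ℤ.* q
    multiple-of-gen∈ {j} h with multiple⊎invertible j
    ... | inj₁ d = d
    ... | inj₂ (k , l , e) = ⊥-elim (gen∉ st (≈-∈ v≈ (*-∈ k h)))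
      where
      v≈ : v ≈[ U ] k *ᵥ (j *ᵥ v)
      v≈ = ≈-sym (≈-trans (≡⇒≈ (trans (sym (*ᵥ-assoc k j v)) (trans (cong (_*ᵥ v) e) (*ᵥ-distribʳ 1ℤ (l ℤ.* q) v))))
             (≈-trans (≈-+∈ (∈-resp (sym (*ᵥ-assoc l q v)) (*-∈ l (q*gen∈ st)))) (≡⇒≈ (1*ᵥ v))))

    q*∈ : ∀ {x} → x ∈ V → q *ᵥ x ∈ U
    q*∈ x∈ = let j , e = span st x∈ in
      ≈-∈ (≈-trans (≈-* q e) (≡⇒≈ (*ᵥ-comm q j v))) (*-∈ j (q*gen∈ st))

    -- The coefficient of b with respect to v is invertible modulo p, so every nonzero class of V/U
    -- generates it.
    gen≈multiple : ∀ {b} → b ∈ V → b ∉ U → ∃ λ k → v ≈[ U ] k *ᵥ b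
    gen≈multiple {b} b∈ b∉ with span st b∈
    ... | j , b≈ with multiple⊎invertible j
    ...   | inj₁ (l , refl) = ⊥-elim (b∉ (≈-∈ b≈ (∈-resp (sym (*ᵥ-assoc l q v)) (*-∈ l (q*gen∈ st)))))
    ...   | inj₂ (k , l , e) = k , ≈-sym (≈-trans (≈-* k b≈)
              (≈-trans (≡⇒≈ (trans (sym (*ᵥ-assoc k j v)) (trans (cong (_*ᵥ v) e) (*ᵥ-distribʳ 1ℤ (l ℤ.* q) v))))
              (≈-trans (≈-+∈ (∈-resp (sym (*ᵥ-assoc l q v)) (*-∈ l (q*gen∈ st)))) (≡⇒≈ (1*ᵥ v)))))

    change-gen : ∀ {b} → b ∈ V → b ∉ U → Step U V b
    change-gen {b} b∈ b∉ = record
      { below = below st ; gen∈ = b∈ ; q*gen∈ = q*∈ b∈ ; gen∉ = b∉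
      ; span = λ x∈ → let k , v≈ = gen≈multiple b∈ b∉ ; j , x≈ = span st x∈ in
          j ℤ.* k , ≈-trans x≈ (≈-trans (≈-* j v≈) (≡⇒≈ (sym (*ᵥ-assoc j k b)))) }

    restrict-step : ∀ {B} → B ⊑ V → v ∈ B → Step (B ∩ U) B v
    restrict-step h b = record
      { below = ∩-fst ; gen∈ = b ; q*gen∈ = to-∩ (*-∈ q b) (q*gen∈ st) ; gen∉ = λ a → gen∉ st (∩-snd a)
      ; span = λ x∈ → let j , e = span st (h x∈) in j , ⟪ to-∩ (diff-∈ x∈ (*-∈ j b)) (diff e) ⟫ }

  -- A composition series witnessing [V : U] = p^n. V/U need not be elementary abelian: the same
  -- notion measures dimensions over the field with p elements and the index of a subgroup in the
  -- whole lattice.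
  data Flag {s} (U : Subgroup s) : Subgroup s → ℕ → Set where
    stop : ∀ {V} → U ≐ V → Flag U V 0
    _▸_  : ∀ {V′ V n v} → Flag U V′ n → Step V′ V v → Flag U V (suc n)
  infixl 5 _▸_

  flag-⊑ : ∀ {s n} {U V : Subgroup s} → Flag U V n → U ⊑ V
  flag-⊑ (stop e)  a = fwd e a
  flag-⊑ (f ▸ st) a = below st (flag-⊑ f a)

  flag-respʳ : ∀ {s n} {U V V′ : Subgroup s} → V ≐ V′ → Flag U V n → Flag U V′ n
  flag-respʳ e (stop e′) = stop (≐-trans e′ e)
  flag-respʳ e (f ▸ st)  = f ▸ step-resp ≐-refl e st

  flag-respˡ : ∀ {s n} {U U′ V : Subgroup s} → U ≐ U′ → Flag U V n → Flag U′ V n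
  flag-respˡ e (stop e′) = stop (≐-trans (≐-sym e) e′)
  flag-respˡ e (f ▸ st)  = flag-respˡ e f ▸ st

  _++ᶠ_ : ∀ {s m n} {U V W : Subgroup s} → Flag U V m → Flag V W n → Flag U W (n ℕ.+ m)
  f ++ᶠ stop e   = flag-respʳ e f
  f ++ᶠ (g ▸ st) = (f ++ᶠ g) ▸ st

  -- Flags are built at the top; the induction for elementary divisors needs the step at the bottom.
  uncons : ∀ {s n} {U V : Subgroup s} → Flag U V (suc n) → ∃₂ λ U′ v → Step U U′ v × Flag U′ V n
  uncons (stop e ▸ st) = _ , _ , step-resp (≐-sym e) ≐-refl st , stop ≐-refl
  uncons (f@(_ ▸ _) ▸ st) = let U′ , v , st′ , g = uncons f in U′ , v , st′ , (g ▸ st)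

  private
    all⊎any : ∀ n {A B : Fin n → Set} → (∀ i → A i ⊎ B i) → (∀ i → A i) ⊎ ∃ B
    all⊎any zero    h = inj₁ λ ()
    all⊎any (suc n) h with h zero | all⊎any n (h ∘ suc)
    ... | inj₂ b | _            = inj₂ (zero , b)
    ... | inj₁ a | inj₂ (i , b) = inj₂ (suc i , b)
    ... | inj₁ a | inj₁ as      = inj₁ λ { zero → a ; (suc i) → as i }

  span-residue : ∀ {s} {U V : Subgroup s} {v} → Step U V v → ∀ {x} → x ∈ V → ∃ λ (r : Fin p) → x ≈[ U ] (+ toℕ r) *ᵥ v
  span-residue {v = v} st x∈ with span st x∈
  ... | j , e with residue j
  ...   | r , l , refl = r , ≈-trans e (≈-trans (≡⇒≈ (*ᵥ-distribʳ (+ toℕ r) (l ℤ.* q) v))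
              (≈-+∈ (∈-resp (sym (*ᵥ-assoc l q v)) (*-∈ l (q*gen∈ st)))))

  -- A property invariant modulo U need only be tested on p translates at each step of the flag, so
  -- a quantifier over the infinite group V is decidable.
  flag-search : ∀ {s n} {U V : Subgroup s} → Flag U V n → (P : Vec ℤ s → Set) → (∀ x → Dec (P x)) →
                (∀ {x y} → x ≈[ U ] y → P y → P x) →
                (∀ {x} → x ∈ V → P x) ⊎ (∃ λ x → (x ∈ V) × ¬ P x)
  flag-search (stop e) P P? resp with P? 0ᵥ
  ... | yes p0 = inj₁ λ x∈ → resp (∈⇒≈0 (bwd e x∈)) p0
  ... | no ¬p0 = inj₂ (0ᵥ , 0-∈ , ¬p0)
  flag-search {s} {V = V} (_▸_ {v = v} f st) P P? resp
    with all⊎any p (λ r → flag-search f (λ x → P (x +ᵥ (+ toℕ r) *ᵥ v)) (λ x → P? _) (λ e → resp (≈-+ e ≈-refl)))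
  ... | inj₁ h = inj₁ λ {x} x∈ → let r , e = span-residue st x∈ in
                   resp (≡⇒≈ (sym (diff-cancel x _))) (h r (diff e))
  ... | inj₂ (r , x , x∈ , ¬px) = inj₂ (x +ᵥ (+ toℕ r) *ᵥ v , +-∈ (below st x∈) (*-∈ (+ toℕ r) (gen∈ st)) , ¬px)

  ⊑-or-witness : ∀ {s n} {U V : Subgroup s} → Flag U V n → (B C : Subgroup s) → U ⊑ B → B ⊑ V → U ⊑ C →
                 (B ⊑ C) ⊎ (∃ λ x → (x ∈ B) × (x ∉ C))
  ⊑-or-witness f B C UB BV UC
    with flag-search f (λ x → (x ∈ B → x ∈ C)) dec (λ e h b → ≈-∈ (≈-mono UC e) (h (≈-∈ (≈-mono UB (≈-sym e)) b)))
    where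
    dec : ∀ x → Dec (x ∈ B → x ∈ C)
    dec x with x ∈? B | x ∈? C
    ... | _     | yes c = yes λ _ → c
    ... | yes b | no ¬c = no λ h → ¬c (h b)
    ... | no ¬b | no ¬c = yes λ b → ⊥-elim (¬b b)
  ... | inj₁ h = inj₁ λ b → h (BV b) b
  ... | inj₂ (x , _ , ¬h) with x ∈? B | x ∈? C
  ...   | _     | yes c = ⊥-elim (¬h λ _ → c)
  ...   | yes b | no ¬c = inj₂ (x , b , ¬c)
  ...   | no ¬b | no ¬c = ⊥-elim (¬h λ b → ⊥-elim (¬b b))

  -- Because b ∉ Y and pb ∈ X, a multiple of b lies in Y only if it already lies in X. Hence (X +
  -- ℤb) ∩ Y = X, and the second isomorphism theorem gives (Y + ℤb)/(X + ℤb) ≅ Y/X.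
  translate : ∀ {s n} {X Y : Subgroup s} {b} → Flag X Y n → (qb : q *ᵥ b ∈ X) (qb′ : q *ᵥ b ∈ Y) → b ∉ Y →
              Flag (adjoin X b qb) (adjoin Y b qb′) n
  translate {X = X} {b = b} (stop e) qb qb′ b∉ = stop
    ( (λ x → let j , e′ = from-adjoin X b qb x in to-adjoin _ b qb′ j (≈-mono (fwd e) e′))
    , (λ x → let j , e′ = from-adjoin _ b qb′ x in to-adjoin _ b qb j (≈-mono (bwd e) e′)))
  translate {X = X} {Y} {b} (_▸_ {V′ = Z} {v = v} f st) qb qb′ b∉ = translate f qb qbZ (λ h → b∉ (below st h)) ▸ record
    { below = λ x → let j , e = from-adjoin Z b qbZ x in to-adjoin Y b qb′ j (≈-mono (below st) e)
    ; gen∈ = ⊑-adjoin Y b qb′ (gen∈ st)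
    ; q*gen∈ = ⊑-adjoin Z b qbZ (q*gen∈ st)
    ; gen∉ = gen∉′
    ; span = span′ }
    where
    qbZ : q *ᵥ b ∈ Z
    qbZ = flag-⊑ f qb
    gen∉′ : v ∉ adjoin Z b qbZ
    gen∉′ h with from-adjoin Z b qbZ h
    ... | j , e with multiple-of-gen∈ (adjoin-step qb′ b∉) {j} (≈-∈ (≈-sym (≈-mono (below st) e)) (gen∈ st))
    ...   | l , refl = gen∉ st (≈-∈ e (∈-resp (sym (*ᵥ-assoc l q b)) (*-∈ l qbZ)))
    span′ : ∀ {x} → x ∈ adjoin Y b qb′ → ∃ λ j → x ≈[ adjoin Z b qbZ ] j *ᵥ v
    span′ {x} h with from-adjoin Y b qb′ h
    ... | i , e with span st (diff e)
    ...   | j , e′ = j , ≈-trans (≡⇒≈ (sym (diff-cancel x (i *ᵥ b))))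
              (≈-trans (≈-+∈ (*-∈ i (∈-adjoin Z b qbZ))) (≈-mono (⊑-adjoin Z b qbZ) e′))

  split-flag : ∀ {s N} {U V : Subgroup s} → Flag U V N → (B : Subgroup s) → U ⊑ B → B ⊑ V →
               ∃₂ λ k d → k ℕ.+ d ≡ N × Flag U B k × Flag B V d
  split-flag (stop e) B UB BV =
    0 , 0 , refl , stop (UB , (λ b → bwd e (BV b))) , stop (BV , (λ v → UB (bwd e v)))
  split-flag {U = U} {V} f@(_▸_ {V′ = V′} {v = v} f′ st) B UB BV with ⊑-or-witness f B V′ UB BV (flag-⊑ f′)
  ... | inj₁ BV′ = let k , d , e , g , h = split-flag f′ B UB BV′ in
      k , suc d , trans (ℕₚ.+-suc k d) (cong suc e) , g , (h ▸ st)
  ... | inj₂ (b , b∈B , b∉V′) =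
    let k , d , e , g , h = split-flag f′ (B ∩ V′) (λ u → to-∩ (UB u) (flag-⊑ f′ u)) ∩-snd
    in suc k , d , cong suc e , (g ▸ stB) ,
       flag-respˡ (adjoin-least (B ∩ V′) b qb ∩-fst b∈B , λ x → let j , e = span stB x in to-adjoin _ b qb j e)
         (flag-respʳ (adjoin-least V′ b (q*gen∈ stV) (below st) (BV b∈B) , λ x → let j , e = span stV x in to-adjoin _ b _ j e)
           (translate h qb (q*gen∈ stV) b∉V′))
    where
    stV : Step V′ V b
    stV = change-gen st (BV b∈B) b∉V′
    stB : Step (B ∩ V′) B b
    stB = restrict-step stV BV b∈B
    qb : q *ᵥ b ∈ B ∩ V′
    qb = q*gen∈ stB

  Cosets : ∀ {s} → Subgroup s → Subgroup s → ℕ → Set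
  Cosets U V = HasCard (∃ (_∈ V)) (λ x y → proj₁ x ≈[ U ] proj₁ y)

  -- The residue of the coefficient of the last generator sorts the cosets into p fibres, each of
  -- them a translate of V′/U.
  flag-card : ∀ {s n} {U V : Subgroup s} → Flag U V n → Cosets U V (p ^ n)
  flag-card {U = U} (stop e) = hc-singleton {_≈_ = λ x y → proj₁ x ≈[ U ] proj₁ y} (0ᵥ , 0-∈) λ { (x , x∈) → ≈-sym (∈⇒≈0 (bwd e x∈)) }
  flag-card {s} {suc n} {U} {V} (_▸_ {V′ = V′} {v = v} f st) = subst (Cosets U V) (sumF-const p (p ^ n))
    (hc-Σ {_~_ = _≡_} sym trans ((λ r → r) , (λ i j e → e) , λ r → r , refl) π
      (λ {x} {y} e → π-unique x (≈-trans (≈-mono (flag-⊑ f) e) (π-≈ y))) fibre)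
    where
    π : ∃ (_∈ V) → Fin p
    π (x , x∈) = proj₁ (span-residue st x∈)
    π-≈ : ∀ x → proj₁ x ≈[ V′ ] (+ toℕ (π x)) *ᵥ v
    π-≈ (x , x∈) = proj₂ (span-residue st x∈)
    π-unique : ∀ x {r} → proj₁ x ≈[ V′ ] (+ toℕ r) *ᵥ v → π x ≡ r
    π-unique x {r} e = let l , e′ = multiple-of-gen∈ st
                                       (∈-resp (trans (cong ((+ toℕ (π x)) *ᵥ v +ᵥ_) (neg-*ᵥ (+ toℕ r) v))
                                          (sym (*ᵥ-distribʳ (+ toℕ (π x)) (ℤ.- + toℕ r) v)))
                                          (diff (≈-trans (≈-sym (π-≈ x)) e)))
                       in residue-unique (π x) r l e′
    fibre : ∀ r → HasCard (Σ (∃ (_∈ V)) λ x → r ≡ π x) (λ x y → proj₁ (proj₁ x) ≈[ U ] proj₁ (proj₁ y)) (p ^ n)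
    fibre r = hc-map (flag-card f) to (λ e → ≈-+ e ≈-refl)
        (λ {x} {y} e → ≈-trans (≡⇒≈ (sym (cancel (proj₁ x)))) (≈-trans (≈-+ e (≈-refl {x = -ᵥ rv})) (≡⇒≈ (cancel (proj₁ y)))))
        ≈-trans from
      where
      rv = (+ toℕ r) *ᵥ v
      cancel : ∀ x → (x +ᵥ rv) -ᵥ rv ≡ x
      cancel x = trans (+ᵥ-assoc x rv (-ᵥ rv)) (trans (cong (x +ᵥ_) (x-x rv)) (+-0ᵥ x))
      to : ∃ (_∈ V′) → Σ (∃ (_∈ V)) λ x → r ≡ π x
      to (x , x∈) = y , sym (π-unique y (≈-trans (≡⇒≈ (+ᵥ-comm x rv)) (≈-+∈ x∈)))
        where y = x +ᵥ rv , +-∈ (below st x∈) (*-∈ (+ toℕ r) (gen∈ st))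
      from : ∀ y → ∃ λ x → proj₁ (proj₁ (to x)) ≈[ U ] proj₁ (proj₁ y)
      from (y , refl) = (proj₁ y -ᵥ rv , diff (π-≈ y)) , ≡⇒≈ (diff-cancel (proj₁ y) rv)

  ^-injective : ∀ m n → p ^ m ≡ p ^ n → m ≡ n
  ^-injective m n e with ℕₚ.<-cmp m n
  ... | tri≈ _ m≡n _ = m≡n
  ... | tri< m<n _ _ = ⊥-elim (ℕₚ.<⇒≢ (ℕₚ.^-monoʳ-< p 1<p m<n) e)
    where 1<p = ℕ.nonTrivial⇒n>1 p {{prime⇒nonTrivial pr}}
  ... | tri> _ _ n<m = ⊥-elim (ℕₚ.<⇒≢ (ℕₚ.^-monoʳ-< p 1<p n<m) (sym e))
    where 1<p = ℕ.nonTrivial⇒n>1 p {{prime⇒nonTrivial pr}}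

  -- Both lengths are read off from the number of cosets, which replaces a Jordan-Hölder exchange
  -- argument.
  flag-unique : ∀ {s m n} {U V : Subgroup s} → Flag U V m → Flag U V n → m ≡ n
  flag-unique {m = m} {n} f g = ^-injective m n (hc-unique ≈-sym ≈-trans (flag-card f) (flag-card g))

  quotient-flag : ∀ {s N k} {U B V : Subgroup s} → Flag U V N → Flag U B k → B ⊑ V →
                  ∃ λ d → k ℕ.+ d ≡ N × Flag B V d
  quotient-flag f g BV with split-flag f _ (flag-⊑ g) BV
  ... | k , d , e , g′ , h rewrite flag-unique g g′ = d , e , h

  sub-flag : ∀ {s N d} {U B V : Subgroup s} → Flag U V N → Flag B V d → U ⊑ B →
             ∃ λ k → k ℕ.+ d ≡ N × Flag U B k
  sub-flag f g UB with split-flag f _ UB (flag-⊑ g)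
  ... | k , d , e , h , g′ rewrite flag-unique g g′ = k , e , h

  step-sub-flag : ∀ {s k} {U B′ B : Subgroup s} {b} → Flag U B (suc k) → Step B′ B b → U ⊑ B′ → Flag U B′ k
  step-sub-flag {k = k} {U} {B′} {B} f st UB′ = helper (sub-flag f one UB′)
    where
    one : Flag B′ B 1
    one = stop ≐-refl ▸ st
    helper : (∃ λ k′ → k′ ℕ.+ 1 ≡ suc k × Flag U B′ k′) → Flag U B′ k
    helper (k′ , e , g) = subst (Flag U B′) (ℕₚ.suc-injective (trans (ℕₚ.+-comm 1 k′) e)) g

-- Subspaces meeting a given subspace trivially

-- Equal to p^(w k) times the Gaussian binomial coefficient [n choose k] at p.
complements : ℕ → ℕ → ℕ → ℕ → ℕ
complements p w zero    zero    = 1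
complements p w zero    (suc k) = 0
complements p w (suc n) zero    = complements p w n zero
complements p w (suc n) (suc k) = complements p w n (suc k) ℕ.+ complements p w n k ℕ.* p ^ (w ℕ.+ n ℕ.∸ k)

module Complements (p : ℕ) (pr : Prime p) where
  open Lattice p pr
  open Flags p pr

  -- When pV ⊆ U, these are the k-dimensional subspaces of V/U meeting W/U in 0; k may be smaller
  -- than the codimension of W/U.
  record Complement {s} (U W V : Subgroup s) (k : ℕ) : Set where
    field
      grp   : Subgroup s
      lower : U ⊑ grp
      upper : grp ⊑ V
      meet  : ∀ {x} → x ∈ grp → x ∈ W → x ∈ U
      dim   : Flag U grp k
  open Complement public

  _≐ᶜ_ : ∀ {s k} {U W V : Subgroup s} → Complement U W V k → Complement U W V k → Set
  B ≐ᶜ C = grp B ≐ grp C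

  module _ {s w} {U W : Subgroup s} (fUW : Flag U W w) where

    private
      -- V′ is a hyperplane of V containing W. A complement in V either lies in V′ or meets V′ in a
      -- complement of one dimension less; the two cases are the two summands in the recurrence of
      -- `complements`.
      module Inductive {V′ V n v} (f : Flag W V′ n) (st : Step V′ V v) (el : ∀ {x} → x ∈ V → q *ᵥ x ∈ U) where

        fUV′ : Flag U V′ (n ℕ.+ w)
        fUV′ = fUW ++ᶠ f

        fUV : Flag U V (suc n ℕ.+ w)
        fUV = fUW ++ᶠ (f ▸ st)

        Inside : ∀ {k} → Complement U W V k → Set
        Inside B = ∀ x → x ∈ grp B → x ∈ V′

        inside? : ∀ {k} (B : Complement U W V k) → (grp B ⊑ V′) ⊎ (∃ λ b → (b ∈ grp B) × (b ∉ V′))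
        inside? B = ⊑-or-witness fUV (grp B) V′ (lower B) (upper B) (flag-⊑ fUV′)

        Inside? : ∀ {k} (B : Complement U W V k) → Dec (Inside B)
        Inside? B with inside? B
        ... | inj₁ h            = yes λ x → h
        ... | inj₂ (b , b∈ , b∉) = no λ h → b∉ (h b b∈)

        inside-card : ∀ {k N} → HasCard (Complement U W V′ k) _≐ᶜ_ N →
                      HasCard (Σ (Complement U W V k) Inside) (λ x y → proj₁ x ≐ᶜ proj₁ y) N
        inside-card h = hc-map h
          (λ B → record { grp = grp B ; lower = lower B ; upper = λ x → below st (upper B x) ; meet = meet B ; dim = dim B } , λ x → upper B)
          (λ e → e) (λ e → e) ≐-trans
          (λ { (B , h) → record { grp = grp B ; lower = lower B ; upper = h _ ; meet = meet B ; dim = dim B } , ≐-refl })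

        outside-gen : ∀ {k} (B : Complement U W V k) → ¬ Inside B → ∃ λ b → (b ∈ grp B) × (b ∉ V′)
        outside-gen B ¬h with inside? B
        ... | inj₁ h = ⊥-elim (¬h λ x → h)
        ... | inj₂ b = b

        outside-step : ∀ {k} (B : Complement U W V k) {b} → b ∈ grp B → b ∉ V′ → Step (grp B ∩ V′) (grp B) b
        outside-step B b∈ b∉ = restrict-step (change-gen st (upper B b∈) b∉) (upper B) b∈

        trace : ∀ {k} → Σ (Complement U W V (suc k)) (λ B → ¬ Inside B) → Complement U W V′ k
        trace {k} (B , ¬h) = record
          { grp = grp B ∩ V′ ; lower = λ u → to-∩ (lower B u) (flag-⊑ fUV′ u) ; upper = ∩-snd
          ; meet = λ x → meet B (∩-fst x) ; dim = dim′ }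
          where
          dim′ : Flag U (grp B ∩ V′) k
          dim′ with outside-gen B ¬h
          ... | b , b∈ , b∉ = step-sub-flag (dim B) (outside-step B b∈ b∉) (λ u → to-∩ (lower B u) (flag-⊑ fUV′ u))

        module _ {k} (B₀ : Complement U W V′ k) where

          private
            q*∈B₀ : ∀ {x} → x ∈ V → q *ᵥ x ∈ grp B₀
            q*∈B₀ x = lower B₀ (el x)

            v+ : ∀ {h} → h ∈ V′ → v +ᵥ h ∈ V
            v+ h∈ = +-∈ (gen∈ st) (below st h∈)

            v+∉ : ∀ {h} → h ∈ V′ → v +ᵥ h ∉ V′
            v+∉ h∈ x = gen∉ st (≈-∈ (≈-sym (≈-+∈ h∈)) x)

            ext : ∀ h → h ∈ V′ → Subgroup s
            ext h h∈ = adjoin (grp B₀) (v +ᵥ h) (q*∈B₀ (v+ h∈))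

            ext∩V′ : ∀ {h} (h∈ : h ∈ V′) {x} → x ∈ ext h h∈ → x ∈ V′ → x ∈ grp B₀
            ext∩V′ {h} h∈ x∈ x∈V′ with from-adjoin (grp B₀) (v +ᵥ h) (q*∈B₀ (v+ h∈)) x∈
            ... | j , e with multiple-of-gen∈ (change-gen st (v+ h∈) (v+∉ h∈)) {j} (≈-∈ (≈-sym (≈-mono (upper B₀) e)) x∈V′)
            ...   | l , refl = ≈-∈ e (∈-resp (sym (*ᵥ-assoc l q _)) (*-∈ l (q*∈B₀ (v+ h∈))))

            extend : ∃ (_∈ V′) → Σ (Σ (Complement U W V (suc k)) (λ B → ¬ Inside B)) λ x → B₀ ≐ᶜ trace x
            extend (h , h∈) = (record
              { grp = ext h h∈ ; lower = λ u → ⊑-adjoin _ _ _ (lower B₀ u)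
              ; upper = adjoin-least _ _ _ (λ x → below st (upper B₀ x)) (v+ h∈)
              ; meet = λ x x∈W → meet B₀ (ext∩V′ h∈ x (flag-⊑ f x∈W)) x∈W
              ; dim = dim B₀ ▸ adjoin-step _ (λ x → v+∉ h∈ (upper B₀ x)) }
              , λ ins → v+∉ h∈ (ins _ (∈-adjoin _ _ _))) ,
              (λ x → to-∩ (⊑-adjoin _ _ _ x) (upper B₀ x)) , (λ x → ext∩V′ h∈ (∩-fst x) (∩-snd x))

            ext-mono : ∀ {h h′} (h∈ : h ∈ V′) (h′∈ : h′ ∈ V′) → h ≈[ grp B₀ ] h′ → ext h h∈ ⊑ ext h′ h′∈
            ext-mono h∈ h′∈ e x = let j , e′ = from-adjoin _ _ _ x in
              to-adjoin _ _ _ j (≈-trans e′ (≈-* j (≈-+ ≈-refl e)))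

            -- The difference of the generators v + h and v + h′ lies in V′, and an extension meets
            -- V′ only in B₀.
            ext-injective : ∀ {h h′} (h∈ : h ∈ V′) (h′∈ : h′ ∈ V′) → ext h h∈ ⊑ ext h′ h′∈ → h ≈[ grp B₀ ] h′
            ext-injective {h} {h′} h∈ h′∈ i = ⟪ ext∩V′ h′∈ (∈-resp lem (diff-∈ (i (∈-adjoin _ _ _)) (∈-adjoin _ _ _))) (diff-∈ h∈ h′∈) ⟫
              where
              lem : (v +ᵥ h) -ᵥ (v +ᵥ h′) ≡ h -ᵥ h′
              lem = trans (sym (diff-interchange v v h h′)) (trans (cong (_+ᵥ (h -ᵥ h′)) (x-x v)) (0-+ᵥ _))

            extend-surj : (y : Σ (Σ (Complement U W V (suc k)) (λ B → ¬ Inside B)) λ x → B₀ ≐ᶜ trace x) → ∃ λ h → grp (proj₁ (proj₁ (extend h))) ≐ grp (proj₁ (proj₁ y))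
            extend-surj ((B , ¬h) , e) = (h , h∈) ,
                adjoin-least _ _ _ (λ x → ∩-fst (fwd e x)) v+h∈B ,
                λ x → let j , e′ = span stB x in to-adjoin _ _ _ j (≈-mono (bwd e) e′)
              where
              b = proj₁ (outside-gen B ¬h)
              b∈ = proj₁ (proj₂ (outside-gen B ¬h))
              b∉ = proj₂ (proj₂ (outside-gen B ¬h))
              -- Some multiple of b is congruent to v modulo V′; taking it as the generator of B
              -- over B ∩ V′ gives it the normal form v + h.
              i = gen≈multiple st (upper B b∈) b∉
              h = proj₁ i *ᵥ b -ᵥ v
              h∈ : h ∈ V′
              h∈ = diff (≈-sym (proj₂ i))
              v+h : proj₁ i *ᵥ b ≡ v +ᵥ h
              v+h = trans (sym (diff-cancel _ v)) (+ᵥ-comm _ v)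
              v+h∈B : v +ᵥ h ∈ grp B
              v+h∈B = ∈-resp v+h (*-∈ (proj₁ i) b∈)
              stB : Step (grp B ∩ V′) (grp B) (v +ᵥ h)
              stB = outside-step B v+h∈B (v+∉ h∈)

          -- The groups with trace B₀ are B₀ + ℤ(v + h) for h in V′ modulo B₀. Over U the lengths of
          -- V′ and B₀ are w + n and k, whence the exponent.
          fibre : HasCard (Σ (Σ (Complement U W V (suc k)) (λ B → ¬ Inside B)) λ x → B₀ ≐ᶜ trace x)
                    (λ x y → proj₁ (proj₁ x) ≐ᶜ proj₁ (proj₁ y)) (p ^ (w ℕ.+ n ℕ.∸ k))
          fibre with quotient-flag fUV′ (dim B₀) (upper B₀)
          ... | d , e , g = hc-map (subst (λ z → Cosets (grp B₀) V′ (p ^ z)) d≡ (flag-card g)) extend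
                (λ {x} {y} e → ext-mono (proj₂ x) (proj₂ y) e , ext-mono (proj₂ y) (proj₂ x) (≈-sym e))
                (λ {x} {y} e → ext-injective (proj₂ x) (proj₂ y) (fwd e)) ≐-trans extend-surj
            where
            d≡ : d ≡ w ℕ.+ n ℕ.∸ k
            d≡ = trans (sym (ℕₚ.m+n∸m≡n k d)) (cong (ℕ._∸ k) (trans e (ℕₚ.+-comm n w)))

        outside-card : ∀ {k N} → HasCard (Complement U W V′ k) _≐ᶜ_ N →
                       HasCard (Σ (Complement U W V (suc k)) (λ B → ¬ Inside B)) (λ x y → proj₁ x ≐ᶜ proj₁ y) (N ℕ.* p ^ (w ℕ.+ n ℕ.∸ k))
        outside-card {k} {N} h = subst (HasCard _ (λ x y → proj₁ x ≐ᶜ proj₁ y)) (sumF-const N (p ^ (w ℕ.+ n ℕ.∸ k)))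
          (hc-Σ ≐-sym ≐-trans h trace
            (λ e → (λ x → to-∩ (fwd e (∩-fst x)) (∩-snd x)) , (λ x → to-∩ (bwd e (∩-fst x)) (∩-snd x)))
            (λ i → fibre (proj₁ h i)))

        inside-resp : ∀ {k} {B C : Complement U W V k} → B ≐ᶜ C → Inside B → Inside C
        inside-resp e h x c = h x (bwd e c)

    count-complements : ∀ {V n} → Flag W V n → (∀ {x} → x ∈ V → q *ᵥ x ∈ U) → ∀ k →
                        HasCard (Complement U W V k) _≐ᶜ_ (complements p w n k)
    count-complements {V} (stop e) el zero = hc-singleton {_≈_ = _≐ᶜ_}
      (record { grp = U ; lower = λ u → u ; upper = λ u → fwd e (flag-⊑ fUW u) ; meet = λ u _ → u ; dim = stop ≐-refl })
      (λ B → lower B , λ b → meet B b (bwd e (upper B b)))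
    -- With W = V, meeting W in U forces the complement to be U, which has length 0 over itself.
    count-complements {V} (stop e) el (suc k) = hc-empty {_≈_ = _≐ᶜ_} λ B →
      ℕₚ.0≢1+n (flag-unique (stop (lower B , λ b → meet B b (bwd e (upper B b)))) (dim B))
    count-complements {V} {suc n} (f ▸ st) el zero = subst (HasCard _ _≐ᶜ_) (ℕₚ.+-identityʳ _)
      (hc-⊎ {_≈_ = _≐ᶜ_} Inside? (λ {B} {C} → inside-resp {B = B} {C}) ≐-sym (inside-card (count-complements f (λ x → el (below st x)) zero))
        (hc-empty {_≈_ = λ x y → proj₁ x ≐ᶜ proj₁ y} λ { (B , ¬h) → ¬h (in-U B (dim B)) }))
      where
      open Inductive f st el
      in-U : (B : Complement U W V 0) → Flag U (grp B) 0 → Inside B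
      in-U B (stop e) x b = flag-⊑ fUV′ (bwd e b)
    count-complements {V} {suc n} (f ▸ st) el (suc k) =
      hc-⊎ {_≈_ = _≐ᶜ_} Inside? (λ {B} {C} → inside-resp {B = B} {C}) ≐-sym (inside-card (count-complements f (λ x → el (below st x)) (suc k)))
        (outside-card (count-complements f (λ x → el (below st x)) k))
      where open Inductive f st el

-- Subgroups with given ranks

-- The default s is the rank of the whole lattice, which the iterated colon has reached when the
-- sequence ends.
headOr : ∀ {N} → ℕ → Vec ℕ N → ℕ
headOr s []      = s
headOr s (t ∷ _) = t

guard : ∀ {P : Set} → Dec P → ℕ → ℕ
guard (yes _) n = n
guard (no  _) n = 0

-- The number of B above A with B : p = C, where r₀, t₀, t₁ are the ranks of A, B, C. The guard is
-- essential: for t₀ < r₀ the truncated difference would pass for dimension 0 and count one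
-- subgroup.
localCount : (p s r₀ t₀ t₁ : ℕ) → ℕ
localCount p s r₀ t₀ t₁ =
  guard (r₀ ℕ.≤? t₀) (complements p (s ℕ.∸ t₁) (t₁ ℕ.∸ r₀) (t₀ ℕ.∸ r₀))

aboveCount : (p s : ℕ) → ∀ {N} → Vec ℕ N → Vec ℕ N → ℕ
aboveCount p s []       []       = 1
aboveCount p s (r ∷ rs) (t ∷ ts) = aboveCount p s rs ts ℕ.* localCount p s r t (headOr s ts)

-- The exponent of the index: s - t is the length of C : p over C when C has rank t, and these
-- layers lead up to the whole lattice.
deficit : ∀ (s : ℕ) {N} → Vec ℕ N → ℕ
deficit s []       = 0
deficit s (t ∷ ts) = deficit s ts ℕ.+ (s ℕ.∸ t)

∩-resp : ∀ {s} {A A′ B : Subgroup s} → A ≐ A′ → (A ∩ B) ≐ (A′ ∩ B)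
∩-resp e = (λ x → to-∩ (fwd e (∩-fst x)) (∩-snd x)) , (λ x → to-∩ (bwd e (∩-fst x)) (∩-snd x))

module RankSequences (p : ℕ) (pr : Prime p) where
  open Lattice p pr
  open Flags p pr
  open Complements p pr

  pL : ∀ {s} → Subgroup s
  pL = dilate full

  RankSeq : ∀ {s N} → Subgroup s → Vec ℕ N → Set
  RankSeq A []       = ⊤
  RankSeq A (r ∷ rs) = Flag (A ∩ pL) A r × RankSeq (colon A) rs

  -- For ℤˢ/B a p-group of type λ, the i-th entry is s minus the i-th part of the conjugate of λ.
  HasRanks : ∀ {s N} → Subgroup s → Vec ℕ N → Set
  HasRanks B []       = full ⊑ B
  HasRanks B (t ∷ ts) = Flag (B ∩ pL) B t × HasRanks (colon B) ts

  colon-resp : ∀ {s} {A B : Subgroup s} → A ≐ B → colon A ≐ colon B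
  colon-resp e = colon-mono (fwd e) , colon-mono (bwd e)

  HasRanks-resp : ∀ {s N} {A B : Subgroup s} (t : Vec ℕ N) → A ≐ B → HasRanks A t → HasRanks B t
  HasRanks-resp []       e h       = λ x → fwd e (h x)
  HasRanks-resp (t ∷ ts) e (f , h) = flag-respʳ e (flag-respˡ (∩-resp e) f) , HasRanks-resp ts (colon-resp e) h

  HasRanks⇒RankSeq : ∀ {s N} {A : Subgroup s} (t : Vec ℕ N) → HasRanks A t → RankSeq A t
  HasRanks⇒RankSeq []       h       = tt
  HasRanks⇒RankSeq (t ∷ ts) (f , h) = f , HasRanks⇒RankSeq ts h

  HasRanks-unique : ∀ {s N} {A : Subgroup s} (t t′ : Vec ℕ N) → HasRanks A t → HasRanks A t′ → t ≡ t′
  HasRanks-unique []       []         h       h′        = refl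
  HasRanks-unique (t ∷ ts) (t′ ∷ ts′) (f , h) (f′ , h′) = cong₂ _∷_ (flag-unique f f′) (HasRanks-unique ts ts′ h h′)

  private
    lift : ∀ {s} → Subgroup s → Subgroup (suc s)
    lift A = record { mem = λ { (x ∷ xs) → mem A xs } ; 0∈ = 0∈ A
                    ; +∈ = λ { (x ∷ xs) (y ∷ ys) → +∈ A xs ys } ; -∈ = λ { (x ∷ xs) → -∈ A xs } }

    to-lift : ∀ {s} {A : Subgroup s} {x xs} → xs ∈ A → x ∷ xs ∈ lift A
    to-lift ⟨ a ⟩ = ⟨ a ⟩

    from-lift : ∀ {s} {A : Subgroup s} {x xs} → x ∷ xs ∈ lift A → xs ∈ A
    from-lift ⟨ a ⟩ = ⟨ a ⟩

    lift-mono : ∀ {s} {A B : Subgroup s} → A ⊑ B → lift A ⊑ lift B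
    lift-mono h {x ∷ xs} a = to-lift (h (from-lift a))

    lift-step : ∀ {s} {U V : Subgroup s} {v} → Step U V v → Step (lift U) (lift V) (0ℤ ∷ v)
    lift-step {U = U} {V} {v} st = record
      { below = lift-mono (below st) ; gen∈ = to-lift (gen∈ st) ; q*gen∈ = to-lift (q*gen∈ st)
      ; gen∉ = λ h → gen∉ st (from-lift h) ; span = λ {x} → spn x }
      where
      spn : ∀ x → x ∈ lift V → ∃ λ j → x ≈[ lift U ] j *ᵥ (0ℤ ∷ v)
      spn (x ∷ xs) h = let j , e = span st (from-lift h) in j , ⟪ to-lift (diff e) ⟫

    lift-flag : ∀ {s n} {U V : Subgroup s} → Flag U V n → Flag (lift U) (lift V) n
    lift-flag (stop e)  = stop (lift-mono (fwd e) , lift-mono (bwd e))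
    lift-flag (f ▸ st) = lift-flag f ▸ lift-step st

    pL-step : ∀ {s} → Step (pL {suc s}) (lift pL) (1ℤ ∷ 0ᵥ)
    pL-step = record
      { below = λ h → blw (from-dilate h) ; gen∈ = to-lift 0-∈ ; q*gen∈ = to-dilate ∈-full
      ; gen∉ = λ h → not-unit (from-dilate h) ; span = λ {x} → spn x }
      where
      blw : ∀ {s} {x : Vec ℤ (suc s)} → (∃ λ y → x ≡ q *ᵥ y × y ∈ full) → x ∈ lift pL
      blw (y ∷ ys , refl , _) = to-lift (to-dilate ∈-full)
      not-unit : ∀ {s} → ¬ (∃ λ y → 1ℤ ∷ 0ᵥ {s} ≡ q *ᵥ y × y ∈ full)
      not-unit (y ∷ ys , e , _) = ℕₚ.<⇒≢ (ℕ.nonTrivial⇒n>1 p {{prime⇒nonTrivial pr}})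
        (sym (ℕₚ.m*n≡1⇒m≡1 p ℤ.∣ y ∣ (trans (sym (ℤₚ.abs-* q y)) (cong ℤ.∣_∣ (sym (Vecₚ.∷-injectiveˡ e))))))
      spn : ∀ {s} (x : Vec ℤ (suc s)) → x ∈ lift pL → ∃ λ j → x ≈[ pL ] j *ᵥ (1ℤ ∷ 0ᵥ)
      spn (x ∷ xs) h = let ys , e , _ = from-dilate (from-lift h) in
        x , ⟪ ∈-resp (cong₂ _∷_ (lem q x) (trans (sym e) (trans (sym (x-0 xs)) (cong (λ z → xs -ᵥ z) (sym (*ᵥ-0 x))))))
                (to-dilate {x = 0ℤ ∷ ys} ∈-full) ⟫
        where
        lem : ∀ q x → q ℤ.* 0ℤ ≡ x ℤ.- x ℤ.* 1ℤ
        lem = solve-∀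

    dilate-step : ∀ {s} {U V : Subgroup s} {v} → Step U V v → Step (dilate U) (dilate V) (q *ᵥ v)
    dilate-step {U = U} {V} {v} st = record
      { below = dilate-mono (below st) ; gen∈ = to-dilate (gen∈ st) ; q*gen∈ = to-dilate (q*gen∈ st)
      ; gen∉ = λ h → gen∉ st (from-dilate* h) ; span = λ h → spn (from-dilate h) }
      where
      spn : ∀ {x} → (∃ λ y → x ≡ q *ᵥ y × y ∈ V) → ∃ λ j → x ≈[ dilate U ] j *ᵥ (q *ᵥ v)
      spn (y , refl , h) = let j , e = span st h in
        j , ⟪ ∈-resp (trans (*ᵥ-diff q y (j *ᵥ v)) (cong (λ z → q *ᵥ y -ᵥ z) (*ᵥ-comm q j v))) (to-dilate (diff e)) ⟫

  dilate-flag : ∀ {s n} {U V : Subgroup s} → Flag U V n → Flag (dilate U) (dilate V) n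
  dilate-flag (stop e)  = stop (dilate-mono (fwd e) , dilate-mono (bwd e))
  dilate-flag (f ▸ st) = dilate-flag f ▸ dilate-step st

  -- Between pℤˢ⁺¹ and ℤˢ⁺¹ lies ℤ × pℤˢ. The first unit vector generates it over pℤˢ⁺¹, and the
  -- remaining steps are those of ℤˢ, lifted.
  full-flag : ∀ s → Flag (pL {s}) full s
  full-flag zero    = stop ((λ _ → ∈-full) , λ { {[]} _ → 0-∈ })
  full-flag (suc s) = subst (Flag pL full) (ℕₚ.+-comm s 1)
    ((stop ≐-refl ▸ pL-step) ++ᶠ flag-respʳ ((λ _ → ∈-full) , λ { {x ∷ xs} _ → to-lift ∈-full }) (lift-flag (full-flag s)))

  -- This replaces the statement that C is free of rank s. Inductively C : p has length s over p(C :
  -- p) = C ∩ pL, and C lies in between, at height t; so C : p has length s - t over C. Multiplying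
  -- by p, C ∩ pL has length s - t over pC, and C has length t over C ∩ pL.
  full-rank : ∀ {s N} {C : Subgroup s} (t : Vec ℕ N) → HasRanks C t → Flag (dilate C) C s
  colon-flag : ∀ {s N} {C : Subgroup s} t₀ (t : Vec ℕ N) → HasRanks C (t₀ ∷ t) →
               ∃ λ d → t₀ ℕ.+ d ≡ s × Flag C (colon C) d

  colon-flag {C = C} t₀ ts (f , h) = quotient-flag (full-rank ts h) (flag-respˡ (≐-sym dilate-colon) f) colon-⊒

  full-rank {s} {C = C} [] h = flag-respˡ (dilate-mono h , dilate-mono (λ _ → ∈-full)) (flag-respʳ (h , (λ _ → ∈-full)) (full-flag s))
  full-rank {s} {C = C} (t ∷ ts) h@(f , _) = helper (colon-flag t ts h)
    where
    helper : (∃ λ d → t ℕ.+ d ≡ s × Flag C (colon C) d) → Flag (dilate C) C s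
    helper (d , e , g) = subst (Flag (dilate C) C) e (dilate-flag g ++ᶠ flag-respˡ (≐-sym dilate-colon) f)

  index-flag : ∀ {s N} {C : Subgroup s} (t : Vec ℕ N) → HasRanks C t → Flag C full (deficit s t)
  index-flag [] h = stop ((λ _ → ∈-full) , h)
  index-flag {s} {C = C} (t ∷ ts) h@(_ , h′) = helper (colon-flag t ts h)
    where
    helper : (∃ λ d → t ℕ.+ d ≡ s × Flag C (colon C) d) → Flag C full (deficit s (t ∷ ts))
    helper (d , e , g) = subst (λ z → Flag C full (deficit s ts ℕ.+ z))
      (trans (sym (ℕₚ.m+n∸m≡n t d)) (cong (ℕ._∸ t) e)) (g ++ᶠ index-flag ts h′)

  -- The sum A + Y. Its membership is not evidently decidable, so it is built by adjoining
  -- generators of A to Y one at a time.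
  record Join {s} (A Y : Subgroup s) (r : ℕ) : Set where
    field
      sum     : Subgroup s
      sumFlag : Flag Y sum r
      left    : A ⊑ sum
      mod     : ∀ {z} → z ∈ sum → ∃ λ a → (a ∈ A) × (z ≈[ Y ] a)
  open Join

  -- The second isomorphism theorem: with X = A ∩ Y, the flag of A over X is carried to A + Y over Y
  -- without loss of length.
  join : ∀ {s r} {X A Y : Subgroup s} → Flag X A r → X ⊑ Y → (∀ {x} → x ∈ A → x ∈ Y → x ∈ X) → Join A Y r
  join {Y = Y} (stop e) XY AYX = record
    { sum = Y ; sumFlag = stop ≐-refl ; left = λ a → XY (bwd e a) ; mod = λ z → 0ᵥ , 0-∈ , ∈⇒≈0 z }
  join {s} {X = X} {A} {Y} (_▸_ {V′ = A′} {v = a} f st) XY AYX = record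
    { sum = Z ; sumFlag = sumFlag J ▸ adjoin-step qa a∉ ; left = left′ ; mod = λ z → mod′ (from-adjoin _ _ qa z) }
    where
    J : Join A′ Y _
    J = join f XY (λ x y → AYX (below st x) y)
    a∉ : a ∉ sum J
    a∉ h = let b , b∈ , e = mod J h in
      gen∉ st (≈-∈ ⟪ flag-⊑ f (AYX (diff-∈ (gen∈ st) (below st b∈)) (diff e)) ⟫ b∈)
    qa : q *ᵥ a ∈ sum J
    qa = left J (q*gen∈ st)
    Z = adjoin (sum J) a qa
    left′ : A ⊑ Z
    left′ x = let j , e = span st x in to-adjoin _ _ qa j (≈-mono (left J) e)
    mod′ : ∀ {z} → (∃ λ j → z ≈[ sum J ] j *ᵥ a) → ∃ λ b → (b ∈ A) × (z ≈[ Y ] b)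
    mod′ {z} (j , e) = let b , b∈ , e′ = mod J (diff e) in
      b +ᵥ j *ᵥ a , +-∈ (below st b∈) (*-∈ j (gen∈ st)) ,
      ≈-trans (≡⇒≈ (sym (diff-cancel z (j *ᵥ a)))) (≈-+ e′ ≈-refl)

  record Above {s N} (A : Subgroup s) (t : Vec ℕ N) : Set where
    field
      sub   : Subgroup s
      above : A ⊑ sub
      ranks : HasRanks sub t
  open Above public

  _≐ᵃ_ : ∀ {s N} {A : Subgroup s} {t : Vec ℕ N} → Above A t → Above A t → Set
  B ≐ᵃ C = sub B ≐ sub C

  private
    -- With U = A + pC and W = A + (C ∩ pL), the subgroups B above A with B : p = C are exactly the
    -- complements to W between U and C. The condition B : p = C amounts to B ∩ pL = pC.
    module Fibre {s N r₀ t₁ t₀ : ℕ} {A C : Subgroup s} {t : Vec ℕ N} (fA : Flag (A ∩ pL) A r₀)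
             (fC : Flag (dilate C) C s) (fW : Flag (C ∩ pL) C t₁) (AC : colon A ⊑ C) (tyC : HasRanks C t) where

      pL⇒pC : ∀ {x} → x ∈ A → x ∈ pL → x ∈ dilate C
      pL⇒pC a l = dilate-mono AC (bwd dilate-colon (to-∩ a l))

      pC⊑pL : dilate C ⊑ pL
      pC⊑pL = dilate-mono (λ _ → ∈-full)

      A⊑C : A ⊑ C
      A⊑C a = AC (colon-⊒ a)

      J₁ : Join A (dilate C) r₀
      J₁ = join fA (λ x → pL⇒pC (∩-fst x) (∩-snd x)) (λ a c → to-∩ a (pC⊑pL c))

      J₂ : Join A (C ∩ pL) r₀
      J₂ = join fA (λ x → to-∩ (A⊑C (∩-fst x)) (∩-snd x)) (λ a w → to-∩ a (∩-snd w))

      U W : Subgroup s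
      U = sum J₁
      W = sum J₂

      pC⊑U : dilate C ⊑ U
      pC⊑U = flag-⊑ (sumFlag J₁)

      pC⊑W : dilate C ⊑ W
      pC⊑W c = flag-⊑ (sumFlag J₂) (to-∩ (dilate-⊑ c) (pC⊑pL c))

      U⊑W : U ⊑ W
      U⊑W u = let a , a∈ , e = mod J₁ u in ≈-∈ (≈-mono pC⊑W e) (left J₂ a∈)

      W⊑C : W ⊑ C
      W⊑C z = let a , a∈ , e = mod J₂ z in ≈-∈ (≈-mono ∩-fst e) (A⊑C a∈)

      -- Modulo pC the element x is some a ∈ A, and a then lies in A ∩ pL = p(A : p), which is
      -- contained in pC.
      U∩pL : ∀ {x} → x ∈ U → x ∈ pL → x ∈ dilate C
      U∩pL u l = let a , a∈ , e = mod J₁ u in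
        ≈-∈ e (pL⇒pC a∈ (≈-∈ (≈-sym (≈-mono pC⊑pL e)) l))

      -- Adding A lengthens pC and C ∩ pL by the same amount r₀, so W/U is as long as (C ∩ pL)/pC.
      fUW : Flag U W (s ℕ.∸ t₁)
      fUW = helper (sub-flag fC fW (λ c → to-∩ (dilate-⊑ c) (pC⊑pL c)))
        where
        helper : (∃ λ w → w ℕ.+ t₁ ≡ s × Flag (dilate C) (C ∩ pL) w) → Flag U W (s ℕ.∸ t₁)
        helper (w , e , f) = helper₂ (quotient-flag (f ++ᶠ sumFlag J₂) (sumFlag J₁) U⊑W)
          where
          helper₂ : (∃ λ d → r₀ ℕ.+ d ≡ r₀ ℕ.+ w × Flag U W d) → Flag U W (s ℕ.∸ t₁)
          helper₂ (d , e′ , g) = subst (Flag U W) (trans (ℕₚ.+-cancelˡ-≡ r₀ d w e′)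
            (trans (sym (ℕₚ.m+n∸n≡m w t₁)) (cong (ℕ._∸ t₁) e))) g

      fWC : Flag W C (t₁ ℕ.∸ r₀)
      fWC = helper (quotient-flag fW (sumFlag J₂) W⊑C)
        where
        helper : (∃ λ n → r₀ ℕ.+ n ≡ t₁ × Flag W C n) → Flag W C (t₁ ℕ.∸ r₀)
        helper (n , e , g) = subst (Flag W C) (trans (sym (ℕₚ.m+n∸m≡n r₀ n)) (cong (ℕ._∸ r₀) e)) g

      F : Set
      F = Σ (Above A (t₀ ∷ t)) λ B → C ≐ colon (sub B)

      module _ (B : F) where
        private
          G = sub (proj₁ B)
          C≐ = proj₂ B
        U⊑G : U ⊑ G
        U⊑G u = let a , a∈ , e = mod J₁ u in
          ≈-∈ (≈-mono (λ c → ∩-fst (fwd dilate-colon (dilate-mono (fwd C≐) c))) e) (above (proj₁ B) a∈)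
        G∩pL : ∀ {x} → x ∈ G → x ∈ pL → x ∈ dilate C
        G∩pL g l = dilate-mono (bwd C≐) (bwd dilate-colon (to-∩ g l))
        G-flag : Flag (dilate C) G t₀
        G-flag = flag-respˡ ((λ x → G∩pL (∩-fst x) (∩-snd x)) , (λ c → to-∩ (U⊑G (pC⊑U c)) (pC⊑pL c))) (proj₁ (ranks (proj₁ B)))
        G-dim : ∃ λ d → r₀ ℕ.+ d ≡ t₀ × Flag U G d
        G-dim = quotient-flag G-flag (sumFlag J₁) U⊑G
        to-complement : ∀ {k} → Flag U G k → Complement U W C k
        to-complement f = record
          { grp = G ; lower = U⊑G ; upper = λ g → bwd C≐ (colon-⊒ g) ; dim = f
          -- Subtracting an element a of A moves g into G ∩ pL = pC, so g lies in A + pC = U.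
          ; meet = λ g w → let a , a∈ , e = mod J₂ w in
              ≈-∈ (≈-mono pC⊑U ⟪ G∩pL (diff-∈ g (above (proj₁ B) a∈)) (∩-snd (diff e)) ⟫) (left J₁ a∈) }

      from-complement : r₀ ℕ.≤ t₀ → Complement U W C (t₀ ℕ.∸ r₀) → F
      from-complement r≤t B = record
        { sub = G ; above = λ a → lower B (left J₁ a)
        ; ranks = flag-respˡ ((λ c → to-∩ (lower B (pC⊑U c)) (pC⊑pL c)) , (λ x → G∩pL′ (∩-fst x) (∩-snd x)))
                    (subst (Flag (dilate C) G) (ℕₚ.m∸n+n≡m r≤t) (sumFlag J₁ ++ᶠ dim B))
                  , HasRanks-resp t C≐ tyC } , C≐
        where
        G = grp B
        -- An element of G ∩ pL lies in C ∩ pL, hence in W, hence by `meet` in U, where `U∩pL`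
        -- applies.
        G∩pL′ : ∀ {x} → x ∈ G → x ∈ pL → x ∈ dilate C
        G∩pL′ g l = U∩pL (meet B g (flag-⊑ (sumFlag J₂) (to-∩ (upper B g) l))) l
        C≐ : C ≐ colon G
        C≐ = (λ c → to-colon (lower B (pC⊑U (to-dilate c)))) ,
             (λ x → from-dilate* (G∩pL′ (from-colon x) (to-dilate ∈-full)))

      guarded-card : (d : Dec (r₀ ℕ.≤ t₀)) →
        HasCard F (λ x y → proj₁ x ≐ᵃ proj₁ y) (guard d (complements p (s ℕ.∸ t₁) (t₁ ℕ.∸ r₀) (t₀ ℕ.∸ r₀)))
      guarded-card (no r≰t) = hc-empty {_≈_ = λ x y → proj₁ x ≐ᵃ proj₁ y} λ B → r≰t (helper (G-dim B))
        where
        helper : ∀ {P : ℕ → Set} → (∃ λ d → r₀ ℕ.+ d ≡ t₀ × P d) → r₀ ℕ.≤ t₀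
        helper (d , e , _) = subst (r₀ ℕ.≤_) e (ℕₚ.m≤m+n r₀ d)
      guarded-card (yes r≤t) = hc-map (count-complements fUW fWC (λ x → pC⊑U (to-dilate x)) (t₀ ℕ.∸ r₀)) (from-complement r≤t)
            (λ e → e) (λ e → e) ≐-trans (λ B → to-complement B (helper B (G-dim B)) , ≐-refl)
        where
        helper : ∀ B → (∃ λ d → r₀ ℕ.+ d ≡ t₀ × Flag U (sub (proj₁ B)) d) → Flag U (sub (proj₁ B)) (t₀ ℕ.∸ r₀)
        helper B (d , e , f) = subst (Flag U _) (trans (sym (ℕₚ.m+n∸m≡n r₀ d)) (cong (ℕ._∸ r₀) e)) f

      fibre-card : HasCard F (λ x y → proj₁ x ≐ᵃ proj₁ y) (localCount p s r₀ t₀ t₁)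
      fibre-card = guarded-card (r₀ ℕ.≤? t₀)

    headFlag : ∀ {s N} {C : Subgroup s} (t : Vec ℕ N) → HasRanks C t → Flag (C ∩ pL) C (headOr s t)
    headFlag {s} [] h = flag-respʳ (h , (λ _ → ∈-full)) (flag-respˡ ((λ l → to-∩ (h ∈-full) l) , ∩-snd) (full-flag s))
    headFlag (t ∷ ts) (f , _) = f

  -- B ↦ B : p maps to the subgroups above A : p with the shortened sequence. All fibres are equally
  -- large, because `localCount` sees C only through its first rank.
  count-above : ∀ {s N} {A : Subgroup s} (r t : Vec ℕ N) → RankSeq A r → HasCard (Above A t) _≐ᵃ_ (aboveCount p s r t)
  count-above {A = A} [] [] _ = hc-singleton {_≈_ = _≐ᵃ_}
    full-above (λ B → ranks B , (λ _ → ∈-full))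
    where
    full-above : Above A []
    full-above = record { sub = full ; above = λ _ → ∈-full ; ranks = λ x → x }
  count-above {s} {A = A} (r ∷ rs) (t ∷ ts) (fA , hA) =
    subst (HasCard _ _≐ᵃ_) (sumF-const (aboveCount p s rs ts) _)
      (hc-Σ {_≈_ = _≐ᵃ_} ≐-sym ≐-trans base (λ B → record { sub = colon (sub B) ; above = colon-mono (above B) ; ranks = proj₂ (ranks B) })
        colon-resp (λ i → let C = proj₁ base i in
          Fibre.fibre-card fA (full-rank ts (ranks C)) (headFlag ts (ranks C)) (above C) (ranks C)))
    where base = count-above rs ts hA

-- Index and type

private
  vecMonoid : ℕ → CommutativeMonoid _ _
  vecMonoid s = record
    { Carrier = Vec ℤ s ; _≈_ = _≡_ ; _∙_ = _+ᵥ_ ; ε = 0ᵥ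
    ; isCommutativeMonoid = record
      { isMonoid = record
        { isSemigroup = record
          { isMagma = record { isEquivalence = ≡.isEquivalence ; ∙-cong = cong₂ _+ᵥ_ }
          ; assoc = +ᵥ-assoc }
        ; identity = 0-+ᵥ , +-0ᵥ }
      ; comm = +ᵥ-comm } }

module _ {s} {A : Subgroup s} where

  QRel-trans : ∀ {x y z} → QRel A x y → QRel A y z → QRel A x z
  QRel-trans {x} {y} {z} a b = holds (diff (≈-trans {A = A} {x} {y} {z} ⟪ ⟨ a ⟩ ⟫ ⟪ ⟨ b ⟩ ⟫))

  QRel-sym : ∀ {x y} → QRel A x y → QRel A y x
  QRel-sym {x} {y} a = holds (diff (≈-sym {A = A} {x} {y} ⟪ ⟨ a ⟩ ⟫))

  HasIndex-unique : ∀ {m n} → HasIndex A m → HasIndex A n → m ≡ n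
  HasIndex-unique = hc-unique {_≈_ = QRel A} (λ {x} {y} → QRel-sym {x} {y}) (λ {x} {y} {z} → QRel-trans {x} {y} {z})

  -- Lagrange: adding x permutes the cosets, so summing representatives gives n x ∈ A.
  index-annihilates : ∀ {n} → HasIndex A n → ∀ x → (+ n) *ᵥ x ∈ A
  index-annihilates {n} (f , f-inj , f-sur) x = ∈-resp (x+y-x (sum f) ((+ n) *ᵥ x)) (diff (≈-sym ∑f≈))
    where
    open MonoidSum (vecMonoid s) using (sum; ∑-distrib-+; sum-permute)
    σ : Vec ℤ s → Fin n → Fin n
    σ y i = proj₁ (f-sur (f i +ᵥ y))
    σ-≈ : ∀ y i → f (σ y i) ≈[ A ] f i +ᵥ y
    σ-≈ y i = ⟪ ⟨ proj₂ (f-sur (f i +ᵥ y)) ⟩ ⟫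
    σ-inv : ∀ y z → y +ᵥ z ≡ 0ᵥ → ∀ i → σ z (σ y i) ≡ i
    σ-inv y z e i = f-inj _ _ (holds (diff (≈-trans (σ-≈ z (σ y i)) (≈-trans (≈-+ (σ-≈ y i) ≈-refl)
      (≡⇒≈ (trans (+ᵥ-assoc (f i) y z) (trans (cong (f i +ᵥ_) e) (+-0ᵥ (f i)))))))))
    π = permutation (σ x) (σ (-ᵥ x)) (σ-inv (-ᵥ x) x (trans (+ᵥ-comm _ x) (x-x x))) (σ-inv x (-ᵥ x) (x-x x))
    ∑-mono : ∀ {m} (g h : Fin m → Vec ℤ s) → (∀ i → g i ≈[ A ] h i) → sum g ≈[ A ] sum h
    ∑-mono {zero}  g h e = ≈-refl
    ∑-mono {suc m} g h e = ≈-+ (e zero) (∑-mono (g ∘ suc) (h ∘ suc) (e ∘ suc))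
    ∑-const : ∀ m → sum {m} (λ _ → x) ≡ (+ m) *ᵥ x
    ∑-const zero    = sym (0*ᵥ x)
    ∑-const (suc m) = trans (cong (x +ᵥ_) (∑-const m)) (sym (suc-*ᵥ m x))
    ∑f≈ : sum f ≈[ A ] sum f +ᵥ (+ n) *ᵥ x
    ∑f≈ = ≈-trans (≡⇒≈ (sum-permute f π)) (≈-trans (∑-mono _ _ (σ-≈ x))
            (≡⇒≈ (trans (∑-distrib-+ f (λ _ → x)) (cong (sum f +ᵥ_) (∑-const n)))))

private
  module _ (n : ℕ) .{{_ : NonZero n}} where
    ℤ/n-card : HasCard ℤ (λ x y → + n ∣ x ℤ.- y) n
    ℤ/n-card = (λ r → + toℕ r) , (λ { i j (divides l e) → ℤ-residue-unique n i j l e }) , sur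
      where
      lem : ∀ r ln → r ℤ.- (r ℤ.+ ln) ≡ ℤ.- ln
      lem = solve-∀
      sur : ∀ x → ∃ λ (r : Fin n) → + n ∣ + toℕ r ℤ.- x
      sur x with ℤ-residue n x
      ... | r , l , refl = r , divides (ℤ.- l) (trans (lem (+ toℕ r) (l ℤ.* + n)) (ℤₚ.neg-distribˡ-* l (+ n)))

  ∣-diff-trans : ∀ {d x y z} → d ∣ x ℤ.- y → d ∣ y ℤ.- z → d ∣ x ℤ.- z
  ∣-diff-trans {d} {x} {y} {z} a b = ≡.subst (d ∣_) (lem x y z) (∣m∣n⇒∣m+n a b)
    where
    lem : ∀ x y z → (x ℤ.- y) ℤ.+ (y ℤ.- z) ≡ x ℤ.- z
    lem = solve-∀

  ∣-diff-sym : ∀ {d x y} → d ∣ x ℤ.- y → d ∣ y ℤ.- x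
  ∣-diff-sym {d} {x} {y} a = ≡.subst (d ∣_) (lem x y) (∣m⇒∣-m a)
    where
    lem : ∀ x y → ℤ.- (x ℤ.- y) ≡ y ℤ.- x
    lem = solve-∀

module Types (p : ℕ) (pr : Prime p) where
  open Lattice p pr
  open Flags p pr
  open RankSequences p pr

  pⁿL : ∀ {s} → ℕ → Subgroup s
  pⁿL zero    = full
  pⁿL (suc n) = dilate (pⁿL n)

  pⁿL-flag : ∀ {s} n → ∃ λ m → Flag (pⁿL {s} n) full m
  pⁿL-flag zero        = 0 , stop ≐-refl
  pⁿL-flag {s} (suc n) = let m , f = pⁿL-flag n in m ℕ.+ s , (go n ++ᶠ f)
    where
    go : ∀ n → Flag (pⁿL {s} (suc n)) (pⁿL n) s
    go zero    = full-flag s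
    go (suc n) = dilate-flag (go n)

  pⁿL-multiple : ∀ {s} n {x : Vec ℤ s} → x ∈ pⁿL n → ∃ λ y → x ≡ (+ (p ^ n)) *ᵥ y
  pⁿL-multiple zero    {x} _ = x , sym (1*ᵥ x)
  pⁿL-multiple (suc n) h with from-dilate h
  ... | y , refl , h′ with pⁿL-multiple n h′
  ...   | z , refl = z , trans (sym (*ᵥ-assoc q (+ (p ^ n)) z)) (cong (_*ᵥ z) (sym (ℤₚ.pos-* p (p ^ n))))

  -- A and A ∩ pL both contain a multiple of the lattice, so splitting a flag of the lattice over it
  -- produces the rank. Each colon lowers the power of p by one, and after N colons the whole
  -- lattice is reached.
  exists-ranks : ∀ {s} N {A : Subgroup s} → pⁿL N ⊑ A → ∃ λ (t : Vec ℕ N) → HasRanks A t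
  exists-ranks zero    h = [] , λ x → h x
  exists-ranks {s} (suc N) {A} h = go (exists-ranks N {colon A} (λ x → to-colon (h (to-dilate x)))) (proj₂ (pⁿL-flag (suc (suc N))))
    where
    pⁿL⊑ : pⁿL (suc (suc N)) ⊑ A ∩ pL
    pⁿL⊑ x = to-∩ (h (dilate-⊑ x)) (dilate-mono (λ _ → ∈-full) x)
    go : (∃ λ (t : Vec ℕ N) → HasRanks (colon A) t) → ∀ {m} → Flag (pⁿL (suc (suc N))) full m → ∃ λ (t : Vec ℕ (suc N)) → HasRanks A t
    go (t , ht) f = go₁ (split-flag f (A ∩ pL) pⁿL⊑ (λ _ → ∈-full))
      where
      go₂ : ∀ {d} → (∃₂ λ k d′ → k ℕ.+ d′ ≡ d × Flag (A ∩ pL) A k × Flag A full d′) → ∃ λ (t : Vec ℕ (suc N)) → HasRanks A t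
      go₂ (k , _ , _ , g , _) = k ∷ t , g , ht
      go₁ : ∀ {m} → (∃₂ λ k d → k ℕ.+ d ≡ m × Flag (pⁿL (suc (suc N))) (A ∩ pL) k × Flag (A ∩ pL) full d) → ∃ λ (t : Vec ℕ (suc N)) → HasRanks A t
      go₁ (_ , _ , _ , _ , g) = go₂ (split-flag g A ∩-fst (λ _ → ∈-full))

  flag-index : ∀ {s n} {A : Subgroup s} → Flag A full n → HasIndex A (p ^ n)
  flag-index {A = A} f = hc-map {_~_ = QRel A} (flag-card f) proj₁ (λ e → holds (diff e)) (λ e → ⟪ ⟨ e ⟩ ⟫)
    (λ {x} {y} {z} → QRel-trans {A = A} {x} {y} {z}) (λ x → (x , ∈-full) , holds (diff (≈-refl {A = A} {x})))

  ranks⇒index : ∀ {s N} {A : Subgroup s} (t : Vec ℕ N) → HasRanks A t → HasIndex A (p ^ deficit s t)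
  ranks⇒index t h = flag-index (index-flag t h)

  index⇒pⁿL : ∀ {s a} {A : Subgroup s} → HasIndex A (p ^ a) → ∀ {N} → a ℕ.≤ N → pⁿL N ⊑ A
  index⇒pⁿL {a = a} {A} h {N} a≤N x∈ with pⁿL-multiple N x∈
  ... | y , refl = ∈-resp (trans (sym (*ᵥ-assoc (+ (p ^ a)) (+ (p ^ (N ℕ.∸ a))) y)) (cong (_*ᵥ y) (trans (sym (ℤₚ.pos-* (p ^ a) _))
          (cong +_ (trans (sym (ℕₚ.^-distribˡ-+-* p a (N ℕ.∸ a))) (cong (p ^_) (ℕₚ.m+[n∸m]≡n a≤N)))))))
          (index-annihilates h ((+ (p ^ (N ℕ.∸ a))) *ᵥ y))

  index⇒ranks : ∀ {s a N} {A : Subgroup s} → HasIndex A (p ^ a) → a ℕ.≤ N →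
                ∃ λ (t : Vec ℕ N) → HasRanks A t × deficit s t ≡ a
  index⇒ranks {s} {a} {N} {A} h a≤N with exists-ranks N {A} (index⇒pⁿL h a≤N)
  ... | t , ht = t , ht , ^-injective _ a (HasIndex-unique {A = A} (ranks⇒index t ht) h)

  DivBy : ∀ {k} → Vec ℕ k → Vec ℤ k → Set
  DivBy []      []       = ⊤
  DivBy (a ∷ l) (x ∷ xs) = (+ (p ^ a) ∣ x) × DivBy l xs

  private
    DivBy? : ∀ {k} (l : Vec ℕ k) x → Dec (DivBy l x)
    DivBy? []      []       = yes tt
    DivBy? (a ∷ l) (x ∷ xs) = (+ (p ^ a) ∣? x) ×-dec DivBy? l xs

    DivBy0 : ∀ {k} (l : Vec ℕ k) → DivBy l 0ᵥ
    DivBy0 []      = tt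
    DivBy0 (a ∷ l) = divides 0ℤ refl , DivBy0 l

    DivBy+ : ∀ {k} (l : Vec ℕ k) {x y} → DivBy l x → DivBy l y → DivBy l (x +ᵥ y)
    DivBy+ []      {[]}     {[]}     _       _       = tt
    DivBy+ (a ∷ l) {x ∷ xs} {y ∷ ys} (d , e) (d′ , e′) = ∣m∣n⇒∣m+n d d′ , DivBy+ l e e′

    DivBy- : ∀ {k} (l : Vec ℕ k) {x} → DivBy l x → DivBy l (-ᵥ x)
    DivBy- []      {[]}     _       = tt
    DivBy- (a ∷ l) {x ∷ xs} (d , e) = ∣m⇒∣-m d , DivBy- l e

    Δ-dec : ∀ {k} → Vec ℕ k → DecSubgroup k
    Δ-dec l = record { P = DivBy l ; P? = DivBy? l ; P0 = DivBy0 l ; P+ = DivBy+ l ; P- = DivBy- l }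

  abstract
    Δ : ∀ {k} → Vec ℕ k → Subgroup k
    Δ l = subgroup (Δ-dec l)

    to-Δ : ∀ {k} {l : Vec ℕ k} {x} → DivBy l x → x ∈ Δ l
    to-Δ {l = l} = to-subgroup (Δ-dec l)

    from-Δ : ∀ {k} {l : Vec ℕ k} {x} → x ∈ Δ l → DivBy l x
    from-Δ {l = l} = from-subgroup (Δ-dec l)

  Δ-card : ∀ {k} (l : Vec ℕ k) → HasCard (Vec ℤ k) (λ x y → x ≈[ Δ l ] y) (p ^ Vec.sum l)
  Δ-card [] = hc-singleton {_≈_ = λ x y → x ≈[ Δ [] ] y} [] (λ { [] → ≈-refl })
  Δ-card (a ∷ l) = subst (HasCard _ (λ x y → x ≈[ Δ (a ∷ l) ] y))
    (trans (sumF-const (p ^ a) (p ^ Vec.sum l)) (sym (ℕₚ.^-distribˡ-+-* p a (Vec.sum l))))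
    (hc-Σ {_≈_ = λ x y → x ≈[ Δ (a ∷ l) ] y} {_~_ = λ x y → + (p ^ a) ∣ x ℤ.- y}
      (λ {x} {y} → ∣-diff-sym {+ (p ^ a)} {x} {y}) (λ {x} {y} {z} → ∣-diff-trans {+ (p ^ a)} {x} {y} {z}) (ℤ/n-card (p ^ a) {{ℕₚ.m^n≢0 p a}}) Vec.head head-resp fibre)
    where
    head-resp : ∀ {x y} → x ≈[ Δ (a ∷ l) ] y → + (p ^ a) ∣ Vec.head x ℤ.- Vec.head y
    head-resp {x ∷ xs} {y ∷ ys} e = proj₁ (from-Δ (diff e))
    fibre : ∀ r → HasCard (Σ (Vec ℤ _) λ x → + (p ^ a) ∣ + toℕ r ℤ.- Vec.head x) (λ x y → proj₁ x ≈[ Δ (a ∷ l) ] proj₁ y) (p ^ Vec.sum l)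
    fibre r = hc-map {_~_ = λ x y → proj₁ x ≈[ Δ (a ∷ l) ] proj₁ y} (Δ-card l)
      (λ x → (+ toℕ r ∷ x) , divides 0ℤ (ℤₚ.+-inverseʳ (+ toℕ r)))
      (λ e → ⟪ to-Δ (divides 0ℤ (ℤₚ.+-inverseʳ (+ toℕ r)) , from-Δ (diff e)) ⟫)
      (λ e → ⟪ to-Δ (proj₂ (from-Δ (diff e))) ⟫) ≈-trans
      (λ { (x ∷ xs , e) → xs , ⟪ to-Δ (e , from-Δ (diff (≈-refl {x = xs}))) ⟫ })

  -- `HasType` phrased through the kernel. The exponents form an arbitrary vector, unsorted and
  -- possibly with zeros, since such vectors arise from taking predecessors and from
  -- diagonalisation.
  record QuotientIso {s k} (A : Subgroup s) (l : Vec ℕ k) : Set where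
    field
      ψ    : Vec ℤ s → Vec ℤ k
      ψ-+  : ∀ x y → ψ (x +ᵥ y) ≈[ Δ l ] ψ x +ᵥ ψ y
      ker⊑ : ∀ x → ψ x ∈ Δ l → x ∈ A
      ker⊒ : ∀ x → x ∈ A → ψ x ∈ Δ l
      ψ-surj : ∀ z → ∃ λ x → ψ x ≈[ Δ l ] z

    ψ-0 : ψ 0ᵥ ≈[ Δ l ] 0ᵥ
    ψ-0 = ∈⇒≈0 (ker⊒ 0ᵥ 0-∈)

    ψ-neg : ∀ x → ψ (-ᵥ x) ≈[ Δ l ] -ᵥ (ψ x)
    ψ-neg x = ≈-trans (≡⇒≈ (sym (x+y-x (ψ x) (ψ (-ᵥ x))))) (≈-trans
      (≈-+ (≈-trans (≈-sym (ψ-+ x (-ᵥ x))) (≈-trans (≡⇒≈ (cong ψ (x-x x))) ψ-0)) ≈-refl) (≡⇒≈ (0-+ᵥ _)))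

    ψ-diff : ∀ x y → ψ (x -ᵥ y) ≈[ Δ l ] ψ x -ᵥ ψ y
    ψ-diff x y = ≈-trans (ψ-+ x (-ᵥ y)) (≈-+ ≈-refl (ψ-neg y))

    ψ-ℕ* : ∀ n x → ψ ((+ n) *ᵥ x) ≈[ Δ l ] (+ n) *ᵥ ψ x
    ψ-ℕ* zero    x = ≈-trans (≡⇒≈ (cong ψ (0*ᵥ x))) (≈-trans ψ-0 (≡⇒≈ (sym (0*ᵥ (ψ x)))))
    ψ-ℕ* (suc n) x = ≈-trans (≡⇒≈ (cong ψ (suc-*ᵥ n x))) (≈-trans (ψ-+ x _)
      (≈-trans (≈-+ ≈-refl (ψ-ℕ* n x)) (≡⇒≈ (sym (suc-*ᵥ n (ψ x))))))

    ψ-inj : ∀ {x y} → ψ x ≈[ Δ l ] ψ y → x ≈[ A ] y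
    ψ-inj {x} {y} e = ⟪ ker⊑ _ (≈-∈ (ψ-diff x y) (diff e)) ⟫

    ψ-resp : ∀ {x y} → x ≈[ A ] y → ψ x ≈[ Δ l ] ψ y
    ψ-resp {x} {y} e = ⟪ ≈-∈ (≈-sym (ψ-diff x y)) (ker⊒ _ (diff e)) ⟫
  open QuotientIso public

  type-index : ∀ {s k} {A : Subgroup s} {l : Vec ℕ k} → QuotientIso A l → HasIndex A (p ^ Vec.sum l)
  type-index {A = A} {l} T = hc-map {_~_ = QRel A} (Δ-card l) (λ z → proj₁ (ψ-surj T z))
    (λ {x} {y} e → holds (diff (ψ-inj T (≈-trans (proj₂ (ψ-surj T x)) (≈-trans e (≈-sym (proj₂ (ψ-surj T y))))))))
    (λ {x} {y} e → ≈-trans (≈-sym (proj₂ (ψ-surj T x))) (≈-trans (ψ-resp T ⟪ ⟨ e ⟩ ⟫) (proj₂ (ψ-surj T y))))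
    (λ {x} {y} {z} → QRel-trans {A = A} {x} {y} {z})
    (λ x → ψ T x , holds (diff (ψ-inj T (proj₂ (ψ-surj T (ψ T x))))))

  private
    Δ-pred⇒ : ∀ {k} (l : Vec ℕ k) {x} → DivBy (map ℕ.pred l) x → DivBy l (q *ᵥ x)
    Δ-pred⇒ []          {[]}     _ = tt
    Δ-pred⇒ (zero ∷ l)  {x ∷ xs} (_ , e) = divides (q ℤ.* x) (sym (ℤₚ.*-identityʳ (q ℤ.* x))) , Δ-pred⇒ l e
    Δ-pred⇒ (suc a ∷ l) {x ∷ xs} (divides m refl , e) =
      divides m (trans (lem q m (+ (p ^ a))) (cong (m ℤ.*_) (sym (ℤₚ.pos-* p (p ^ a))))) , Δ-pred⇒ l e
      where
      lem : ∀ q m a → q ℤ.* (m ℤ.* a) ≡ m ℤ.* (q ℤ.* a)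
      lem = solve-∀

    Δ-pred⇐ : ∀ {k} (l : Vec ℕ k) {x} → DivBy l (q *ᵥ x) → DivBy (map ℕ.pred l) x
    Δ-pred⇐ []          {[]}     _ = tt
    Δ-pred⇐ (zero ∷ l)  {x ∷ xs} (_ , e) = divides x (sym (ℤₚ.*-identityʳ x)) , Δ-pred⇐ l e
    Δ-pred⇐ (suc a ∷ l) {x ∷ xs} (divides m eq , e) =
      divides m (ℤₚ.*-cancelˡ-≡ q x _ (trans eq (trans (cong (m ℤ.*_) (ℤₚ.pos-* p (p ^ a))) (lem q m (+ (p ^ a)))))) , Δ-pred⇐ l e
      where
      lem : ∀ q m a → m ℤ.* (q ℤ.* a) ≡ q ℤ.* (m ℤ.* a)
      lem = solve-∀

    Δ-pred-⊒ : ∀ {k} {l : Vec ℕ k} → Δ l ⊑ Δ (map ℕ.pred l)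
    Δ-pred-⊒ {l = l} x = to-Δ (Δ-pred⇐ l (from-Δ (*-∈ q x)))

  -- The same map works: dividing the p-torsion out of ℤ/p^a leaves ℤ/p^(a-1), and a trivial summand
  -- stays trivial.
  type-colon : ∀ {s k} {A : Subgroup s} {l : Vec ℕ k} → QuotientIso A l → QuotientIso (colon A) (map ℕ.pred l)
  type-colon {l = l} T = record
    { ψ = ψ T ; ψ-+ = λ x y → ≈-mono Δ-pred-⊒ (ψ-+ T x y)
    ; ker⊑ = λ x h → to-colon (ker⊑ T _ (≈-∈ (ψ-ℕ* T p x) (to-Δ (Δ-pred⇒ l (from-Δ h)))))
    ; ker⊒ = λ x h → to-Δ (Δ-pred⇐ l (from-Δ (≈-∈ (≈-sym (ψ-ℕ* T p x)) (ker⊒ T _ (from-colon h)))))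
    ; ψ-surj = λ z → let x , e = ψ-surj T z in x , ≈-mono Δ-pred-⊒ e }

  fromHasType : ∀ {s} {A : Subgroup s} (l : List ℕ) → HasType p A l → QuotientIso A (fromList l)
  toHasType : ∀ {s} {A : Subgroup s} (l : List ℕ) → QuotientIso A (fromList l) → HasType p A l

  private
    ModRel⇒ : ∀ l {x y} → ModRel p l x y → DivBy (fromList l) (x -ᵥ y)
    ModRel⇒ []      {[]}     {[]}     _       = tt
    ModRel⇒ (a ∷ l) {x ∷ xs} {y ∷ ys} (d , e) = ∣ᵤ⇒∣ d , ModRel⇒ l e

    ModRel⇐ : ∀ l {x y} → DivBy (fromList l) (x -ᵥ y) → ModRel p l x y
    ModRel⇐ []      {[]}     {[]}     _       = tt
    ModRel⇐ (a ∷ l) {x ∷ xs} {y ∷ ys} (d , e) = ∣⇒∣ᵤ d , ModRel⇐ l e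

  fromHasType {A = A} l (φ , φ-+ , φ-ker , φ-surj) = record
    { ψ = φ ; ψ-+ = λ x y → ⟪ to-Δ (ModRel⇒ l (φ-+ x y)) ⟫
    ; ker⊑ = λ x h → ∈-resp (x-0 x) ⟨ Equivalence.to (φ-ker x 0ᵥ) (ModRel⇐ l (from-Δ (diff (≈-trans (∈⇒≈0 h) (≈-sym φ0))))) ⟩
    ; ker⊒ = λ x h → ≈-∈ (φ-resp x h) (≈0⇒∈ φ0)
    ; ψ-surj = λ z → let x , e = φ-surj z in x , ⟪ to-Δ (ModRel⇒ l e) ⟫ }
    where
    φ0 : φ 0ᵥ ≈[ Δ (fromList l) ] 0ᵥ
    φ0 = ∈⇒≈0 (∈-resp (x+y-x (φ 0ᵥ) (φ 0ᵥ)) (diff (≈-trans (≈-sym ⟪ to-Δ (ModRel⇒ l (φ-+ 0ᵥ 0ᵥ)) ⟫) (≡⇒≈ (cong φ (+-0ᵥ 0ᵥ))))))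
    φ-resp : ∀ x → x ∈ A → φ x ≈[ Δ (fromList l) ] φ 0ᵥ
    φ-resp x h = ⟪ to-Δ (ModRel⇒ l (Equivalence.from (φ-ker x 0ᵥ) (holds (∈-resp (sym (x-0 x)) h)))) ⟫

  toHasType l T = ψ T , (λ x y → ModRel⇐ l (from-Δ (diff (ψ-+ T x y)))) ,
    (λ x y → mk⇔ (λ e → holds (diff (ψ-inj T ⟪ to-Δ (ModRel⇒ l e) ⟫)))
                 (λ e → ModRel⇐ l (from-Δ (diff (ψ-resp T ⟪ ⟨ e ⟩ ⟫))))) ,
    (λ z → let x , e = ψ-surj T z in x , ModRel⇐ l (from-Δ (diff e)))

-- Elementary divisors

dot : ∀ {k} → Vec ℤ k → Vec ℤ k → ℤ
dot []       []       = 0ℤ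
dot (x ∷ xs) (y ∷ ys) = x ℤ.* y ℤ.+ dot xs ys

module _ {X : Set} where

  -- Brings the pivot coordinate to the head, so that the basis change below concerns only the first
  -- coordinate.
  front : ∀ {k} → Fin (suc k) → Vec X (suc k) → Vec X (suc k)
  front i xs = lookup xs i ∷ removeAt xs i

  unfront : ∀ {k} → Fin (suc k) → Vec X (suc k) → Vec X (suc k)
  unfront i (x ∷ xs) = insertAt xs i x

  unfront-front : ∀ {k} (i : Fin (suc k)) xs → unfront i (front i xs) ≡ xs
  unfront-front i xs = Vecₚ.insertAt-removeAt xs i

  front-unfront : ∀ {k} (i : Fin (suc k)) xs → front i (unfront i xs) ≡ xs
  front-unfront i (x ∷ xs) = cong₂ _∷_ (Vecₚ.insertAt-lookup xs i x) (Vecₚ.removeAt-insertAt xs i x)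

front-zipWith : ∀ {X Y Z : Set} (g : X → Y → Z) {k} (i : Fin (suc k)) xs ys →
                front i (zipWith g xs ys) ≡ zipWith g (front i xs) (front i ys)
front-zipWith g zero (x ∷ xs) (y ∷ ys) = refl
front-zipWith g {suc k} (suc i) (x ∷ xs@(_ ∷ _)) (y ∷ ys@(_ ∷ _)) =
  let e = front-zipWith g i xs ys in cong₂ (λ u v → u ∷ g x y ∷ v) (Vecₚ.∷-injectiveˡ e) (Vecₚ.∷-injectiveʳ e)

front-dot : ∀ {k} (i : Fin (suc k)) xs ys → dot (front i xs) (front i ys) ≡ dot xs ys
front-dot zero (x ∷ xs) (y ∷ ys) = refl
front-dot {suc k} (suc i) (x ∷ xs@(_ ∷ _)) (y ∷ ys@(_ ∷ _)) =
  trans (lem (lookup xs i ℤ.* lookup ys i) (x ℤ.* y) _) (cong (λ z → x ℤ.* y ℤ.+ z) (front-dot i xs ys))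
  where
  lem : ∀ a b c → a ℤ.+ (b ℤ.+ c) ≡ b ℤ.+ (a ℤ.+ c)
  lem = solve-∀

dot-+ : ∀ {k} (d x y : Vec ℤ k) → dot d (x +ᵥ y) ≡ dot d x ℤ.+ dot d y
dot-+ []      []       []       = refl
dot-+ (d ∷ ds) (x ∷ xs) (y ∷ ys) = trans (cong (λ z → d ℤ.* (x ℤ.+ y) ℤ.+ z) (dot-+ ds xs ys)) (lem d x y _ _)
  where
  lem : ∀ d x y u v → d ℤ.* (x ℤ.+ y) ℤ.+ (u ℤ.+ v) ≡ (d ℤ.* x ℤ.+ u) ℤ.+ (d ℤ.* y ℤ.+ v)
  lem = solve-∀

dot-0 : ∀ {k} (d : Vec ℤ k) → dot d 0ᵥ ≡ 0ℤ
dot-0 []       = refl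
dot-0 (d ∷ ds) = trans (cong₂ ℤ._+_ (ℤₚ.*-zeroʳ d) (dot-0 ds)) refl

module Structure (p : ℕ) (pr : Prime p) where
  open Lattice p pr
  open Flags p pr
  open RankSequences p pr
  open Types p pr

  scaleBy : ∀ {k} → Vec ℕ k → Vec ℤ k → Vec ℤ k
  scaleBy = zipWith (λ a m → m ℤ.* + (p ^ a))

  DivBy⇒scale : ∀ {k} (l : Vec ℕ k) {y} → DivBy l y → ∃ λ m → y ≡ scaleBy l m
  DivBy⇒scale []      {[]}    _                   = [] , refl
  DivBy⇒scale (a ∷ l) {y ∷ ys} (divides m refl , d) = let ms , e = DivBy⇒scale l d in m ∷ ms , cong (_ ∷_) e

  scale⇒DivBy : ∀ {k} (l : Vec ℕ k) m → DivBy l (scaleBy l m)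
  scale⇒DivBy []      []      = tt
  scale⇒DivBy (a ∷ l) (m ∷ ms) = divides m refl , scale⇒DivBy l ms

  scaleBy-+ : ∀ {k} (l : Vec ℕ k) m n → scaleBy l (m +ᵥ n) ≡ scaleBy l m +ᵥ scaleBy l n
  scaleBy-+ []      []       []       = refl
  scaleBy-+ (a ∷ l) (m ∷ ms) (n ∷ ns) = cong₂ _∷_ (ℤₚ.*-distribʳ-+ (+ (p ^ a)) m n) (scaleBy-+ l ms ns)

  front-DivBy : ∀ {k} (i : Fin (suc k)) l {y} → DivBy l y → DivBy (front i l) (front i y)
  front-DivBy i l {y} d with DivBy⇒scale l d
  ... | m , refl = subst (DivBy (front i l)) (sym (front-zipWith _ i l m)) (scale⇒DivBy (front i l) (front i m))

  unfront-DivBy : ∀ {k} (i : Fin (suc k)) l {y} → DivBy (front i l) (front i y) → DivBy l y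
  unfront-DivBy i l {y} d with DivBy⇒scale (front i l) d
  ... | m , e = subst (DivBy l) y≡ (scale⇒DivBy l (unfront i m))
    where
    y≡ : scaleBy l (unfront i m) ≡ y
    y≡ = trans (sym (unfront-front i _)) (trans (cong (unfront i)
           (trans (front-zipWith _ i l (unfront i m)) (trans (cong (scaleBy (front i l)) (front-unfront i m)) (sym e)))) (unfront-front i y))

  -- A basis adapted to A, as in the Smith normal form. The equations for φ hold exactly and not
  -- merely modulo A, because the coordinates must survive the passage to a smaller subgroup.
  record Diagonal {s k} (A : Subgroup s) (l : Vec ℕ k) : Set where
    field
      φ      : Vec ℤ s → Vec ℤ k
      φ-+    : ∀ x y → φ (x +ᵥ y) ≡ φ x +ᵥ φ y
      φ-inj  : ∀ x → φ x ≡ 0ᵥ → x ≡ 0ᵥ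
      φ-surj : ∀ z → ∃ λ x → φ x ≡ z
      φ⇒     : ∀ x → DivBy l (φ x) → x ∈ A
      φ⇐     : ∀ x → x ∈ A → DivBy l (φ x)

    φ-injective : ∀ {x y} → φ x ≡ φ y → x ≡ y
    φ-injective {x} {y} e = trans (sym (diff-cancel x y)) (trans (cong (_+ᵥ y) (φ-inj (x -ᵥ y) z)) (0-+ᵥ y))
      where
      z : φ (x -ᵥ y) ≡ 0ᵥ
      z = trans (sym (x+y-x (φ y) _)) (trans (cong (_-ᵥ φ y)
            (trans (sym (φ-+ y (x -ᵥ y))) (trans (cong φ (trans (+ᵥ-comm y _) (diff-cancel x y))) e))) (x-x (φ y)))
  open Diagonal

  diagonal⇒type : ∀ {s k} {A : Subgroup s} {l : Vec ℕ k} → Diagonal A l → QuotientIso A l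
  diagonal⇒type D = record
    { ψ = φ D ; ψ-+ = λ x y → ≡⇒≈ (φ-+ D x y) ; ker⊑ = λ x h → φ⇒ D x (from-Δ h) ; ker⊒ = λ x h → to-Δ (φ⇐ D x h)
    ; ψ-surj = λ z → let x , e = φ-surj D z in x , ≡⇒≈ e }

  private
    front-+ : ∀ {k} (i : Fin (suc k)) x y → front i (x +ᵥ y) ≡ front i x +ᵥ front i y
    front-+ = front-zipWith ℤ._+_

    unfront-0 : ∀ {k} (i : Fin (suc k)) → unfront i (0ᵥ {suc k}) ≡ 0ᵥ
    unfront-0 zero = refl
    unfront-0 {suc k} (suc i) = cong (0ℤ ∷_) (unfront-0 i)

  front-diagonal : ∀ {s k} {A : Subgroup s} {l : Vec ℕ (suc k)} (i : Fin (suc k)) → Diagonal A l → Diagonal A (front i l)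
  front-diagonal {l = l} i D = record
    { φ = front i ∘ φ D
    ; φ-+ = λ x y → trans (cong (front i) (φ-+ D x y)) (front-+ i (φ D x) (φ D y))
    ; φ-inj = λ x e → φ-inj D x (trans (sym (unfront-front i (φ D x))) (trans (cong (unfront i) e) (unfront-0 i)))
    ; φ-surj = λ z → let x , e = φ-surj D (unfront i z) in x , trans (cong (front i) e) (front-unfront i z)
    ; φ⇒ = λ x d → φ⇒ D x (unfront-DivBy i l d)
    ; φ⇐ = λ x h → front-DivBy i l (φ⇐ D x h) }

  Multiple : ℤ → Set
  Multiple j = ∃ λ l → j ≡ l ℤ.* q

  private
    Good : ∀ {k} → ℕ → Vec ℕ k → Vec ℤ k → Set
    Good a []      []      = ⊤
    Good a (b ∷ l) (g ∷ f) = (Multiple g ⊎ b ℕ.≤ a) × Good a l f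

    AllMultiple : ∀ {k} → Vec ℤ k → Set
    AllMultiple []      = ⊤
    AllMultiple (g ∷ f) = Multiple g × AllMultiple f

    Inv : ℤ → Set
    Inv j = ∃₂ λ k l → k ℤ.* j ≡ 1ℤ ℤ.+ l ℤ.* q

    good-mono : ∀ {k a b} (l : Vec ℕ k) f → a ℕ.≤ b → Good a l f → Good b l f
    good-mono []      []      _ _              = tt
    good-mono (c ∷ l) (g ∷ f) h (inj₁ m , r) = inj₁ m , good-mono l f h r
    good-mono (c ∷ l) (g ∷ f) h (inj₂ d , r) = inj₂ (ℕₚ.≤-trans d h) , good-mono l f h r

    all⇒good : ∀ {k} a (l : Vec ℕ k) f → AllMultiple f → Good a l f
    all⇒good a []      []      _       = tt
    all⇒good a (b ∷ l) (g ∷ f) (m , r) = inj₁ m , all⇒good a l f r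

    -- The exponent of the pivot is maximal, so that the other basis vectors can be corrected by integral
    -- multiples of the pivot vector.
    pivot : ∀ {k} (l : Vec ℕ k) f → AllMultiple f ⊎ (∃ λ i → Inv (lookup f i) × Good (lookup l i) l f)
    pivot [] [] = inj₁ tt
    pivot (a ∷ l) (g ∷ f) with multiple⊎invertible g | pivot l f
    ... | inj₁ m | inj₁ r            = inj₁ (m , r)
    ... | inj₁ m | inj₂ (i , v , h)  = inj₂ (suc i , v , inj₁ m , h)
    ... | inj₂ v | inj₁ r            = inj₂ (zero , v , inj₂ ℕₚ.≤-refl , all⇒good a l f r)
    ... | inj₂ v | inj₂ (i , v′ , h) with ℕₚ.≤-total a (lookup l i)
    ...   | inj₁ a≤ = inj₂ (suc i , v′ , inj₂ a≤ , h)
    ...   | inj₂ ≤a = inj₂ (zero , v , inj₂ ℕₚ.≤-refl , good-mono l f ≤a h)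

    good-removeAt : ∀ {k a} (i : Fin (suc k)) l f → Good a l f → Good a (removeAt l i) (removeAt f i)
    good-removeAt zero (b ∷ l) (g ∷ f) (_ , h) = h
    good-removeAt {suc k} (suc i) (b ∷ l@(_ ∷ _)) (g ∷ f@(_ ∷ _)) (d , h) = d , good-removeAt i l f h

    allMultiple-dot : ∀ {k} (m f : Vec ℤ k) → AllMultiple f → Multiple (dot m f)
    allMultiple-dot []       []      _ = 0ℤ , refl
    allMultiple-dot (m ∷ ms) (g ∷ f) ((l , refl) , h) = let l′ , e = allMultiple-dot ms f h in
      m ℤ.* l ℤ.+ l′ , trans (cong (λ z → m ℤ.* (l ℤ.* q) ℤ.+ z) e) (lem m l l′ q)
      where
      lem : ∀ m l l′ q → m ℤ.* (l ℤ.* q) ℤ.+ l′ ℤ.* q ≡ (m ℤ.* l ℤ.+ l′) ℤ.* q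
      lem = solve-∀

    -- With d_j = c_j p^(a − l_j), the functional f vanishes modulo p on p^(l_j) (e_j − d_j e_0).
    clear : ∀ {k a f₀} (l : Vec ℕ k) f → Inv f₀ → Good a l f →
            ∃₂ λ (d c : Vec ℤ k) → (∀ m → dot d (scaleBy l m) ≡ dot c m ℤ.* + (p ^ a)) ×
              (∀ m → ∃ λ e → dot m f ≡ f₀ ℤ.* dot c m ℤ.+ e ℤ.* q)
    clear {f₀ = f₀} [] [] v _ = [] , [] , (λ { [] → refl }) , (λ { [] → 0ℤ , lem f₀ q })
      where
      lem : ∀ x q → 0ℤ ≡ x ℤ.* 0ℤ ℤ.+ 0ℤ ℤ.* q
      lem = solve-∀
    clear {a = a} {f₀} (b ∷ l) (g ∷ f) v (inj₁ (n , refl) , h) =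
      let d , c , hd , hc = clear l f v h in
      0ℤ ∷ d , 0ℤ ∷ c ,
      (λ { (m ∷ ms) → trans (ℤₚ.+-identityˡ _) (trans (hd ms) (cong (ℤ._* + (p ^ a)) (sym (ℤₚ.+-identityˡ (dot c ms))))) }) ,
      (λ { (m ∷ ms) → let e , eq = hc ms in m ℤ.* n ℤ.+ e , trans (cong (λ z → m ℤ.* (n ℤ.* q) ℤ.+ z) eq) (lem m n q f₀ (dot c ms) e) })
      where
      lem : ∀ m n q f c e → m ℤ.* (n ℤ.* q) ℤ.+ (f ℤ.* c ℤ.+ e ℤ.* q) ≡ f ℤ.* (0ℤ ℤ.+ c) ℤ.+ (m ℤ.* n ℤ.+ e) ℤ.* q
      lem = solve-∀
    clear {a = a} {f₀} (b ∷ l) (g ∷ f) v@(κ , λ′ , inv) (inj₂ b≤a , h) =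
      let d , c , hd , hc = clear l f v h in
      κ ℤ.* g ℤ.* + (p ^ (a ℕ.∸ b)) ∷ d , κ ℤ.* g ∷ c ,
      (λ { (m ∷ ms) → trans (cong₂ ℤ._+_ (lem₁ (κ ℤ.* g) (+ (p ^ (a ℕ.∸ b))) m (+ (p ^ b))) (hd ms))
             (trans (cong (λ z → κ ℤ.* g ℤ.* m ℤ.* z ℤ.+ dot c ms ℤ.* + (p ^ a)) pᵃ) (sym (ℤₚ.*-distribʳ-+ (+ (p ^ a)) (κ ℤ.* g ℤ.* m) (dot c ms)))) }) ,
      (λ { (m ∷ ms) → let e , eq = hc ms in e ℤ.- m ℤ.* g ℤ.* λ′ , trans (cong (λ z → m ℤ.* g ℤ.+ z) eq) (fin m (dot c ms) e) })
      where
      pᵃ : + (p ^ (a ℕ.∸ b)) ℤ.* + (p ^ b) ≡ + (p ^ a)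
      pᵃ = trans (sym (ℤₚ.pos-* (p ^ (a ℕ.∸ b)) (p ^ b)))
             (cong +_ (trans (sym (ℕₚ.^-distribˡ-+-* p (a ℕ.∸ b) b)) (cong (p ^_) (ℕₚ.m∸n+n≡m b≤a))))
      lem₁ : ∀ k x m y → k ℤ.* x ℤ.* (m ℤ.* y) ≡ k ℤ.* m ℤ.* (x ℤ.* y)
      lem₁ = solve-∀
      lem₂ : ∀ m g f c e q k → m ℤ.* g ℤ.+ (f ℤ.* c ℤ.+ e ℤ.* q) ≡ f ℤ.* (k ℤ.* g ℤ.* m ℤ.+ c) ℤ.+ e ℤ.* q ℤ.+ m ℤ.* g ℤ.* (1ℤ ℤ.- k ℤ.* f)
      lem₂ = solve-∀
      lem₃ : ∀ m g l q e x → x ℤ.+ e ℤ.* q ℤ.+ m ℤ.* g ℤ.* (1ℤ ℤ.- (1ℤ ℤ.+ l ℤ.* q)) ≡ x ℤ.+ (e ℤ.- m ℤ.* g ℤ.* l) ℤ.* q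
      lem₃ = solve-∀
      fin : ∀ m c e → m ℤ.* g ℤ.+ (f₀ ℤ.* c ℤ.+ e ℤ.* q) ≡ f₀ ℤ.* (κ ℤ.* g ℤ.* m ℤ.+ c) ℤ.+ (e ℤ.- m ℤ.* g ℤ.* λ′) ℤ.* q
      fin m c e = trans (lem₂ m g f₀ c e q κ) (trans (cong (λ z → f₀ ℤ.* (κ ℤ.* g ℤ.* m ℤ.+ c) ℤ.+ e ℤ.* q ℤ.+ m ℤ.* g ℤ.* (1ℤ ℤ.- z)) inv)
                    (lem₃ m g λ′ q e (f₀ ℤ.* (κ ℤ.* g ℤ.* m ℤ.+ c))))

    additive-ℤ : ∀ {s} {A : Subgroup s} (g : ℤ → Vec ℤ s) → (∀ a b → g (a ℤ.+ b) ≈[ A ] g a +ᵥ g b) → ∀ a → g a ≈[ A ] a *ᵥ g 1ℤ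
    additive-ℤ {A = A} g g-+ = go
      where
      g0 : g 0ℤ ≈[ A ] 0ᵥ
      g0 = ∈⇒≈0 (∈-resp (x+y-x (g 0ℤ) (g 0ℤ)) (diff (≈-sym (g-+ 0ℤ 0ℤ))))
      goℕ : ∀ n → g (+ n) ≈[ A ] (+ n) *ᵥ g 1ℤ
      goℕ zero    = ≈-trans g0 (≡⇒≈ (sym (0*ᵥ _)))
      goℕ (suc n) = ≈-trans (g-+ 1ℤ (+ n)) (≈-trans (≈-+ ≈-refl (goℕ n)) (≡⇒≈ (sym (suc-*ᵥ n _))))
      go : ∀ a → g a ≈[ A ] a *ᵥ g 1ℤ
      go (+ n) = goℕ n
      go -[1+ n ] = ≈-trans (≡⇒≈ (sym (x+y-x (g (+ suc n)) (g -[1+ n ]))))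
        (≈-trans (≈-+ (≈-trans (≈-sym (g-+ (+ suc n) -[1+ n ])) (≈-trans (≡⇒≈ (cong g (ℤₚ.+-inverseʳ (+ suc n)))) g0))
                      (≈-trans (≡⇒≈ (trans (cong -ᵥ_ (sym (1*ᵥ _))) (neg-*ᵥ 1ℤ _)))
                        (≈-trans (≈-* (ℤ.- 1ℤ) (goℕ (suc n))) (≡⇒≈ (trans (sym (*ᵥ-assoc (ℤ.- 1ℤ) (+ suc n) _)) (cong (_*ᵥ g 1ℤ) (ℤₚ.-1*i≡-i (+ suc n))))))))
                 (≡⇒≈ (0-+ᵥ _)))

    coefficients : ∀ {s k} {A A′ : Subgroup s} {v} → Step A A′ v → (h : Vec ℤ k → Vec ℤ s) →
                   (∀ m n → h (m +ᵥ n) ≈[ A ] h m +ᵥ h n) → (∀ m → h m ∈ A′) →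
                   ∃ λ f → ∀ m → h m ≈[ A ] dot m f *ᵥ v
    coefficients {k = zero} {v = v} st h h-+ h∈ = [] , λ { [] → ≈-trans h0 (≡⇒≈ (sym (0*ᵥ v))) }
      where h0 = ∈⇒≈0 (∈-resp (x+y-x (h []) (h [])) (diff (≈-sym (h-+ [] []))))
    coefficients {k = suc k} {A} {v = v} st h h-+ h∈ with span st (h∈ (1ℤ ∷ 0ᵥ))
      | coefficients st (λ m → h (0ℤ ∷ m)) (λ m n → h-+ (0ℤ ∷ m) (0ℤ ∷ n)) (λ m → h∈ (0ℤ ∷ m))
    ... | j , ej | f , ef = j ∷ f , λ { (a ∷ m) →
      ≈-trans (≡⇒≈ (cong h (sym (cong₂ _∷_ (ℤₚ.+-identityʳ a) (0-+ᵥ m))))) (≈-trans (h-+ (a ∷ 0ᵥ) (0ℤ ∷ m))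
      (≈-trans (≈-+ (≈-trans (additive-ℤ (λ a → h (a ∷ 0ᵥ)) (λ a b → ≈-trans (≡⇒≈ (cong (λ z → h ((a ℤ.+ b) ∷ z)) (sym (+-0ᵥ 0ᵥ)))) (h-+ (a ∷ 0ᵥ) (b ∷ 0ᵥ))) a)
                             (≈-trans (≈-* a ej) (≡⇒≈ (sym (*ᵥ-assoc a j v))))) (ef m))
               (≡⇒≈ (sym (*ᵥ-distribʳ (a ℤ.* j) (dot m f) v))))) }

  module _ {s k} {A A′ : Subgroup s} {v} (st : Step A A′ v) {l : Vec ℕ k} (D : Diagonal A′ l) where

    private
      h : Vec ℤ k → Vec ℤ s
      h m = proj₁ (φ-surj D (scaleBy l m))
      φh : ∀ m → φ D (h m) ≡ scaleBy l m
      φh m = proj₂ (φ-surj D (scaleBy l m))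

    -- A′/A is generated by v, so the projection A′ → A′/A is a linear functional modulo p in the
    -- coordinates m of A′; f lists its values on the adapted basis.
    functional : ∃ λ f → ∀ x m → φ D x ≡ scaleBy l m → x ≈[ A ] dot m f *ᵥ v
    functional = let f , ef = coefficients st h
                       (λ m n → ≡⇒≈ (φ-injective D (trans (φh (m +ᵥ n)) (trans (scaleBy-+ l m n)
                          (sym (trans (φ-+ D (h m) (h n)) (cong₂ _+ᵥ_ (φh m) (φh n))))))))
                       (λ m → φ⇒ D (h m) (subst (DivBy l) (sym (φh m)) (scale⇒DivBy l m)))
                 in f , λ x m e → ≈-trans (≡⇒≈ (φ-injective D (trans e (sym (φh m))))) (ef m)

    multiple⇒∈ : ∀ {x j} → x ≈[ A ] j *ᵥ v → Multiple j → x ∈ A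
    multiple⇒∈ e (n , refl) = ≈-∈ e (∈-resp (sym (*ᵥ-assoc n q v)) (*-∈ n (q*gen∈ st)))

  -- On A′, with coordinates m, the functional is congruent to f₀ (m₀ + c·m) modulo p by `clear`, so
  -- A is cut out by p dividing m₀ + c·m. The shear turns the first coordinate into (m₀ + c·m) p^a,
  -- and the condition becomes divisibility by p^(a+1).
  refine-front : ∀ {s k} {A A′ : Subgroup s} {v} (st : Step A A′ v) {a} {l : Vec ℕ k} (D : Diagonal A′ (a ∷ l)) f₀ f →
                 (∀ x m → φ D x ≡ scaleBy (a ∷ l) m → x ≈[ A ] dot m (f₀ ∷ f) *ᵥ v) → Inv f₀ → Good a l f →
                 Diagonal A (suc a ∷ l)
  refine-front {s} {k} {A} {A′} {v} st {a} {l} D f₀ f fun v₀@(κ , λ′ , inv) good with clear l f v₀ good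
  ... | d , c , hd , hc = record
    { φ = shear ∘ φ D
    ; φ-+ = λ x y → trans (cong shear (φ-+ D x y)) (shear-+ (φ D x) (φ D y))
    ; φ-inj = λ x e → φ-inj D x (shear-inj (φ D x) e)
    ; φ-surj = λ z → let y , e = shear-surj z ; x , e′ = φ-surj D y in x , trans (cong shear e′) e
    ; φ⇒ = λ x → to x (φ D x) refl
    ; φ⇐ = λ x x∈ → from x x∈ (DivBy⇒scale (a ∷ l) (φ⇐ D x (below st x∈))) }
    where
    shear : Vec ℤ (suc k) → Vec ℤ (suc k)
    shear (y ∷ ys) = y ℤ.+ dot d ys ∷ ys
    shear-+ : ∀ x y → shear (x +ᵥ y) ≡ shear x +ᵥ shear y
    shear-+ (x ∷ xs) (y ∷ ys) = cong (_∷ (xs +ᵥ ys)) (trans (cong (λ z → (x ℤ.+ y) ℤ.+ z) (dot-+ d xs ys)) (lem x y _ _))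
      where
      lem : ∀ x y u v → (x ℤ.+ y) ℤ.+ (u ℤ.+ v) ≡ (x ℤ.+ u) ℤ.+ (y ℤ.+ v)
      lem = solve-∀
    shear-inj : ∀ x → shear x ≡ 0ᵥ → x ≡ 0ᵥ
    shear-inj (x ∷ xs) e with Vecₚ.∷-injectiveʳ e
    ... | refl = cong (_∷ 0ᵥ) (trans (sym (ℤₚ.+-identityʳ x)) (trans (cong (λ z → x ℤ.+ z) (sym (dot-0 d))) (Vecₚ.∷-injectiveˡ e)))
    shear-surj : ∀ z → ∃ λ y → shear y ≡ z
    shear-surj (z ∷ zs) = z ℤ.- dot d zs ∷ zs , cong (_∷ zs) (lem z (dot d zs))
      where
      lem : ∀ z d → z ℤ.- d ℤ.+ d ≡ z
      lem = solve-∀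
    P = + (p ^ a)
    pP : + (p ^ suc a) ≡ q ℤ.* P
    pP = ℤₚ.pos-* p (p ^ a)
    dot-f : ∀ m₀ m → ∃ λ e → m₀ ℤ.* f₀ ℤ.+ dot m f ≡ f₀ ℤ.* (m₀ ℤ.+ dot c m) ℤ.+ e ℤ.* q
    dot-f m₀ m = let e , eq = hc m in e , trans (cong (λ z → m₀ ℤ.* f₀ ℤ.+ z) eq) (lem m₀ f₀ (dot c m) (e ℤ.* q))
      where
      lem : ∀ m f c x → m ℤ.* f ℤ.+ (f ℤ.* c ℤ.+ x) ≡ f ℤ.* (m ℤ.+ c) ℤ.+ x
      lem = solve-∀
    to : ∀ x y → φ D x ≡ y → DivBy (suc a ∷ l) (shear y) → x ∈ A
    to x (y ∷ ys) e (divides w ew , dl) with DivBy⇒scale l dl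
    ... | m , refl = multiple⇒∈ st D (fun x (m₀ ∷ m) (trans e (cong (_∷ scaleBy l m) y≡)))
                       (let e , eq = dot-f m₀ m in f₀ ℤ.* w ℤ.+ e , trans eq (lem₂ f₀ w q (dot c m) e))
      where
      m₀ = w ℤ.* q ℤ.- dot c m
      lem₁ : ∀ y x → y ≡ (y ℤ.+ x) ℤ.- x
      lem₁ = solve-∀
      lem₃ : ∀ w q P c → w ℤ.* (q ℤ.* P) ℤ.- c ℤ.* P ≡ (w ℤ.* q ℤ.- c) ℤ.* P
      lem₃ = solve-∀
      y≡ : y ≡ m₀ ℤ.* P
      y≡ = trans (lem₁ y (dot d (scaleBy l m))) (trans (cong₂ ℤ._-_ (trans ew (cong (w ℤ.*_) pP)) (hd m)) (lem₃ w q P (dot c m)))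
      lem₂ : ∀ f w q c e → f ℤ.* (w ℤ.* q ℤ.- c ℤ.+ c) ℤ.+ e ℤ.* q ≡ (f ℤ.* w ℤ.+ e) ℤ.* q
      lem₂ = solve-∀
    cancel : ∀ {z} e → Multiple (f₀ ℤ.* z ℤ.+ e ℤ.* q) → Multiple z
    cancel {z} e (n , eq) = κ ℤ.* (n ℤ.- e) ℤ.- λ′ ℤ.* z , trans (lem₁ z λ′ q) (trans (cong (λ u → u ℤ.* z ℤ.- λ′ ℤ.* q ℤ.* z) (sym inv))
        (trans (lem₂ κ f₀ z (e ℤ.* q) (λ′ ℤ.* q)) (trans (cong (λ u → κ ℤ.* (u ℤ.- e ℤ.* q) ℤ.- λ′ ℤ.* q ℤ.* z) eq) (lem₃ κ n e q λ′ z))))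
      where
      lem₁ : ∀ z l q → z ≡ (1ℤ ℤ.+ l ℤ.* q) ℤ.* z ℤ.- l ℤ.* q ℤ.* z
      lem₁ = solve-∀
      lem₂ : ∀ k f z e l → k ℤ.* f ℤ.* z ℤ.- l ℤ.* z ≡ k ℤ.* (f ℤ.* z ℤ.+ e ℤ.- e) ℤ.- l ℤ.* z
      lem₂ = solve-∀
      lem₃ : ∀ k n e q l z → k ℤ.* (n ℤ.* q ℤ.- e ℤ.* q) ℤ.- l ℤ.* q ℤ.* z ≡ (k ℤ.* (n ℤ.- e) ℤ.- l ℤ.* z) ℤ.* q
      lem₃ = solve-∀
    from : ∀ x → x ∈ A → (∃ λ m → φ D x ≡ scaleBy (a ∷ l) m) → DivBy (suc a ∷ l) (shear (φ D x))
    from x x∈ (m₀ ∷ m , e) = subst (λ y → DivBy (suc a ∷ l) (shear y)) (sym e) (helper (dot-f m₀ m))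
      where
      mult : Multiple (m₀ ℤ.* f₀ ℤ.+ dot m f)
      mult = multiple-of-gen∈ st (≈-∈ (≈-sym (fun x (m₀ ∷ m) e)) x∈)
      helper : (∃ λ e → m₀ ℤ.* f₀ ℤ.+ dot m f ≡ f₀ ℤ.* (m₀ ℤ.+ dot c m) ℤ.+ e ℤ.* q) → DivBy (suc a ∷ l) (shear (scaleBy (a ∷ l) (m₀ ∷ m)))
      helper (e , eq) = conclude (cancel e (subst Multiple eq mult))
        where
        conclude : Multiple (m₀ ℤ.+ dot c m) → DivBy (suc a ∷ l) (shear (scaleBy (a ∷ l) (m₀ ∷ m)))
        conclude (n , en) = divides n (trans (cong (λ z → m₀ ℤ.* P ℤ.+ z) (hd m)) (trans (sym (ℤₚ.*-distribʳ-+ P m₀ (dot c m)))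
          (trans (cong (ℤ._* P) en) (trans (ℤₚ.*-assoc n q P) (cong (n ℤ.*_) (sym pP)))))) , scale⇒DivBy l m

  -- A pivot exists: if p divided every value of the functional, the generator v itself would lie in
  -- A.
  refine : ∀ {s k} {A A′ : Subgroup s} {v} → Step A A′ v → {l : Vec ℕ k} → Diagonal A′ l → ∃ λ (l′ : Vec ℕ k) → Diagonal A l′
  refine {k = k} {A} {v = v} st {l} D with functional st D
  ... | f , fun with pivot l f
  ...   | inj₁ all with DivBy⇒scale l (φ⇐ D v (gen∈ st))
  ...     | m , e = ⊥-elim (gen∉ st (multiple⇒∈ st D (fun v m e) (allMultiple-dot m f all)))
  refine {k = suc k} {A} {v = v} st {l} D | f , fun | inj₂ (i , inv , good) =
    _ , refine-front st (front-diagonal i D) (lookup f i) (removeAt f i) fun′ inv (good-removeAt i l f good)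
    where
    fun′ : ∀ x m → front i (φ D x) ≡ scaleBy (front i l) m → x ≈[ A ] dot m (front i f) *ᵥ v
    fun′ x m e = ≈-trans (fun x (unfront i m) φx≡) (≡⇒≈ (cong (_*ᵥ v)
        (trans (sym (front-dot i (unfront i m) f)) (cong (λ z → dot z (front i f)) (front-unfront i m)))))
      where
      φx≡ : φ D x ≡ scaleBy l (unfront i m)
      φx≡ = trans (sym (unfront-front i (φ D x))) (trans (cong (unfront i) (trans e
              (sym (trans (front-zipWith _ i l (unfront i m)) (cong (scaleBy (front i l)) (front-unfront i m))))))
              (unfront-front i _))

  flag⇒diagonal : ∀ {s} n {A : Subgroup s} → Flag A full n → ∃ λ (l : Vec ℕ s) → Diagonal A l
  flag⇒diagonal {s} zero (stop e) = replicate s 0 , record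
    { φ = λ x → x ; φ-+ = λ _ _ → refl ; φ-inj = λ _ e → e ; φ-surj = λ z → z , refl
    ; φ⇒ = λ _ _ → bwd e ∈-full ; φ⇐ = λ x _ → unit x }
    where
    unit : ∀ {k} (x : Vec ℤ k) → DivBy (replicate k 0) x
    unit []       = tt
    unit (x ∷ xs) = divides x (sym (ℤₚ.*-identityʳ x)) , unit xs
  flag⇒diagonal (suc n) f with uncons f
  ... | A′ , v , st , g = refine st (proj₂ (flag⇒diagonal n g))

-- Ranks determine the type

exceeds : ℕ → ℕ → ℕ
exceeds j       zero    = 0
exceeds zero    (suc a) = 1
exceeds (suc j) (suc a) = exceeds j a

-- `gt j l` counts the entries above j: for a partition, part j + 1 of its conjugate.
gt : ∀ {k} → ℕ → Vec ℕ k → ℕ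
gt j []      = 0
gt j (a ∷ l) = exceeds j a ℕ.+ gt j l

gt-pred : ∀ {k} j (l : Vec ℕ k) → gt j (map ℕ.pred l) ≡ gt (suc j) l
gt-pred j []          = refl
gt-pred j (zero ∷ l)  = cong₂ ℕ._+_ {exceeds j 0} refl (gt-pred j l)
gt-pred j (suc a ∷ l) = cong (exceeds j a ℕ.+_) (gt-pred j l)

gt≤length : ∀ {k} j (l : Vec ℕ k) → gt j l ℕ.≤ k
gt≤length j []      = ℕ.z≤n
gt≤length j (a ∷ l) = ℕₚ.+-mono-≤ (≤1 j a) (gt≤length j l)
  where
  ≤1 : ∀ j a → exceeds j a ℕ.≤ 1
  ≤1 zero    zero    = ℕ.z≤n
  ≤1 (suc j) zero    = ℕ.z≤n
  ≤1 zero    (suc a) = ℕₚ.≤-refl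
  ≤1 (suc j) (suc a) = ≤1 j a

sum-pred : ∀ {k} (l : Vec ℕ k) → Vec.sum l ≡ Vec.sum (map ℕ.pred l) ℕ.+ gt 0 l
sum-pred []          = refl
sum-pred (zero ∷ l)  = sum-pred l
sum-pred (suc a ∷ l) = trans (cong (λ z → suc (a ℕ.+ z)) (sum-pred l))
  (trans (cong suc (sym (ℕₚ.+-assoc a _ _))) (sym (ℕₚ.+-suc _ _)))

sum≡0⇒gt≡0 : ∀ {k} j (l : Vec ℕ k) → Vec.sum l ≡ 0 → gt j l ≡ 0
sum≡0⇒gt≡0 j []         e = refl
sum≡0⇒gt≡0 j (zero ∷ l) e = trans (cong (ℕ._+ gt j l) (z j)) (sum≡0⇒gt≡0 j l e)
  where
  z : ∀ j → exceeds j 0 ≡ 0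
  z zero    = refl
  z (suc j) = refl

gt≡0⇒sum≡0 : ∀ {k} (l : Vec ℕ k) → gt 0 l ≡ 0 → Vec.sum l ≡ 0
gt≡0⇒sum≡0 []         e = refl
gt≡0⇒sum≡0 (zero ∷ l) e = gt≡0⇒sum≡0 l e

-- Stated with addition, so that `gt` can be recovered by cancellation; the subtraction in `ranksOf`
-- truncates. The last clause says that the sequence is long enough to exhaust l.
Match : ∀ {N k} → ℕ → Vec ℕ N → Vec ℕ k → Set
Match s []       l = Vec.sum l ≡ 0
Match s (t ∷ ts) l = t ℕ.+ gt 0 l ≡ s × Match s ts (map ℕ.pred l)

ranksOf : ∀ {k} → ℕ → ∀ N → Vec ℕ k → Vec ℕ N
ranksOf s zero    l = []
ranksOf s (suc N) l = s ℕ.∸ gt 0 l ∷ ranksOf s N (map ℕ.pred l)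

match⇒≡ : ∀ {N k} s (t : Vec ℕ N) (l : Vec ℕ k) → Match s t l → t ≡ ranksOf s N l
match⇒≡ s []       l m       = refl
match⇒≡ s (t ∷ ts) l (e , m) = cong₂ _∷_ (trans (sym (ℕₚ.m+n∸n≡m t (gt 0 l))) (cong (ℕ._∸ gt 0 l) e)) (match⇒≡ s ts _ m)

match-ranksOf : ∀ {k} s N (l : Vec ℕ k) → k ℕ.≤ s → Vec.sum l ℕ.≤ N → Match s (ranksOf s N l) l
match-ranksOf s zero    l k≤s h = ℕₚ.n≤0⇒n≡0 h
match-ranksOf s (suc N) l k≤s h = ℕₚ.m∸n+n≡m (ℕₚ.≤-trans (gt≤length 0 l) k≤s) , match-ranksOf s N _ k≤s h′
  where
  -- Taking predecessors lowers the sum by `gt 0 l`. If that is 0, the sum was 0 already; otherwise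
  -- it drops by at least one.
  h′ : Vec.sum (map ℕ.pred l) ℕ.≤ N
  h′ with gt 0 l in eq | sum-pred l
  ... | zero  | e = ℕₚ.≤-trans (ℕₚ.≤-reflexive (trans (sym (ℕₚ.+-identityʳ _)) (trans (sym e) (gt≡0⇒sum≡0 l eq)))) ℕ.z≤n
  ... | suc g | e = ℕₚ.≤-pred (ℕₚ.≤-trans (ℕₚ.≤-trans (ℕ.s≤s (ℕₚ.m≤m+n _ g)) (ℕₚ.≤-reflexive (trans (sym (ℕₚ.+-suc _ g)) (sym e)))) h)

match-gt : ∀ {N k k′} s (t : Vec ℕ N) (l : Vec ℕ k) (l′ : Vec ℕ k′) → Match s t l → Match s t l′ → ∀ j → gt j l ≡ gt j l′
match-gt s []       l l′ m       m′        j       = trans (sum≡0⇒gt≡0 j l m) (sym (sum≡0⇒gt≡0 j l′ m′))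
match-gt s (t ∷ ts) l l′ (e , _) (e′ , _)  zero    = ℕₚ.+-cancelˡ-≡ t _ _ (trans e (sym e′))
match-gt s (t ∷ ts) l l′ (_ , m) (_ , m′)  (suc j) =
  trans (sym (gt-pred j l)) (trans (match-gt s ts _ _ m m′ j) (gt-pred j l′))

private
  exceeds-≢ : ∀ x a → ¬ (a ≡ suc x) → exceeds (suc x) a ≡ exceeds x a
  exceeds-≢ zero    zero          ne = refl
  exceeds-≢ (suc x) zero          ne = refl
  exceeds-≢ zero    (suc zero)    ne = ⊥-elim (ne refl)
  exceeds-≢ zero    (suc (suc a)) ne = refl
  exceeds-≢ (suc x) (suc a)       ne = exceeds-≢ x a (λ e → ne (cong suc e))

  exceeds-mono : ∀ x a → exceeds (suc x) a ℕ.≤ exceeds x a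
  exceeds-mono x       zero          = ℕ.z≤n
  exceeds-mono zero    (suc zero)    = ℕ.z≤n
  exceeds-mono zero    (suc (suc a)) = ℕₚ.≤-refl
  exceeds-mono (suc x) (suc a)       = exceeds-mono x a

  gt-mono : ∀ {k} x (l : Vec ℕ k) → gt (suc x) l ℕ.≤ gt x l
  gt-mono x []      = ℕ.z≤n
  gt-mono x (a ∷ l) = ℕₚ.+-mono-≤ (exceeds-mono x a) (gt-mono x l)

  -- The two counts differ exactly by the number of entries equal to x + 1.
  find : ∀ {k} x (l : Vec ℕ k) → gt (suc x) l ℕ.< gt x l → ∃ λ i → lookup l i ≡ suc x
  find x (a ∷ l) h with a ℕ.≟ suc x
  ... | yes e = zero , e
  ... | no ne = let i , e = find x l (ℕₚ.+-cancelˡ-< (exceeds x a) _ _ (subst (λ z → z ℕ.+ gt (suc x) l ℕ.< exceeds x a ℕ.+ gt x l) (exceeds-≢ x a ne) h)) in suc i , e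

  gt-front : ∀ {k} j (i : Fin (suc k)) l → gt j (front i l) ≡ gt j l
  gt-front j zero (a ∷ l) = refl
  gt-front {suc k} j (suc i) (a ∷ l@(_ ∷ _)) = trans (lem (exceeds j (lookup l i)) (exceeds j a) _) (cong (exceeds j a ℕ.+_) (gt-front j i l))
    where
    lem : ∀ a b c → a ℕ.+ (b ℕ.+ c) ≡ b ℕ.+ (a ℕ.+ c)
    lem a b c = trans (sym (ℕₚ.+-assoc a b c)) (trans (cong (ℕ._+ c) (ℕₚ.+-comm a b)) (ℕₚ.+-assoc b a c))

  exceeds-self : ∀ x → exceeds x (suc x) ≡ 1
  exceeds-self zero    = refl
  exceeds-self (suc x) = exceeds-self x

  exceeds-self′ : ∀ x → exceeds (suc x) (suc x) ≡ 0
  exceeds-self′ zero    = refl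
  exceeds-self′ (suc x) = exceeds-self′ x

module TypeRanks (p : ℕ) (pr : Prime p) where
  open Lattice p pr
  open Flags p pr
  open RankSequences p pr
  open Types p pr
  open Structure p pr

  -- The ranks are not transported along ψ. Instead the indices of A and A : p are computed both
  -- from the ranks and from the type, and the difference of the exponents gives s - t = `gt 0 l`.
  type⇒match : ∀ {s N k} {A : Subgroup s} (t : Vec ℕ N) (l : Vec ℕ k) → HasRanks A t → QuotientIso A l → Match s t l
  type⇒match {A = A} [] l h T = ^-injective _ 0 (HasIndex-unique {A = A} (type-index T) (ranks⇒index [] h))
  type⇒match {s} {A = A} (t ∷ ts) l h@(_ , h′) T = helper (colon-flag t ts h) , type⇒match ts (map ℕ.pred l) h′ (type-colon T)
    where
    open ≡-Reasoning
    e₁ : deficit s ts ℕ.+ (s ℕ.∸ t) ≡ Vec.sum l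
    e₁ = ^-injective _ _ (HasIndex-unique {A = A} (ranks⇒index (t ∷ ts) h) (type-index T))
    e₂ : deficit s ts ≡ Vec.sum (map ℕ.pred l)
    e₂ = ^-injective _ _ (HasIndex-unique {A = colon A} (ranks⇒index ts h′) (type-index (type-colon T)))
    e₃ : s ℕ.∸ t ≡ gt 0 l
    e₃ = ℕₚ.+-cancelˡ-≡ (deficit s ts) _ _ (begin
      deficit s ts ℕ.+ (s ℕ.∸ t)            ≡⟨ e₁ ⟩
      Vec.sum l                              ≡⟨ sum-pred l ⟩
      Vec.sum (map ℕ.pred l) ℕ.+ gt 0 l      ≡⟨ cong (ℕ._+ gt 0 l) e₂ ⟨
      deficit s ts ℕ.+ gt 0 l               ∎)
    helper : ∀ {P : ℕ → Set} → (∃ λ d → t ℕ.+ d ≡ s × P d) → t ℕ.+ gt 0 l ≡ s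
    helper (d , e , _) = trans (cong (t ℕ.+_) (sym e₃)) (ℕₚ.m+[n∸m]≡n (subst (t ℕ.≤_) e (ℕₚ.m≤m+n t d)))

  type⇒ranks : ∀ {s k} N {A : Subgroup s} {l : Vec ℕ k} → Vec.sum l ℕ.≤ N → QuotientIso A l → HasRanks A (ranksOf s N l)
  type⇒ranks {s} N {A} {l} h T = helper (index⇒ranks (type-index T) h)
    where
    helper : (∃ λ (t : Vec ℕ N) → HasRanks A t × deficit s t ≡ Vec.sum l) → HasRanks A (ranksOf s N l)
    helper (t , ht , _) = subst (HasRanks A) (match⇒≡ s t l (type⇒match t l ht T)) ht

  private
    Positive : ∀ {k} → Vec ℕ k → Set
    Positive []      = ⊤
    Positive (a ∷ l) = 0 ℕ.< a × Positive l

    -- Permutes coordinates and discards those with exponent 0, where divisibility is no condition.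
    record Select {n k} (l : Vec ℕ n) (m : Vec ℕ k) : Set where
      field
        ρ      : Vec ℤ n → Vec ℤ k
        ρ-+    : ∀ x y → ρ (x +ᵥ y) ≡ ρ x +ᵥ ρ y
        ρ-surj : ∀ z → ∃ λ x → ρ x ≡ z
        ρ⇒     : ∀ x → DivBy l x → DivBy m (ρ x)
        ρ⇐     : ∀ x → DivBy m (ρ x) → DivBy l x
    open Select

    zeros : ∀ {k} (l : Vec ℕ k) → Vec.sum l ≡ 0 → ∀ x → DivBy l x
    zeros []         e []       = tt
    zeros (zero ∷ l) e (x ∷ xs) = divides x (sym (ℤₚ.*-identityʳ x)) , zeros l e xs

    -- The head x + 1 of m makes `gt` drop between x and x + 1, so l has an entry x + 1 as well; the
    -- two are paired and removed. Once m is empty, all remaining entries of l are 0.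
    select : ∀ {n k} (l : Vec ℕ n) (m : Vec ℕ k) → Positive m → (∀ j → gt j l ≡ gt j m) → Select l m
    select l [] _ e = record
      { ρ = λ _ → [] ; ρ-+ = λ _ _ → refl ; ρ-surj = λ { [] → 0ᵥ , refl } ; ρ⇒ = λ _ _ → tt
      ; ρ⇐ = λ x _ → zeros l (gt≡0⇒sum≡0 l (e 0)) x }
    select {n} l (suc x ∷ m) (_ , pos) e = go l e (find x l lt)
      where
      lt : gt (suc x) l ℕ.< gt x l
      lt = subst₂ ℕ._<_ (sym (trans (e (suc x)) (cong (ℕ._+ gt (suc x) m) (exceeds-self′ x))))
             (sym (trans (e x) (cong (ℕ._+ gt x m) (exceeds-self x)))) (ℕ.s≤s (gt-mono x m))
      go : ∀ {n} (l : Vec ℕ n) → (∀ j → gt j l ≡ gt j (suc x ∷ m)) → (∃ λ i → lookup l i ≡ suc x) → Select l (suc x ∷ m)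
      go {suc n} l e (i , l≡) = record
        { ρ = λ z → lookup z i ∷ ρ S (removeAt z i)
        ; ρ-+ = λ y z → let eq = front-zipWith ℤ._+_ i y z in
            cong₂ _∷_ (Vecₚ.∷-injectiveˡ eq) (trans (cong (ρ S) (Vecₚ.∷-injectiveʳ eq)) (ρ-+ S _ _))
        ; ρ-surj = λ { (z ∷ zs) → let y , eq = ρ-surj S zs in
            insertAt y i z , cong₂ _∷_ (Vecₚ.insertAt-lookup y i z) (trans (cong (ρ S) (Vecₚ.removeAt-insertAt y i z)) eq) }
        ; ρ⇒ = λ z d → let d₀ , d₁ = front-DivBy i l d in subst (λ a → + (p ^ a) ∣ _) l≡ d₀ , ρ⇒ S _ d₁
        ; ρ⇐ = λ { z (d₀ , d₁) → unfront-DivBy i l (subst (λ a → + (p ^ a) ∣ _) (sym l≡) d₀ , ρ⇐ S _ d₁) } }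
        where
        S : Select (removeAt l i) m
        S = select (removeAt l i) m pos λ j → ℕₚ.+-cancelˡ-≡ (exceeds j (suc x)) _ _
              (trans (cong (λ a → exceeds j a ℕ.+ gt j (removeAt l i)) (sym l≡)) (trans (gt-front j i l) (e j)))

    select-type : ∀ {s n k} {A : Subgroup s} {l : Vec ℕ n} {m : Vec ℕ k} → Select l m → QuotientIso A l → QuotientIso A m
    select-type {l = l} {m} S T = record
      { ψ = ρ S ∘ ψ T
      ; ψ-+ = λ x y → ≈-trans (resp (ψ-+ T x y)) (≡⇒≈ (ρ-+ S (ψ T x) (ψ T y)))
      ; ker⊑ = λ x h → ker⊑ T x (to-Δ (ρ⇐ S _ (from-Δ h)))
      ; ker⊒ = λ x h → to-Δ (ρ⇒ S _ (from-Δ (ker⊒ T x h)))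
      ; ψ-surj = λ z → let y , e = ρ-surj S z ; x , e′ = ψ-surj T y in x , ≈-trans (resp e′) (≡⇒≈ e) }
      where
      resp : ∀ {x y} → x ≈[ Δ l ] y → ρ S x ≈[ Δ m ] ρ S y
      resp {x} {y} e = ≈-trans (≡⇒≈ (trans (cong (ρ S) (trans (sym (diff-cancel x y)) (+ᵥ-comm _ y))) (ρ-+ S y _)))
                         (≈-+∈ (to-Δ (ρ⇒ S _ (from-Δ (diff e)))))

    positive : ∀ (l : List ℕ) → All (0 ℕ.<_) l → Positive (fromList l)
    positive []      []       = tt
    positive (a ∷ l) (h ∷ hs) = h , positive l hs

  -- Diagonalisation yields some exponents l′, s in number. The ranks force `gt j l′` = `gt j l` for
  -- all j, so l′ is l up to order and zeros.
  ranks⇒HasType : ∀ {s} N {A : Subgroup s} (l : List ℕ) → All (0 ℕ.<_) l → length l ℕ.≤ s → Vec.sum (fromList l) ℕ.≤ N →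
                  HasRanks A (ranksOf s N (fromList l)) → HasType p A l
  ranks⇒HasType {s} N {A} l pos len h ranks = toHasType l (helper (flag⇒diagonal _ (index-flag _ ranks)))
    where
    helper : (∃ λ (l′ : Vec ℕ s) → Diagonal A l′) → QuotientIso A (fromList l)
    helper (l′ , D) = select-type (select l′ (fromList l) (positive l pos)
      (match-gt s (ranksOf s N (fromList l)) l′ (fromList l) (type⇒match _ l′ ranks T) (match-ranksOf s N (fromList l) len h))) T
      where T = diagonal⇒type D

  HasType⇒ranks : ∀ {s} N {A : Subgroup s} (l : List ℕ) → Vec.sum (fromList l) ℕ.≤ N → HasType p A l → HasRanks A (ranksOf s N (fromList l))
  HasType⇒ranks N l h T = type⇒ranks N h (fromHasType l T)

-- Linear algebra over ℤ and sl₂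

private
  combine-rows : ∀ {a} → ℤ → ℤ → Vec ℤ a → Vec ℤ a → Vec ℤ a
  combine-rows m n []       []       = []
  combine-rows m n (x ∷ xs) (y ∷ ys) = m ℤ.* x ℤ.- n ℤ.* y ∷ combine-rows m n xs ys

  dot-combine : ∀ {a} m n (x y c : Vec ℤ a) → dot (combine-rows m n x y) c ≡ m ℤ.* dot x c ℤ.- n ℤ.* dot y c
  dot-combine m n []       []       []       = lem m n
    where
    lem : ∀ m n → 0ℤ ≡ m ℤ.* 0ℤ ℤ.- n ℤ.* 0ℤ
    lem = solve-∀
  dot-combine m n (x ∷ xs) (y ∷ ys) (c ∷ cs) =
    trans (cong (λ z → (m ℤ.* x ℤ.- n ℤ.* y) ℤ.* c ℤ.+ z) (dot-combine m n xs ys cs)) (lem m n x y c (dot xs cs) (dot ys cs))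
    where
    lem : ∀ m n x y c u v → (m ℤ.* x ℤ.- n ℤ.* y) ℤ.* c ℤ.+ (m ℤ.* u ℤ.- n ℤ.* v) ≡ m ℤ.* (x ℤ.* c ℤ.+ u) ℤ.- n ℤ.* (y ℤ.* c ℤ.+ v)
    lem = solve-∀

  dot-scale : ∀ {a} m (x c : Vec ℤ a) → dot x (map (m ℤ.*_) c) ≡ m ℤ.* dot x c
  dot-scale m []       []       = sym (ℤₚ.*-zeroʳ m)
  dot-scale m (x ∷ xs) (c ∷ cs) = trans (cong (λ z → x ℤ.* (m ℤ.* c) ℤ.+ z) (dot-scale m xs cs)) (lem m x c (dot xs cs))
    where
    lem : ∀ m x c u → x ℤ.* (m ℤ.* c) ℤ.+ m ℤ.* u ≡ m ℤ.* (x ℤ.* c ℤ.+ u)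
    lem = solve-∀

  dot-zeroʳ : ∀ {a} (x : Vec ℤ a) → dot x (replicate a 0ℤ) ≡ 0ℤ
  dot-zeroʳ []       = refl
  dot-zeroʳ (x ∷ xs) = cong₂ ℤ._+_ (ℤₚ.*-zeroʳ x) (dot-zeroʳ xs)

  HeadZero : ∀ {a} → Vec ℤ (suc a) → Set
  HeadZero r = Vec.head r ≡ 0ℤ

  pivot-row : ∀ {a} (rs : List (Vec ℤ (suc a))) →
              All HeadZero rs ⊎ (∃₂ λ us r → ∃ λ ws → rs ≡ us ++ r ∷ ws × ¬ HeadZero r)
  pivot-row [] = inj₁ []
  pivot-row (r ∷ rs) with Vec.head r ℤ.≟ 0ℤ | pivot-row rs
  ... | no ne | _ = inj₂ ([] , r , rs , refl , ne)
  ... | yes e | inj₁ h = inj₁ (e ∷ h)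
  ... | yes e | inj₂ (us , r′ , ws , refl , ne) = inj₂ (r ∷ us , r′ , ws , refl , ne)

-- Elimination without fractions: every row other than the pivot row is multiplied by the pivot
-- entry before the first unknown is cleared.
kernel : ∀ a (rs : List (Vec ℤ a)) → length rs ℕ.< a →
         ∃ λ (c : Vec ℤ a) → (∃ λ i → ¬ (lookup c i ≡ 0ℤ)) × All (λ r → dot r c ≡ 0ℤ) rs
kernel (suc a) rs h with pivot-row rs
... | inj₁ zs = 1ℤ ∷ replicate a 0ℤ , (zero , λ ()) , All.map (λ {r} → unit r) zs
  where
  unit : (r : Vec ℤ (suc a)) → HeadZero r → dot r (1ℤ ∷ replicate a 0ℤ) ≡ 0ℤ
  unit (x ∷ xs) refl = trans (ℤₚ.+-identityˡ _) (dot-zeroʳ xs)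
... | inj₂ (us , m ∷ r , ws , refl , m≢0) = solution (kernel a (List.map eliminate (us ++ ws)) h′)
  where
  eliminate : Vec ℤ (suc a) → Vec ℤ a
  eliminate (x ∷ xs) = combine-rows m x xs r
  h′ : length (List.map eliminate (us ++ ws)) ℕ.< a
  h′ = ℕₚ.≤-pred (subst (ℕ._< suc a) (trans (Listₚ.length-++ us) (trans (ℕₚ.+-suc (length us) (length ws))
         (cong suc (trans (sym (Listₚ.length-++ us)) (sym (Listₚ.length-map eliminate (us ++ ws))))))) h)
  solution : (∃ λ (c : Vec ℤ a) → (∃ λ i → ¬ (lookup c i ≡ 0ℤ)) × All (λ r → dot r c ≡ 0ℤ) (List.map eliminate (us ++ ws))) →
             ∃ λ (c : Vec ℤ (suc a)) → (∃ λ i → ¬ (lookup c i ≡ 0ℤ)) × All (λ r → dot r c ≡ 0ℤ) (us ++ (m ∷ r) ∷ ws)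
  solution (c , (i , cᵢ≢0) , zs) = d , (suc i , dᵢ≢0) , Allₚ.++⁺ (proj₁ (Allₚ.++⁻ us zs′)) (row-r ∷ proj₂ (Allₚ.++⁻ us zs′))
    where
    d : Vec ℤ (suc a)
    -- Scaling c by the pivot entry m lets the first unknown solve the pivot row over the integers.
    d = ℤ.- dot r c ∷ map (m ℤ.*_) c
    dᵢ≢0 : ¬ (lookup (map (m ℤ.*_) c) i ≡ 0ℤ)
    dᵢ≢0 e with ℤₚ.i*j≡0⇒i≡0∨j≡0 m (trans (sym (Vecₚ.lookup-map i (m ℤ.*_) c)) e)
    ... | inj₁ m≡0 = m≢0 m≡0
    ... | inj₂ c≡0 = cᵢ≢0 c≡0
    row-r : dot (m ∷ r) d ≡ 0ℤ
    row-r = trans (cong (λ z → m ℤ.* (ℤ.- dot r c) ℤ.+ z) (dot-scale m r c)) (lem m (dot r c))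
      where
      lem : ∀ m u → m ℤ.* (ℤ.- u) ℤ.+ m ℤ.* u ≡ 0ℤ
      lem = solve-∀
    row : ∀ x → dot (eliminate x) c ≡ 0ℤ → dot x d ≡ 0ℤ
    row (x ∷ xs) e = trans (cong (λ z → x ℤ.* (ℤ.- dot r c) ℤ.+ z) (dot-scale m xs c))
        (trans (lem x (dot r c) m (dot xs c)) (trans (sym (dot-combine m x xs r c)) e))
      where
      lem : ∀ x u m w → x ℤ.* (ℤ.- u) ℤ.+ m ℤ.* w ≡ m ℤ.* w ℤ.- x ℤ.* u
      lem = solve-∀
    zs′ : All (λ x → dot x d ≡ 0ℤ) (us ++ ws)
    zs′ = All.map (λ {x} → row x) (Allₚ.map⁻ zs)

-- A matrix stored by rows. `act` applies it to functions, so an operator whose rows list elements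
-- one grade lower carries functions on grade k to functions on grade k + 1.
Op : Set → Set
Op X = X → List (ℤ × X)

lin : ∀ {X : Set} → List (ℤ × X) → (X → ℤ) → ℤ
lin []             v = 0ℤ
lin ((c , x) ∷ xs) v = c ℤ.* v x ℤ.+ lin xs v

act : ∀ {X : Set} → Op X → (X → ℤ) → X → ℤ
act E v x = lin (E x) v

module _ {X : Set} where

  lin-++ : ∀ (xs ys : List (ℤ × X)) v → lin (xs ++ ys) v ≡ lin xs v ℤ.+ lin ys v
  lin-++ []             ys v = sym (ℤₚ.+-identityˡ _)
  lin-++ ((c , x) ∷ xs) ys v = trans (cong (λ z → c ℤ.* v x ℤ.+ z) (lin-++ xs ys v)) (sym (ℤₚ.+-assoc (c ℤ.* v x) (lin xs v) (lin ys v)))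

  lin-cong : ∀ (xs : List (ℤ × X)) {v w : X → ℤ} → All (λ cx → v (proj₂ cx) ≡ w (proj₂ cx)) xs → lin xs v ≡ lin xs w
  lin-cong []             []       = refl
  lin-cong ((c , x) ∷ xs) (e ∷ es) = cong₂ (λ a b → c ℤ.* a ℤ.+ b) e (lin-cong xs es)

  lin-cong′ : ∀ (xs : List (ℤ × X)) {v w : X → ℤ} → (∀ x → v x ≡ w x) → lin xs v ≡ lin xs w
  lin-cong′ xs e = lin-cong xs (All.universal (λ cx → e (proj₂ cx)) xs)

  lin-+ : ∀ (xs : List (ℤ × X)) v w → lin xs (λ x → v x ℤ.+ w x) ≡ lin xs v ℤ.+ lin xs w
  lin-+ []             v w = refl
  lin-+ ((c , x) ∷ xs) v w = trans (cong (λ z → c ℤ.* (v x ℤ.+ w x) ℤ.+ z) (lin-+ xs v w)) (lem c (v x) (w x) (lin xs v) (lin xs w))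
    where
    lem : ∀ c a b u w → c ℤ.* (a ℤ.+ b) ℤ.+ (u ℤ.+ w) ≡ (c ℤ.* a ℤ.+ u) ℤ.+ (c ℤ.* b ℤ.+ w)
    lem = solve-∀

  lin-* : ∀ (xs : List (ℤ × X)) k v → lin xs (λ x → k ℤ.* v x) ≡ k ℤ.* lin xs v
  lin-* []             k v = sym (ℤₚ.*-zeroʳ k)
  lin-* ((c , x) ∷ xs) k v = trans (cong (λ z → c ℤ.* (k ℤ.* v x) ℤ.+ z) (lin-* xs k v)) (lem c k (v x) (lin xs v))
    where
    lem : ∀ c k a u → c ℤ.* (k ℤ.* a) ℤ.+ k ℤ.* u ≡ k ℤ.* (c ℤ.* a ℤ.+ u)
    lem = solve-∀

  lin-0 : ∀ (xs : List (ℤ × X)) → lin xs (λ _ → 0ℤ) ≡ 0ℤ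
  lin-0 []             = refl
  lin-0 ((c , x) ∷ xs) = cong₂ ℤ._+_ (ℤₚ.*-zeroʳ c) (lin-0 xs)

  lin-map : ∀ {Y : Set} (g : X → Y) xs (v : Y → ℤ) → lin (List.map (λ cx → proj₁ cx , g (proj₂ cx)) xs) v ≡ lin xs (v ∘ g)
  lin-map g []             v = refl
  lin-map g ((c , x) ∷ xs) v = cong (λ z → c ℤ.* v (g x) ℤ.+ z) (lin-map g xs v)

lin-comm : ∀ {X Y : Set} (xs : List (ℤ × X)) (ys : List (ℤ × Y)) (v : X → Y → ℤ) →
           lin xs (λ x → lin ys (v x)) ≡ lin ys (λ y → lin xs (λ x → v x y))
lin-comm []             ys v = sym (lin-0 ys)
lin-comm ((c , x) ∷ xs) ys v = trans (cong₂ ℤ._+_ (sym (lin-* ys c (v x))) (lin-comm xs ys v)) (sym (lin-+ ys _ _))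

-- E shifts the weight by −2 and F by +2; on a positive weight E is injective, because E F^(j+1) v is a
-- nonzero multiple of F^j v whenever E v = 0, while F^j v vanishes for large j.
module Raising {X : Set} (In : X → Set) (E F : Op X) (wt : X → ℤ) (M : ℤ)
  (E-in : ∀ {x} → In x → All (λ cy → In (proj₂ cy)) (E x))
  (F-in : ∀ {x} → In x → All (λ cy → In (proj₂ cy) × wt x ≡ wt (proj₂ cy) ℤ.+ + 2) (F x))
  (bound : ∀ {x} → In x → wt x ℤ.≤ M)
  (comm : ∀ v {x} → In x → act F (act E v) x ≡ act E (act F v) x ℤ.+ wt x ℤ.* v x)
  where

  Supported : ℤ → (X → ℤ) → Set
  Supported w v = ∀ {x} → In x → ¬ (wt x ≡ w) → v x ≡ 0ℤ

  F-supported : ∀ {w v} → Supported w v → Supported (w ℤ.+ + 2) (act F v)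
  F-supported {w} {v} sup {x} x∈ ne = trans (lin-cong (F x) (All.map (λ { (y∈ , e) → sup y∈ λ e′ → ne (trans e (cong (ℤ._+ + 2) e′)) }) (F-in x∈))) (lin-0 (F x))

  iterate : ℕ → (X → ℤ) → X → ℤ
  iterate zero    v = v
  iterate (suc j) v = act F (iterate j v)

  weight : ℕ → ℤ → ℤ
  weight zero    w = w
  weight (suc j) w = weight j w ℤ.+ + 2

  iterate-supported : ∀ j {w v} → Supported w v → Supported (weight j w) (iterate j v)
  iterate-supported zero    sup = sup
  iterate-supported (suc j) {w} {v} sup = F-supported {weight j w} {iterate j v} (iterate-supported j sup)

  private
    wt-* : ∀ {w v} → Supported w v → ∀ {x} → In x → wt x ℤ.* v x ≡ w ℤ.* v x
    wt-* {w} {v} sup {x} x∈ with wt x ℤ.≟ w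
    ... | yes e = cong (ℤ._* v x) e
    ... | no ne = trans (cong (wt x ℤ.*_) (sup x∈ ne)) (trans (ℤₚ.*-zeroʳ (wt x)) (sym (trans (cong (w ℤ.*_) (sup x∈ ne)) (ℤₚ.*-zeroʳ w))))

    -- This is (j + 1)(w + j), kept as the sum of w, w + 2, ..., w + 2j so that positivity is
    -- immediate.
    coef : ℕ → ℤ → ℤ
    coef zero    w = w
    coef (suc j) w = coef j w ℤ.+ weight (suc j) w

    weight>0 : ∀ j {w} → 0ℤ ℤ.< w → 0ℤ ℤ.< weight j w
    weight>0 zero    h = h
    weight>0 (suc j) h = ℤₚ.+-mono-<-≤ (weight>0 j h) (ℤ.+≤+ ℕ.z≤n)

    coef>0 : ∀ j {w} → 0ℤ ℤ.< w → 0ℤ ℤ.< coef j w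
    coef>0 zero    h = h
    coef>0 (suc j) h = ℤₚ.+-mono-< (coef>0 j h) (weight>0 (suc j) h)

  module _ {w v} (sup : Supported w v) (w>0 : 0ℤ ℤ.< w) (Ev≡0 : ∀ {x} → In x → act E v x ≡ 0ℤ) where

    E-iterate : ∀ j {x} → In x → act E (iterate (suc j) v) x ≡ ℤ.- coef j w ℤ.* iterate j v x
    E-iterate zero {x} x∈ = lem (act E (act F v) x) (wt x) (v x) w (wt-* sup x∈)
        (trans (sym (comm v x∈)) (trans (lin-cong (F x) (All.map (λ h → Ev≡0 (proj₁ h)) (F-in x∈))) (lin-0 (F x))))
      where
      lem : ∀ a t u w → t ℤ.* u ≡ w ℤ.* u → a ℤ.+ t ℤ.* u ≡ 0ℤ → a ≡ ℤ.- w ℤ.* u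
      lem a t u w e₁ e₂ = trans (l₁ a (t ℤ.* u)) (trans (cong₂ ℤ._-_ e₂ e₁) (l₂ w u))
        where
        l₁ : ∀ a b → a ≡ a ℤ.+ b ℤ.- b
        l₁ = solve-∀
        l₂ : ∀ w u → 0ℤ ℤ.- w ℤ.* u ≡ ℤ.- w ℤ.* u
        l₂ = solve-∀
    E-iterate (suc j) {x} x∈ = lem (act E (act F u) x) (wt x) (u x) (weight (suc j) w) (coef j w) (wt-* (iterate-supported (suc j) sup) x∈)
        (trans (sym (comm u x∈)) (trans (lin-cong (F x) (All.map (λ h → E-iterate j (proj₁ h)) (F-in x∈))) (lin-* (F x) (ℤ.- coef j w) (iterate j v))))
      where
      u = iterate (suc j) v
      lem : ∀ a t u w c → t ℤ.* u ≡ w ℤ.* u → a ℤ.+ t ℤ.* u ≡ ℤ.- c ℤ.* u → a ≡ ℤ.- (c ℤ.+ w) ℤ.* u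
      lem a t u w c e₁ e₂ = trans (l₁ a (t ℤ.* u)) (trans (cong₂ ℤ._-_ e₂ e₁) (l₂ c w u))
        where
        l₁ : ∀ a b → a ≡ a ℤ.+ b ℤ.- b
        l₁ = solve-∀
        l₂ : ∀ c w u → ℤ.- c ℤ.* u ℤ.- w ℤ.* u ≡ ℤ.- (c ℤ.+ w) ℤ.* u
        l₂ = solve-∀

    descend : ∀ j → (∀ {x} → In x → iterate j v x ≡ 0ℤ) → ∀ {x} → In x → v x ≡ 0ℤ
    descend zero    h = h
    descend (suc j) h = descend j λ {x} x∈ → nonzero (ℤₚ.i*j≡0⇒i≡0∨j≡0 (ℤ.- coef j w)
      (trans (sym (E-iterate j x∈)) (trans (lin-cong (E x) (All.map h (E-in x∈))) (lin-0 (E x)))))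
      where
      nonzero : ∀ {z} → ℤ.- coef j w ≡ 0ℤ ⊎ z ≡ 0ℤ → z ≡ 0ℤ
      nonzero (inj₁ e) = ⊥-elim (ℤₚ.<-irrefl (sym (ℤₚ.neg-injective {coef j w} {0ℤ} e)) (coef>0 j w>0))
      nonzero (inj₂ e) = e

    weight≥ : ∀ j → + j ℤ.≤ weight j w
    weight≥ zero    = ℤₚ.<⇒≤ w>0
    weight≥ (suc j) = ℤₚ.≤-trans (ℤₚ.≤-reflexive (ℤₚ.+-comm 1ℤ (+ j))) (ℤₚ.+-mono-≤ (weight≥ j) (ℤ.+≤+ (ℕ.s≤s ℕ.z≤n)))

    injective : ∀ {x} → In x → v x ≡ 0ℤ
    injective = descend J λ {x} x∈ → iterate-supported J sup x∈ λ e →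
        ℤₚ.<-irrefl refl (ℤₚ.<-≤-trans M<J (ℤₚ.≤-trans (weight≥ J) (subst (ℤ._≤ M) e (bound x∈))))
      where
      -- F^J v has weight w + 2J, which exceeds M, and no element has such a weight.
      J = suc ℤ.∣ M ∣
      M<J : M ℤ.< + J
      M<J = below-abs M
        where
        below-abs : ∀ M → M ℤ.< + suc ℤ.∣ M ∣
        below-abs (+ n)    = ℤ.+<+ (ℕₚ.n<1+n n)
        below-abs -[1+ n ] = ℤ.-<+

module _ {X : Set} (_≟X_ : DecidableEquality X) where

  private
    δ : X → X → ℤ
    δ y x = if does (y ≟X x) then 1ℤ else 0ℤ

    δ-≡ : ∀ x → δ x x ≡ 1ℤ
    δ-≡ x with x ≟X x
    ... | yes _ = refl
    ... | no ne = ⊥-elim (ne refl)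

    δ-≢ : ∀ {x y} → ¬ (y ≡ x) → δ y x ≡ 0ℤ
    δ-≢ {x} {y} ne with y ≟X x
    ... | yes e = ⊥-elim (ne e)
    ... | no _  = refl

    comb : ∀ {a} → Vec ℤ a → Vec X a → X → ℤ
    comb []       []       x = 0ℤ
    comb (c ∷ cs) (y ∷ ys) x = c ℤ.* δ y x ℤ.+ comb cs ys x

    comb-∉ : ∀ xs (c : Vec ℤ (length xs)) {x} → x ∉ˡ xs → comb c (fromList xs) x ≡ 0ℤ
    comb-∉ []       []       x∉ = refl
    comb-∉ (y ∷ ys) (c ∷ cs) {x} x∉ = trans (cong₂ (λ a b → c ℤ.* a ℤ.+ b) (δ-≢ (λ e → x∉ (here (sym e)))) (comb-∉ ys cs (λ h → x∉ (there h))))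
      (trans (ℤₚ.+-identityʳ _) (ℤₚ.*-zeroʳ c))

    lookup-∈ : ∀ (xs : List X) i → lookup (fromList xs) i ∈ˡ xs
    lookup-∈ (x ∷ xs) zero    = here refl
    lookup-∈ (x ∷ xs) (suc i) = there (lookup-∈ xs i)

    comb-lookup : ∀ xs → Unique xs → (c : Vec ℤ (length xs)) → ∀ i → comb c (fromList xs) (lookup (fromList xs) i) ≡ lookup c i
    comb-lookup (y ∷ ys) (y∉ ∷ u) (c ∷ cs) zero = trans (cong₂ (λ a b → c ℤ.* a ℤ.+ b) (δ-≡ y) (comb-∉ ys cs (λ h → All.lookup y∉ h refl)))
      (trans (ℤₚ.+-identityʳ _) (ℤₚ.*-identityʳ c))
    comb-lookup (y ∷ ys) (y∉ ∷ u) (c ∷ cs) (suc i) =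
      trans (cong₂ (λ a b → c ℤ.* a ℤ.+ b) (δ-≢ (All.lookup y∉ (lookup-∈ ys i))) (comb-lookup ys u cs i))
        (trans (cong (ℤ._+ lookup cs i) (ℤₚ.*-zeroʳ c)) (ℤₚ.+-identityˡ _))

    act-comb : ∀ {a} (E : Op X) (c : Vec ℤ a) (zs : Vec X a) y → act E (comb c zs) y ≡ dot (map (λ x → act E (δ x) y) zs) c
    act-comb E []       []       y = lin-0 (E y)
    act-comb E (c ∷ cs) (z ∷ zs) y = trans (lin-+ (E y) (λ x → c ℤ.* δ z x) (comb cs zs))
      (cong₂ ℤ._+_ (trans (lin-* (E y) c (δ z)) (ℤₚ.*-comm c _)) (act-comb E cs zs y))

  -- With fewer rows than columns, `kernel` gives a nonzero combination of the delta functions on xs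
  -- that E annihilates on ys.
  injective⇒length≤ : (E : Op X) (xs ys : List X) → Unique xs →
    (∀ v → (∀ {x} → x ∉ˡ xs → v x ≡ 0ℤ) → (∀ {y} → y ∈ˡ ys → act E v y ≡ 0ℤ) → ∀ {x} → x ∈ˡ xs → v x ≡ 0ℤ) →
    length xs ℕ.≤ length ys
  injective⇒length≤ E xs ys u inj with length xs ℕ.≤? length ys
  ... | yes h = h
  ... | no ¬h = ⊥-elim (contra (kernel (length xs) rows (subst (ℕ._< length xs) (sym (Listₚ.length-map row ys)) (ℕₚ.≰⇒> ¬h))))
    where
    row : X → Vec ℤ (length xs)
    row y = map (λ x → act E (δ x) y) (fromList xs)
    rows = List.map row ys
    contra : ¬ (∃ λ (c : Vec ℤ (length xs)) → (∃ λ i → ¬ (lookup c i ≡ 0ℤ)) × All (λ r → dot r c ≡ 0ℤ) rows)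
    contra (c , (i , cᵢ≢0) , zs) = cᵢ≢0 (trans (sym (comb-lookup xs u c i))
      (inj (comb c (fromList xs)) (comb-∉ xs c)
        (λ {y} y∈ → trans (act-comb E c (fromList xs) y) (All.lookup (Allₚ.map⁻ zs) y∈)) (lookup-∈ xs i)))

-- A graded set carrying raising and lowering operators with the commutation relation of sl₂.
record Rep : Set₁ where
  field
    X     : Set
    _≟X_  : DecidableEquality X
    In    : X → Set
    els   : List X
    els-unique : Unique els
    els⇒In : ∀ {x} → x ∈ˡ els → In x
    In⇒els : ∀ {x} → In x → x ∈ˡ els
    gr    : X → ℕ
    D     : ℕ
    E F   : Op X
    E-in  : ∀ {x} → In x → All (λ cy → In (proj₂ cy) × gr x ≡ suc (gr (proj₂ cy))) (E x)
    F-in  : ∀ {x} → In x → All (λ cy → In (proj₂ cy) × gr (proj₂ cy) ≡ suc (gr x)) (F x)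
    comm  : ∀ v {x} → In x → act F (act E v) x ≡ act E (act F v) x ℤ.+ (+ D ℤ.- + 2 ℤ.* + gr x) ℤ.* v x

  grades : List ℕ
  grades = List.map gr els

  level : ℕ → List X
  level k = filter (λ x → gr x ℕ.≟ k) els

module _ (R : Rep) where
  open Rep R

  private
    wt : X → ℤ
    wt x = + D ℤ.- + 2 ℤ.* + gr x

    step : ∀ (d : ℤ) g h → h ≡ suc g → d ℤ.- + 2 ℤ.* + g ≡ (d ℤ.- + 2 ℤ.* + h) ℤ.+ + 2
    step d g h refl = trans (lem d (+ g)) refl
      where
      lem : ∀ d g → d ℤ.- + 2 ℤ.* g ≡ (d ℤ.- + 2 ℤ.* (1ℤ ℤ.+ g)) ℤ.+ + 2
      lem = solve-∀

    neg-step : ∀ (d : ℤ) g h → h ≡ suc g → ℤ.- (d ℤ.- + 2 ℤ.* + h) ≡ ℤ.- (d ℤ.- + 2 ℤ.* + g) ℤ.+ + 2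
    neg-step d g h refl = lem d (+ g)
      where
      lem : ∀ d g → ℤ.- (d ℤ.- + 2 ℤ.* (1ℤ ℤ.+ g)) ≡ ℤ.- (d ℤ.- + 2 ℤ.* g) ℤ.+ + 2
      lem = solve-∀

    2*-pos : ∀ g → + 2 ℤ.* + g ≡ + (2 ℕ.* g)
    2*-pos g = sym (ℤₚ.pos-* 2 g)

    wt≤D : ∀ {x} → In x → wt x ℤ.≤ + D
    wt≤D {x} _ = ℤₚ.≤-trans (ℤₚ.+-monoʳ-≤ (+ D) (ℤₚ.neg-mono-≤ (subst (0ℤ ℤ.≤_) (sym (2*-pos (gr x))) (ℤ.+≤+ ℕ.z≤n))))
                   (ℤₚ.≤-reflexive (ℤₚ.+-identityʳ (+ D)))

    E-in′ : ∀ {x} → In x → All (λ cy → In (proj₂ cy)) (E x)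
    E-in′ x∈ = All.map proj₁ (E-in x∈)

    F-in′ : ∀ {x} → In x → All (λ cy → In (proj₂ cy)) (F x)
    F-in′ x∈ = All.map proj₁ (F-in x∈)

    F-wt : ∀ {x} → In x → All (λ cy → In (proj₂ cy) × wt x ≡ wt (proj₂ cy) ℤ.+ + 2) (F x)
    F-wt {x} x∈ = All.map (λ { {_ , y} (y∈ , e) → y∈ , step (+ D) (gr x) (gr y) e }) (F-in x∈)

    module Up = Raising In E F wt (+ D) E-in′ F-wt wt≤D comm

    -- The sum of all grades, a crude bound for each of them; it bounds the negated weight from
    -- above.
    bound : ℕ
    bound = ListAction.sum grades

    gr≤bound : ∀ {x} xs → x ∈ˡ xs → gr x ℕ.≤ ListAction.sum (List.map gr xs)
    gr≤bound (y ∷ ys) (here refl) = ℕₚ.m≤m+n _ _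
    gr≤bound (y ∷ ys) (there h)   = ℕₚ.≤-trans (gr≤bound ys h) (ℕₚ.m≤n+m _ _)

    -wt : X → ℤ
    -wt x = ℤ.- wt x

    -wt≤ : ∀ {x} → In x → -wt x ℤ.≤ + (2 ℕ.* bound)
    -wt≤ {x} x∈ = ℤₚ.≤-trans (ℤₚ.≤-reflexive (lem (+ D) (+ 2 ℤ.* + gr x)))
         (ℤₚ.≤-trans (ℤₚ.+-monoʳ-≤ (+ 2 ℤ.* + gr x) (ℤₚ.neg-mono-≤ (ℤ.+≤+ (ℕ.z≤n {D}))))
         (ℤₚ.≤-trans (ℤₚ.≤-reflexive (trans (ℤₚ.+-identityʳ _) (2*-pos (gr x)))) (ℤ.+≤+ (ℕₚ.*-monoʳ-≤ 2 (gr≤bound els (In⇒els x∈))))))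
      where
      lem : ∀ d a → ℤ.- (d ℤ.- a) ≡ a ℤ.- d
      lem = solve-∀

    E-wt : ∀ {x} → In x → All (λ cy → In (proj₂ cy) × -wt x ≡ -wt (proj₂ cy) ℤ.+ + 2) (E x)
    E-wt {x} x∈ = All.map (λ { {_ , y} (y∈ , e) → y∈ , neg-step (+ D) (gr y) (gr x) e }) (E-in x∈)

    comm′ : ∀ v {x} → In x → act E (act F v) x ≡ act F (act E v) x ℤ.+ -wt x ℤ.* v x
    comm′ v {x} x∈ = trans (lem (act E (act F v) x) (wt x) (v x)) (cong (ℤ._+ -wt x ℤ.* v x) (sym (comm v x∈)))
      where
      lem : ∀ a w u → a ≡ a ℤ.+ w ℤ.* u ℤ.+ (ℤ.- w) ℤ.* u
      lem = solve-∀

    -- Exchanging E and F and negating the weight preserves the relation, so F is injective on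
    -- negative weights.
    module Down = Raising In F E -wt (+ (2 ℕ.* bound)) F-in′ E-wt -wt≤ comm′

    level⇒In : ∀ k {x} → x ∈ˡ level k → In x × gr x ≡ k
    level⇒In k h = let h₁ , h₂ = ∈-filter⁻ (λ x → gr x ℕ.≟ k) h in els⇒In h₁ , h₂

    In⇒level : ∀ {k x} → In x → gr x ≡ k → x ∈ˡ level k
    In⇒level {k} h e = ∈-filter⁺ (λ x → gr x ℕ.≟ k) (In⇒els h) e

    level-unique : ∀ k → Unique (level k)
    level-unique k = Uniqueₚ.filter⁺ (λ x → gr x ℕ.≟ k) els-unique

    vanish : ∀ {k} (v : X → ℤ) → (∀ {x} → x ∉ˡ level k → v x ≡ 0ℤ) → ∀ xs →
             All (λ cy → ¬ (gr (proj₂ cy) ≡ k)) xs → lin xs v ≡ 0ℤ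
    vanish {k} v sup xs h = trans (lin-cong xs (All.map (λ ne → sup (λ y∈ → ne (proj₂ (level⇒In k y∈)))) h)) (lin-0 xs)

  level-increasing : ∀ k → 2 ℕ.* k ℕ.< D → length (level k) ℕ.≤ length (level (suc k))
  level-increasing k 2k<D = injective⇒length≤ _≟X_ E (level k) (level (suc k)) (level-unique k) λ v sup ev x∈ →
    Up.injective {w = + D ℤ.- + 2 ℤ.* + k} {v} (λ x∈ ne → sup (λ h → ne (cong (λ z → + D ℤ.- + 2 ℤ.* + z) (proj₂ (level⇒In k h))))) w>0
      (λ {x} x∈ → E-zero v sup ev x∈) (proj₁ (level⇒In k x∈))
    where
    w>0 : 0ℤ ℤ.< + D ℤ.- + 2 ℤ.* + k
    w>0 = subst (ℤ._< + D ℤ.- + 2 ℤ.* + k) (ℤₚ.+-inverseʳ (+ 2 ℤ.* + k))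
            (ℤₚ.+-monoˡ-< (ℤ.- (+ 2 ℤ.* + k)) (subst (ℤ._< + D) (sym (2*-pos k)) (ℤ.+<+ 2k<D)))
    E-zero : ∀ v → (∀ {x} → x ∉ˡ level k → v x ≡ 0ℤ) → (∀ {y} → y ∈ˡ level (suc k) → act E v y ≡ 0ℤ) → ∀ {x} → In x → act E v x ≡ 0ℤ
    E-zero v sup ev {x} x∈ with gr x ℕ.≟ suc k
    ... | yes e = ev (In⇒level x∈ e)
    ... | no ne = vanish v sup (E x) (All.map (λ h e → ne (trans (proj₂ h) (cong suc e))) (E-in x∈))

  level-decreasing : ∀ k → D ℕ.< 2 ℕ.* suc k → length (level (suc k)) ℕ.≤ length (level k)
  level-decreasing k D<2k = injective⇒length≤ _≟X_ F (level (suc k)) (level k) (level-unique (suc k)) λ v sup fv x∈ →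
    Down.injective {w = ℤ.- (+ D ℤ.- + 2 ℤ.* + suc k)} {v} (λ x∈ ne → sup (λ h → ne (cong (λ z → ℤ.- (+ D ℤ.- + 2 ℤ.* + z)) (proj₂ (level⇒In (suc k) h))))) w>0
      (λ {x} x∈ → F-zero v sup fv x∈) (proj₁ (level⇒In (suc k) x∈))
    where
    w>0 : 0ℤ ℤ.< ℤ.- (+ D ℤ.- + 2 ℤ.* + suc k)
    w>0 = ℤₚ.neg-mono-< (subst (+ D ℤ.- + 2 ℤ.* + suc k ℤ.<_) (ℤₚ.+-inverseʳ (+ 2 ℤ.* + suc k))
            (ℤₚ.+-monoˡ-< (ℤ.- (+ 2 ℤ.* + suc k)) (subst (+ D ℤ.<_) (sym (2*-pos (suc k))) (ℤ.+<+ D<2k))))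
    F-zero : ∀ v → (∀ {x} → x ∉ˡ level (suc k) → v x ≡ 0ℤ) → (∀ {y} → y ∈ˡ level k → act F v y ≡ 0ℤ) → ∀ {x} → In x → act F v x ≡ 0ℤ
    F-zero v sup fv {x} x∈ with gr x ℕ.≟ k
    ... | yes e = fv (In⇒level x∈ e)
    ... | no ne = vanish v sup (F x) (All.map (λ h e → ne (ℕₚ.suc-injective (trans (sym (proj₂ h)) e))) (F-in x∈))

unitRep : Rep
unitRep = record
  { X = ⊤ ; _≟X_ = λ _ _ → yes refl ; In = λ _ → ⊤ ; els = tt ∷ [] ; els-unique = [] ∷ [] ; els⇒In = λ _ → tt ; In⇒els = λ _ → here refl
  ; gr = λ _ → 0 ; D = 0 ; E = λ _ → [] ; F = λ _ → [] ; E-in = λ _ → [] ; F-in = λ _ → [] ; comm = λ v _ → refl }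

emptyRep : Rep
emptyRep = record
  { X = ⊤ ; _≟X_ = λ _ _ → yes refl ; In = λ _ → ⊥ ; els = [] ; els-unique = [] ; els⇒In = λ () ; In⇒els = λ ()
  ; gr = λ _ → 0 ; D = 0 ; E = λ _ → [] ; F = λ _ → [] ; E-in = λ () ; F-in = λ () ; comm = λ v () }

_⊗_ : Rep → Rep → Rep
R ⊗ S = record
  { X = R.X × S.X ; _≟X_ = ×-≡-dec R._≟X_ S._≟X_ ; In = λ { (x , y) → R.In x × S.In y }
  ; els = cartesianProduct R.els S.els
  ; els-unique = Uniqueₚ.cartesianProduct⁺ R.els-unique S.els-unique
  ; els⇒In = λ h → let a , b = ∈-cartesianProduct⁻ R.els S.els h in R.els⇒In a , S.els⇒In b
  ; In⇒els = λ { (a , b) → ∈-cartesianProduct⁺ (R.In⇒els a) (S.In⇒els b) }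
  ; gr = λ { (x , y) → R.gr x ℕ.+ S.gr y } ; D = R.D ℕ.+ S.D ; E = R.E ⊞ S.E ; F = R.F ⊞ S.F
  ; E-in = λ { {x , y} (a , b) → Allₚ.++⁺
      (Allₚ.map⁺ (All.map (λ { (h , e) → (h , b) , cong (ℕ._+ S.gr y) e }) (R.E-in a)))
      (Allₚ.map⁺ (All.map (λ { (h , e) → (a , h) , trans (cong (R.gr x ℕ.+_) e) (ℕₚ.+-suc _ _) }) (S.E-in b))) }
  ; F-in = λ { {x , y} (a , b) → Allₚ.++⁺
      (Allₚ.map⁺ (All.map (λ { (h , e) → (h , b) , cong (ℕ._+ S.gr y) e }) (R.F-in a)))
      (Allₚ.map⁺ (All.map (λ { (h , e) → (a , h) , trans (cong (R.gr x ℕ.+_) e) (ℕₚ.+-suc _ _) }) (S.F-in b))) }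
  ; comm = λ { v {x , y} (a , b) → comm⊗ v a b } }
  where
  module R = Rep R
  module S = Rep S
  _⊞_ : Op R.X → Op S.X → Op (R.X × S.X)
  (P ⊞ Q) (x , y) = List.map (λ cx → proj₁ cx , (proj₂ cx , y)) (P x) ++ List.map (λ cy → proj₁ cy , (x , proj₂ cy)) (Q y)
  ⊞-act : ∀ P Q v x y → act (P ⊞ Q) v (x , y) ≡ lin (P x) (λ x′ → v (x′ , y)) ℤ.+ lin (Q y) (λ y′ → v (x , y′))
  ⊞-act P Q v x y = trans (lin-++ (List.map _ (P x)) _ v) (cong₂ ℤ._+_ (lin-map (_, y) (P x) v) (lin-map (x ,_) (Q y) v))
  ⊞-act² : ∀ P Q P′ Q′ v x y → act (P ⊞ Q) (act (P′ ⊞ Q′) v) (x , y) ≡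
    (lin (P x) (λ x′ → lin (P′ x′) (λ x″ → v (x″ , y))) ℤ.+ lin (P x) (λ x′ → lin (Q′ y) (λ y′ → v (x′ , y′)))) ℤ.+
    (lin (Q y) (λ y′ → lin (P′ x) (λ x′ → v (x′ , y′))) ℤ.+ lin (Q y) (λ y′ → lin (Q′ y′) (λ y″ → v (x , y″))))
  ⊞-act² P Q P′ Q′ v x y = trans (⊞-act P Q _ x y) (cong₂ ℤ._+_
    (trans (lin-cong′ (P x) (λ x′ → ⊞-act P′ Q′ v x′ y)) (lin-+ (P x) _ _))
    (trans (lin-cong′ (Q y) (λ y′ → ⊞-act P′ Q′ v x y′)) (lin-+ (Q y) _ _)))
  -- The mixed terms agree in both orders because operators on different factors commute; the
  -- weights of the factors add.
  comm⊗ : ∀ v {x y} → R.In x → S.In y → act (R.F ⊞ S.F) (act (R.E ⊞ S.E) v) (x , y) ≡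
    act (R.E ⊞ S.E) (act (R.F ⊞ S.F) v) (x , y) ℤ.+ (+ (R.D ℕ.+ S.D) ℤ.- + 2 ℤ.* + (R.gr x ℕ.+ S.gr y)) ℤ.* v (x , y)
  comm⊗ v {x} {y} a b = trans (⊞-act² R.F S.F R.E S.E v x y)
    (trans (lem _ _ _ _ (act R.E (act R.F (λ x′ → v (x′ , y))) x) (act S.E (act S.F (λ y′ → v (x , y′))) y) _ _ (+ R.D) (+ S.D) (+ R.gr x) (+ S.gr y) (v (x , y))
       (R.comm (λ x′ → v (x′ , y)) a) (S.comm (λ y′ → v (x , y′)) b)
       (lin-comm (R.F x) (S.E y) (λ x′ y′ → v (x′ , y′))) (sym (lin-comm (R.E x) (S.F y) (λ x′ y′ → v (x′ , y′)))))
      (cong (ℤ._+ (+ (R.D ℕ.+ S.D) ℤ.- + 2 ℤ.* + (R.gr x ℕ.+ S.gr y)) ℤ.* v (x , y)) (sym (⊞-act² R.E S.E R.F S.F v x y))))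
    where
    lem : ∀ fe fe₂ ef₂ fe₃ ef ef₃ ef₄ fe₄ d d′ g g′ u →
          fe ≡ ef ℤ.+ (d ℤ.- + 2 ℤ.* g) ℤ.* u → fe₃ ≡ ef₃ ℤ.+ (d′ ℤ.- + 2 ℤ.* g′) ℤ.* u →
          fe₂ ≡ ef₂ → fe₄ ≡ ef₄ →
          (fe ℤ.+ fe₂) ℤ.+ (fe₄ ℤ.+ fe₃) ≡ ((ef ℤ.+ ef₄) ℤ.+ (ef₂ ℤ.+ ef₃)) ℤ.+ ((d ℤ.+ d′) ℤ.- + 2 ℤ.* (g ℤ.+ g′)) ℤ.* u
    lem fe fe₂ ef₂ fe₃ ef ef₃ ef₄ fe₄ d d′ g g′ u refl refl refl refl = ring ef ef₃ fe₂ fe₄ d d′ g g′ u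
      where
      ring : ∀ ef ef₃ x y d d′ g g′ u → ((ef ℤ.+ (d ℤ.- + 2 ℤ.* g) ℤ.* u) ℤ.+ x) ℤ.+ (y ℤ.+ (ef₃ ℤ.+ (d′ ℤ.- + 2 ℤ.* g′) ℤ.* u)) ≡
             ((ef ℤ.+ y) ℤ.+ (x ℤ.+ ef₃)) ℤ.+ ((d ℤ.+ d′) ℤ.- + 2 ℤ.* (g ℤ.+ g′)) ℤ.* u
      ring = solve-∀

-- Gaussian binomial coefficients

-- A list of exponents with repetitions stands for a polynomial with non-negative coefficients
-- before p is chosen.
evalE : ℕ → List ℕ → ℕ
evalE p []      = 0
evalE p (g ∷ G) = p ^ g ℕ.+ evalE p G

evalE-++ : ∀ p G bracket → evalE p (G ++ bracket) ≡ evalE p G ℕ.+ evalE p bracket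
evalE-++ p []      bracket = refl
evalE-++ p (g ∷ G) bracket = trans (cong (p ^ g ℕ.+_) (evalE-++ p G bracket)) (sym (ℕₚ.+-assoc (p ^ g) _ _))

evalE-shift : ∀ p {X Y : Set} (f : X → ℕ) (h : Y → ℕ) (g : Y → X) e xs → (∀ {y} → y ∈ˡ xs → f (g y) ≡ e ℕ.+ h y) →
              evalE p (List.map f (List.map g xs)) ≡ p ^ e ℕ.* evalE p (List.map h xs)
evalE-shift p f h g e []       _  = sym (ℕₚ.*-zeroʳ (p ^ e))
evalE-shift p f h g e (y ∷ ys) eq = trans (cong₂ ℕ._+_ (trans (cong (p ^_) (eq (here refl))) (ℕₚ.^-distribˡ-+-* p e (h y)))
    (evalE-shift p f h g e ys (λ y∈ → eq (there y∈)))) (sym (ℕₚ.*-distribˡ-+ (p ^ e) (p ^ h y) _))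

evalE-⊗ : ∀ p R S → evalE p (Rep.grades (R ⊗ S)) ≡ evalE p (Rep.grades R) ℕ.* evalE p (Rep.grades S)
evalE-⊗ p R S = go R.els
  where
  module R = Rep R
  module S = Rep S
  go : ∀ xs → evalE p (List.map (Rep.gr (R ⊗ S)) (cartesianProduct xs S.els)) ≡ evalE p (List.map R.gr xs) ℕ.* evalE p S.grades
  go []       = refl
  go (x ∷ xs) = begin
    evalE p (List.map gr⊗ (List.map (x ,_) S.els ++ cartesianProduct xs S.els))
      ≡⟨ cong (evalE p) (Listₚ.map-++ gr⊗ (List.map (x ,_) S.els) _) ⟩
    evalE p (List.map gr⊗ (List.map (x ,_) S.els) ++ List.map gr⊗ (cartesianProduct xs S.els))
      ≡⟨ evalE-++ p (List.map gr⊗ (List.map (x ,_) S.els)) _ ⟩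
    evalE p (List.map gr⊗ (List.map (x ,_) S.els)) ℕ.+ evalE p (List.map gr⊗ (cartesianProduct xs S.els))
      ≡⟨ cong₂ ℕ._+_ (evalE-shift p gr⊗ S.gr (x ,_) (R.gr x) S.els (λ _ → refl)) (go xs) ⟩
    p ^ R.gr x ℕ.* evalE p S.grades ℕ.+ evalE p (List.map R.gr xs) ℕ.* evalE p S.grades
      ≡⟨ ℕₚ.*-distribʳ-+ (evalE p S.grades) (p ^ R.gr x) _ ⟨
    (p ^ R.gr x ℕ.+ evalE p (List.map R.gr xs)) ℕ.* evalE p S.grades ∎
    where
    open ≡-Reasoning
    gr⊗ = Rep.gr (R ⊗ S)

-- Words with k ones and n − k zeros index the monomials of the Gaussian binomial coefficient [n choose k],
-- graded by the number of pairs (one, later zero).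
Word : Set
Word = List Bool

ones zeros inv : Word → ℕ
ones []          = 0
ones (true ∷ u)  = suc (ones u)
ones (false ∷ u) = ones u
zeros []          = 0
zeros (true ∷ u)  = zeros u
zeros (false ∷ u) = suc (zeros u)
inv []          = 0
inv (true ∷ u)  = zeros u ℕ.+ inv u
inv (false ∷ u) = inv u

words : ℕ → ℕ → List Word
words zero    zero    = [] ∷ []
words zero    (suc k) = []
words (suc n) zero    = List.map (false ∷_) (words n zero)
words (suc n) (suc k) = List.map (false ∷_) (words n (suc k)) ++ List.map (true ∷_) (words n k)

private
  IsWord : ℕ → ℕ → Word → Set
  IsWord n k u = ones u ≡ k × zeros u ℕ.+ k ≡ n

  words-sound : ∀ n k {u} → u ∈ˡ words n k → IsWord n k u
  words-sound zero    zero    (here refl) = refl , refl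
  words-sound (suc n) zero    h with ∈-map⁻ (false ∷_) h
  ... | u , h′ , refl = let a , b = words-sound n zero h′ in a , cong suc b
  words-sound (suc n) (suc k) h with ∈-++⁻ (List.map (false ∷_) (words n (suc k))) h
  ... | inj₁ h₁ with ∈-map⁻ (false ∷_) h₁
  ...   | u , h′ , refl = let a , b = words-sound n (suc k) h′ in a , cong suc b
  words-sound (suc n) (suc k) h | inj₂ h₂ with ∈-map⁻ (true ∷_) h₂
  ...   | u , h′ , refl = let a , b = words-sound n k h′ in cong suc a , trans (ℕₚ.+-suc (zeros u) k) (cong suc b)

  words-complete : ∀ u → u ∈ˡ words (zeros u ℕ.+ ones u) (ones u)
  words-complete [] = here refl
  words-complete (true ∷ u) = subst (λ z → true ∷ u ∈ˡ words z (suc (ones u))) (sym (ℕₚ.+-suc (zeros u) (ones u)))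
    (∈-++⁺ʳ (List.map (false ∷_) _) (∈-map⁺ (true ∷_) (words-complete u)))
  words-complete (false ∷ u) with ones u | words-complete u
  ... | zero  | h = ∈-map⁺ (false ∷_) h
  ... | suc k | h = ∈-++⁺ˡ (∈-map⁺ (false ∷_) h)

  words-unique : ∀ n k → Unique (words n k)
  words-unique zero    zero    = [] ∷ []
  words-unique zero    (suc k) = []
  words-unique (suc n) zero    = Uniqueₚ.map⁺ Listₚ.∷-injectiveʳ (words-unique n zero)
  words-unique (suc n) (suc k) = Uniqueₚ.++⁺ (Uniqueₚ.map⁺ Listₚ.∷-injectiveʳ (words-unique n (suc k)))
    (Uniqueₚ.map⁺ Listₚ.∷-injectiveʳ (words-unique n k)) disjoint
    where
    disjoint : ∀ {u} → u ∈ˡ List.map (false ∷_) (words n (suc k)) × u ∈ˡ List.map (true ∷_) (words n k) → ⊥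
    disjoint (a , b) with ∈-map⁻ (false ∷_) a | ∈-map⁻ (true ∷_) b
    ... | _ , _ , refl | _ , _ , ()

  cons : Bool → List (ℤ × Word) → List (ℤ × Word)
  cons b = List.map (λ cu → proj₁ cu , b ∷ proj₂ cu)

  raise : Op Word
  raise []                 = []
  raise (false ∷ u)        = cons false (raise u)
  raise (true ∷ [])        = []
  raise (true ∷ true ∷ u)  = cons true (raise (true ∷ u))
  raise (true ∷ false ∷ u) = (1ℤ , false ∷ true ∷ u) ∷ cons true (raise (false ∷ u))

  -- The weight i (n − i) of a swap at places i, i + 1 of a word of length n makes the commutator with raise diagonal;
  -- l is the place of the first letter of the suffix.
  lower : ℕ → Op Word
  lower l []                  = []
  lower l (true ∷ u)          = cons true (lower (suc l) u)
  lower l (false ∷ [])        = []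
  lower l (false ∷ false ∷ u) = cons false (lower (suc l) (false ∷ u))
  lower l (false ∷ true ∷ u)  = (+ (l ℕ.* suc (length u)) , true ∷ false ∷ u) ∷ cons false (lower (suc l) (true ∷ u))

  -- The eigenvalue of the commutator on a word: a factor 01 at places i, i + 1 contributes i(n -
  -- i), a factor 10 contributes -i(n - i).
  bracket : ℕ → Word → ℤ
  bracket l []                  = 0ℤ
  bracket l (true ∷ [])         = 0ℤ
  bracket l (true ∷ true ∷ u)   = bracket (suc l) (true ∷ u)
  bracket l (true ∷ false ∷ u)  = ℤ.- + (l ℕ.* suc (length u)) ℤ.+ bracket (suc l) (false ∷ u)
  bracket l (false ∷ [])        = 0ℤ
  bracket l (false ∷ false ∷ u) = bracket (suc l) (false ∷ u)
  bracket l (false ∷ true ∷ u)  = + (l ℕ.* suc (length u)) ℤ.+ bracket (suc l) (true ∷ u)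

  Down Up : Word → ℤ × Word → Set
  Down u cy = ones (proj₂ cy) ≡ ones u × zeros (proj₂ cy) ≡ zeros u × inv u ≡ suc (inv (proj₂ cy))
  Up u cy   = ones (proj₂ cy) ≡ ones u × zeros (proj₂ cy) ≡ zeros u × inv (proj₂ cy) ≡ suc (inv u)

  cons-Down : ∀ b u xs → All (Down u) xs → All (Down (b ∷ u)) (cons b xs)
  cons-Down true  u xs h = Allₚ.map⁺ (All.map (λ { (a , b , c) → cong suc a , b , trans (cong₂ ℕ._+_ (sym b) c) (ℕₚ.+-suc _ _) }) h)
  cons-Down false u xs h = Allₚ.map⁺ (All.map (λ { (a , b , c) → a , cong suc b , c }) h)

  cons-Up : ∀ b u xs → All (Up u) xs → All (Up (b ∷ u)) (cons b xs)
  cons-Up true  u xs h = Allₚ.map⁺ (All.map (λ { (a , b , c) → cong suc a , b , trans (cong₂ ℕ._+_ b c) (ℕₚ.+-suc _ _) }) h)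
  cons-Up false u xs h = Allₚ.map⁺ (All.map (λ { (a , b , c) → a , cong suc b , c }) h)

  raise-Down : ∀ u → All (Down u) (raise u)
  raise-Down []                 = []
  raise-Down (false ∷ u)        = cons-Down false u (raise u) (raise-Down u)
  raise-Down (true ∷ [])        = []
  raise-Down (true ∷ true ∷ u)  = cons-Down true (true ∷ u) (raise (true ∷ u)) (raise-Down (true ∷ u))
  raise-Down (true ∷ false ∷ u) = (refl , refl , refl) ∷ cons-Down true (false ∷ u) (raise (false ∷ u)) (raise-Down (false ∷ u))

  lower-Up : ∀ l u → All (Up u) (lower l u)
  lower-Up l []                  = []
  lower-Up l (true ∷ u)          = cons-Up true u (lower (suc l) u) (lower-Up (suc l) u)
  lower-Up l (false ∷ [])        = []
  lower-Up l (false ∷ false ∷ u) = cons-Up false (false ∷ u) (lower (suc l) (false ∷ u)) (lower-Up (suc l) (false ∷ u))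
  lower-Up l (false ∷ true ∷ u)  = (refl , refl , refl) ∷ cons-Up false (true ∷ u) (lower (suc l) (true ∷ u)) (lower-Up (suc l) (true ∷ u))

  length-zeros-ones : ∀ u → length u ≡ zeros u ℕ.+ ones u
  length-zeros-ones []          = refl
  length-zeros-ones (true ∷ u)  = trans (cong suc (length-zeros-ones u)) (sym (ℕₚ.+-suc _ _))
  length-zeros-ones (false ∷ u) = cong suc (length-zeros-ones u)

  module _ (v : Word → ℤ) where
    eF : ∀ u → act raise v (false ∷ u) ≡ act raise (v ∘ (false ∷_)) u
    eF u = lin-map (false ∷_) (raise u) v
    eTT : ∀ u → act raise v (true ∷ true ∷ u) ≡ act raise (v ∘ (true ∷_)) (true ∷ u)
    eTT u = lin-map (true ∷_) (raise (true ∷ u)) v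
    eTF : ∀ u → act raise v (true ∷ false ∷ u) ≡ 1ℤ ℤ.* v (false ∷ true ∷ u) ℤ.+ act raise (v ∘ (true ∷_)) (false ∷ u)
    eTF u = cong (λ z → 1ℤ ℤ.* v (false ∷ true ∷ u) ℤ.+ z) (lin-map (true ∷_) (raise (false ∷ u)) v)
    fT : ∀ l u → act (lower l) v (true ∷ u) ≡ act (lower (suc l)) (v ∘ (true ∷_)) u
    fT l u = lin-map (true ∷_) (lower (suc l) u) v
    fFF : ∀ l u → act (lower l) v (false ∷ false ∷ u) ≡ act (lower (suc l)) (v ∘ (false ∷_)) (false ∷ u)
    fFF l u = lin-map (false ∷_) (lower (suc l) (false ∷ u)) v
    fFT : ∀ l u → act (lower l) v (false ∷ true ∷ u) ≡
          + (l ℕ.* suc (length u)) ℤ.* v (true ∷ false ∷ u) ℤ.+ act (lower (suc l)) (v ∘ (false ∷_)) (true ∷ u)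
    fFT l u = cong (λ z → + (l ℕ.* suc (length u)) ℤ.* v (true ∷ false ∷ u) ℤ.+ z) (lin-map (false ∷_) (lower (suc l) (true ∷ u)) v)

  -- In `commute`, the inner operator has an extra swap at the front only for one value of the
  -- following letter. This takes that term κ out of the outer operator; a front swap of the outer
  -- operator makes the word begin with the other letter and never meets κ.
  raise-split : ∀ {g g′ κ : Word → ℤ} → (∀ u → g (true ∷ u) ≡ g′ (true ∷ u) ℤ.+ κ u) → (∀ u → g (false ∷ u) ≡ g′ (false ∷ u)) →
            ∀ u → act raise g (true ∷ u) ≡ act raise g′ (true ∷ u) ℤ.+ act raise κ u
  raise-split gt gf [] = refl
  raise-split {g} {g′} {κ} gt gf (true ∷ u) = trans (eTT g u) (trans (lin-cong′ (raise (true ∷ u)) gt)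
    (trans (lin-+ (raise (true ∷ u)) (g′ ∘ (true ∷_)) κ) (cong (ℤ._+ act raise κ (true ∷ u)) (sym (eTT g′ u)))))
  raise-split {g} {g′} {κ} gt gf (false ∷ u) = trans (eTF g u)
    (trans (cong₂ (λ a b → 1ℤ ℤ.* a ℤ.+ b) (gf (true ∷ u)) (trans (lin-cong′ (raise (false ∷ u)) gt) (lin-+ (raise (false ∷ u)) (g′ ∘ (true ∷_)) κ)))
      (trans (sym (ℤₚ.+-assoc (1ℤ ℤ.* g′ (false ∷ true ∷ u)) _ _)) (cong (ℤ._+ act raise κ (false ∷ u)) (sym (eTF g′ u)))))

  lower-split : ∀ {g g′ κ : Word → ℤ} l → (∀ u → g (false ∷ u) ≡ g′ (false ∷ u) ℤ.+ κ u) → (∀ u → g (true ∷ u) ≡ g′ (true ∷ u)) →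
            ∀ u → act (lower l) g (false ∷ u) ≡ act (lower l) g′ (false ∷ u) ℤ.+ act (lower (suc l)) κ u
  lower-split l gf gt [] = refl
  lower-split {g} {g′} {κ} l gf gt (false ∷ u) = trans (fFF g l u) (trans (lin-cong′ (lower (suc l) (false ∷ u)) gf)
    (trans (lin-+ (lower (suc l) (false ∷ u)) (g′ ∘ (false ∷_)) κ) (cong (ℤ._+ act (lower (suc l)) κ (false ∷ u)) (sym (fFF g′ l u)))))
  lower-split {g} {g′} {κ} l gf gt (true ∷ u) = trans (fFT g l u)
    (trans (cong₂ (λ a b → c ℤ.* a ℤ.+ b) (gt (false ∷ u)) (trans (lin-cong′ (lower (suc l) (true ∷ u)) gf) (lin-+ (lower (suc l) (true ∷ u)) (g′ ∘ (false ∷_)) κ)))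
      (trans (sym (ℤₚ.+-assoc (c ℤ.* g′ (true ∷ false ∷ u)) _ _)) (cong (ℤ._+ act (lower (suc l)) κ (true ∷ u)) (sym (fFT g′ l u)))))
    where c = + (l ℕ.* suc (length u))

  -- Swaps at disjoint places commute, their coefficients depending only on the place. After a swap
  -- the two overlapping places do not admit the opposite swap. What remains are inverse pairs at
  -- one place, and these give the diagonal term.
  commute : ∀ l v u → act (lower l) (act raise v) u ≡ act raise (act (lower l) v) u ℤ.+ bracket l u ℤ.* v u
  commute l v []           = refl
  commute l v (true ∷ [])  = refl
  commute l v (false ∷ []) = refl
  commute l v (true ∷ true ∷ u) = begin
    act (lower l) (act raise v) (true ∷ true ∷ u)                       ≡⟨ fT (act raise v) l (true ∷ u) ⟩
    act (lower (suc l)) (act raise v ∘ (true ∷_)) (true ∷ u)            ≡⟨ fT (act raise v ∘ (true ∷_)) (suc l) u ⟩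
    act (lower (2 ℕ.+ l)) (λ u′ → act raise v (true ∷ true ∷ u′)) u     ≡⟨ lin-cong′ (lower (2 ℕ.+ l) u) (eTT v) ⟩
    act (lower (2 ℕ.+ l)) (act raise (v ∘ (true ∷_)) ∘ (true ∷_)) u     ≡⟨ fT (act raise (v ∘ (true ∷_))) (suc l) u ⟨
    act (lower (suc l)) (act raise (v ∘ (true ∷_))) (true ∷ u)          ≡⟨ commute (suc l) (v ∘ (true ∷_)) (true ∷ u) ⟩
    act raise (act (lower (suc l)) (v ∘ (true ∷_))) (true ∷ u) ℤ.+ hv   ≡⟨ cong (ℤ._+ hv) (lin-cong′ (raise (true ∷ u)) (fT v l)) ⟨
    act raise (act (lower l) v ∘ (true ∷_)) (true ∷ u) ℤ.+ hv           ≡⟨ cong (ℤ._+ hv) (eTT (act (lower l) v) u) ⟨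
    act raise (act (lower l) v) (true ∷ true ∷ u) ℤ.+ hv                ∎
    where
    open ≡-Reasoning
    hv = bracket (suc l) (true ∷ u) ℤ.* v (true ∷ true ∷ u)
  commute l v (false ∷ false ∷ u) = begin
    act (lower l) (act raise v) (false ∷ false ∷ u)                        ≡⟨ fFF (act raise v) l u ⟩
    act (lower (suc l)) (act raise v ∘ (false ∷_)) (false ∷ u)             ≡⟨ lin-cong′ (lower (suc l) (false ∷ u)) (eF v) ⟩
    act (lower (suc l)) (act raise (v ∘ (false ∷_))) (false ∷ u)           ≡⟨ commute (suc l) (v ∘ (false ∷_)) (false ∷ u) ⟩
    act raise (act (lower (suc l)) (v ∘ (false ∷_))) (false ∷ u) ℤ.+ hv    ≡⟨ cong (ℤ._+ hv) (eF (act (lower (suc l)) (v ∘ (false ∷_))) u) ⟩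
    act raise (act (lower (suc l)) (v ∘ (false ∷_)) ∘ (false ∷_)) u ℤ.+ hv ≡⟨ cong (ℤ._+ hv) (lin-cong′ (raise u) (fFF v l)) ⟨
    act raise (λ u′ → act (lower l) v (false ∷ false ∷ u′)) u ℤ.+ hv       ≡⟨ cong (ℤ._+ hv) (eF (act (lower l) v ∘ (false ∷_)) u) ⟨
    act raise (act (lower l) v ∘ (false ∷_)) (false ∷ u) ℤ.+ hv            ≡⟨ cong (ℤ._+ hv) (eF (act (lower l) v) (false ∷ u)) ⟨
    act raise (act (lower l) v) (false ∷ false ∷ u) ℤ.+ hv                 ∎
    where
    open ≡-Reasoning
    hv = bracket (suc l) (false ∷ u) ℤ.* v (false ∷ false ∷ u)
  commute l v (false ∷ true ∷ u) = begin
    act (lower l) (act raise v) (false ∷ true ∷ u)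
      ≡⟨ fFT (act raise v) l u ⟩
    c ℤ.* act raise v (true ∷ false ∷ u) ℤ.+ act (lower (suc l)) (act raise v ∘ (false ∷_)) (true ∷ u)
      ≡⟨ cong₂ (λ a b → c ℤ.* a ℤ.+ b) (eTF v u) (lin-cong′ (lower (suc l) (true ∷ u)) (eF v)) ⟩
    c ℤ.* (1ℤ ℤ.* v₀ ℤ.+ act raise (v ∘ (true ∷_)) (false ∷ u)) ℤ.+ act (lower (suc l)) (act raise (v ∘ (false ∷_))) (true ∷ u)
      ≡⟨ cong₂ (λ a b → c ℤ.* (1ℤ ℤ.* v₀ ℤ.+ a) ℤ.+ b) (eF (v ∘ (true ∷_)) u) (commute (suc l) (v ∘ (false ∷_)) (true ∷ u)) ⟩
    c ℤ.* (1ℤ ℤ.* v₀ ℤ.+ ξ) ℤ.+ (ef ℤ.+ h ℤ.* v₀)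
      ≡⟨ ring c v₀ ξ ef h ⟩
    (ef ℤ.+ c ℤ.* ξ) ℤ.+ (c ℤ.+ h) ℤ.* v₀
      ≡⟨ cong (λ z → (ef ℤ.+ z) ℤ.+ (c ℤ.+ h) ℤ.* v₀) κ-eq ⟨
    (ef ℤ.+ act raise κ u) ℤ.+ (c ℤ.+ h) ℤ.* v₀
      ≡⟨ cong (ℤ._+ (c ℤ.+ h) ℤ.* v₀) (raise-split (λ u′ → trans (fFT v l u′) (ℤₚ.+-comm (κ u′) _)) (fFF v l) u) ⟨
    act raise (act (lower l) v ∘ (false ∷_)) (true ∷ u) ℤ.+ (c ℤ.+ h) ℤ.* v₀
      ≡⟨ cong (ℤ._+ (c ℤ.+ h) ℤ.* v₀) (eF (act (lower l) v) (true ∷ u)) ⟨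
    act raise (act (lower l) v) (false ∷ true ∷ u) ℤ.+ (c ℤ.+ h) ℤ.* v₀ ∎
    where
    open ≡-Reasoning
    c = + (l ℕ.* suc (length u))
    v₀ = v (false ∷ true ∷ u)
    h = bracket (suc l) (true ∷ u)
    ξ = act raise (v ∘ (true ∷_) ∘ (false ∷_)) u
    ef = act raise (act (lower (suc l)) (v ∘ (false ∷_))) (true ∷ u)
    κ : Word → ℤ
    κ u′ = + (l ℕ.* suc (length u′)) ℤ.* v (true ∷ false ∷ u′)
    κ-eq : act raise κ u ≡ c ℤ.* ξ
    -- `raise` preserves the length of a word, so the coefficient of the front swap is constant and
    -- can be pulled out.
    κ-eq = trans (lin-cong (raise u) (All.map (λ { {_ , y} (a , b , _) → cong (λ z → + (l ℕ.* suc z) ℤ.* v (true ∷ false ∷ y))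
             (trans (length-zeros-ones y) (trans (cong₂ ℕ._+_ b a) (sym (length-zeros-ones u)))) }) (raise-Down u)))
             (lin-* (raise u) c (v ∘ (true ∷_) ∘ (false ∷_)))
    ring : ∀ c v ξ ef h → c ℤ.* (1ℤ ℤ.* v ℤ.+ ξ) ℤ.+ (ef ℤ.+ h ℤ.* v) ≡ (ef ℤ.+ c ℤ.* ξ) ℤ.+ (c ℤ.+ h) ℤ.* v
    ring = solve-∀
  commute l v (true ∷ false ∷ u) = begin
    act (lower l) (act raise v) (true ∷ false ∷ u)
      ≡⟨ fT (act raise v) l (false ∷ u) ⟩
    act (lower (suc l)) (act raise v ∘ (true ∷_)) (false ∷ u)
      ≡⟨ lower-split (suc l) (λ u′ → trans (eTF v u′) (ℤₚ.+-comm (κ u′) _)) (eTT v) u ⟩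
    act (lower (suc l)) (act raise (v ∘ (true ∷_))) (false ∷ u) ℤ.+ act (lower (2 ℕ.+ l)) κ u
      ≡⟨ cong₂ ℤ._+_ (commute (suc l) (v ∘ (true ∷_)) (false ∷ u)) (lin-cong′ (lower (2 ℕ.+ l) u) (λ u′ → ℤₚ.*-identityˡ (v (false ∷ true ∷ u′)))) ⟩
    (ef ℤ.+ h ℤ.* v₀) ℤ.+ ζ
      ≡⟨ ring c v₀ ζ ef h ⟩
    (1ℤ ℤ.* (c ℤ.* v₀ ℤ.+ ζ) ℤ.+ ef) ℤ.+ (ℤ.- c ℤ.+ h) ℤ.* v₀
      ≡⟨ cong (ℤ._+ (ℤ.- c ℤ.+ h) ℤ.* v₀) (cong₂ (λ a b → 1ℤ ℤ.* (c ℤ.* v₀ ℤ.+ a) ℤ.+ b) (fT (v ∘ (false ∷_)) (suc l) u) (lin-cong′ (raise (false ∷ u)) (fT v l))) ⟨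
    (1ℤ ℤ.* (c ℤ.* v₀ ℤ.+ act (lower (suc l)) (v ∘ (false ∷_)) (true ∷ u)) ℤ.+ act raise (act (lower l) v ∘ (true ∷_)) (false ∷ u)) ℤ.+ (ℤ.- c ℤ.+ h) ℤ.* v₀
      ≡⟨ cong (λ z → (1ℤ ℤ.* z ℤ.+ act raise (act (lower l) v ∘ (true ∷_)) (false ∷ u)) ℤ.+ (ℤ.- c ℤ.+ h) ℤ.* v₀) (fFT v l u) ⟨
    (1ℤ ℤ.* act (lower l) v (false ∷ true ∷ u) ℤ.+ act raise (act (lower l) v ∘ (true ∷_)) (false ∷ u)) ℤ.+ (ℤ.- c ℤ.+ h) ℤ.* v₀
      ≡⟨ cong (ℤ._+ (ℤ.- c ℤ.+ h) ℤ.* v₀) (eTF (act (lower l) v) u) ⟨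
    act raise (act (lower l) v) (true ∷ false ∷ u) ℤ.+ (ℤ.- c ℤ.+ h) ℤ.* v₀ ∎
    where
    open ≡-Reasoning
    c = + (l ℕ.* suc (length u))
    v₀ = v (true ∷ false ∷ u)
    h = bracket (suc l) (false ∷ u)
    ζ = act (lower (2 ℕ.+ l)) (v ∘ (false ∷_) ∘ (true ∷_)) u
    ef = act raise (act (lower (suc l)) (v ∘ (true ∷_))) (false ∷ u)
    κ : Word → ℤ
    κ u′ = 1ℤ ℤ.* v (false ∷ true ∷ u′)
    ring : ∀ c v ζ ef h → (ef ℤ.+ h ℤ.* v) ℤ.+ ζ ≡ (1ℤ ℤ.* (c ℤ.* v ℤ.+ ζ) ℤ.+ ef) ℤ.+ (ℤ.- c ℤ.+ h) ℤ.* v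
    ring = solve-∀

  c-eq : ∀ l u → + (l ℕ.* suc (length u)) ≡ + l ℤ.* (1ℤ ℤ.+ (+ zeros u ℤ.+ + ones u))
  c-eq l u = trans (ℤₚ.pos-* l (suc (length u))) (cong (λ z → + l ℤ.* (1ℤ ℤ.+ + z)) (length-zeros-ones u))

  -- A general l is needed since passing to the tail shifts all places by one. At l = 1 the two
  -- formulas merge in `H-1`, the weight k(n - k) - 2 `inv u` of a word.
  H-true : ∀ l u → bracket l (true ∷ u) ≡ + ones u ℤ.* + zeros u ℤ.- + 2 ℤ.* + inv u ℤ.- + l ℤ.* + zeros u
  H-false : ∀ l u → bracket l (false ∷ u) ≡ + ones u ℤ.* + zeros u ℤ.- + 2 ℤ.* + inv u ℤ.+ + l ℤ.* + ones u
  H-true l [] = lem (+ l)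
    where
    lem : ∀ l → 0ℤ ≡ 0ℤ ℤ.- l ℤ.* 0ℤ
    lem = solve-∀
  H-true l (true ∷ u) = trans (H-true (suc l) u) (lem (+ l) (+ ones u) (+ zeros u) (+ inv u))
    where
    lem : ∀ l k z i → k ℤ.* z ℤ.- + 2 ℤ.* i ℤ.- (1ℤ ℤ.+ l) ℤ.* z ≡ (1ℤ ℤ.+ k) ℤ.* z ℤ.- + 2 ℤ.* (z ℤ.+ i) ℤ.- l ℤ.* z
    lem = solve-∀
  H-true l (false ∷ u) = trans (cong₂ (λ a b → ℤ.- a ℤ.+ b) (c-eq l u) (H-false (suc l) u)) (lem (+ l) (+ ones u) (+ zeros u) (+ inv u))
    where
    lem : ∀ l k z i → ℤ.- (l ℤ.* (1ℤ ℤ.+ (z ℤ.+ k))) ℤ.+ (k ℤ.* z ℤ.- + 2 ℤ.* i ℤ.+ (1ℤ ℤ.+ l) ℤ.* k) ≡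
          k ℤ.* (1ℤ ℤ.+ z) ℤ.- + 2 ℤ.* i ℤ.- l ℤ.* (1ℤ ℤ.+ z)
    lem = solve-∀
  H-false l [] = lem (+ l)
    where
    lem : ∀ l → 0ℤ ≡ 0ℤ ℤ.+ l ℤ.* 0ℤ
    lem = solve-∀
  H-false l (true ∷ u) = trans (cong₂ ℤ._+_ (c-eq l u) (H-true (suc l) u)) (lem (+ l) (+ ones u) (+ zeros u) (+ inv u))
    where
    lem : ∀ l k z i → l ℤ.* (1ℤ ℤ.+ (z ℤ.+ k)) ℤ.+ (k ℤ.* z ℤ.- + 2 ℤ.* i ℤ.- (1ℤ ℤ.+ l) ℤ.* z) ≡
          (1ℤ ℤ.+ k) ℤ.* z ℤ.- + 2 ℤ.* (z ℤ.+ i) ℤ.+ l ℤ.* (1ℤ ℤ.+ k)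
    lem = solve-∀
  H-false l (false ∷ u) = trans (H-false (suc l) u) (lem (+ l) (+ ones u) (+ zeros u) (+ inv u))
    where
    lem : ∀ l k z i → k ℤ.* z ℤ.- + 2 ℤ.* i ℤ.+ (1ℤ ℤ.+ l) ℤ.* k ≡ k ℤ.* (1ℤ ℤ.+ z) ℤ.- + 2 ℤ.* i ℤ.+ l ℤ.* k
    lem = solve-∀

  H-1 : ∀ u → bracket 1 u ≡ + ones u ℤ.* + zeros u ℤ.- + 2 ℤ.* + inv u
  H-1 [] = refl
  H-1 (true ∷ u) = trans (H-true 1 u) (lem (+ ones u) (+ zeros u) (+ inv u))
    where
    lem : ∀ k z i → k ℤ.* z ℤ.- + 2 ℤ.* i ℤ.- 1ℤ ℤ.* z ≡ (1ℤ ℤ.+ k) ℤ.* z ℤ.- + 2 ℤ.* (z ℤ.+ i)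
    lem = solve-∀
  H-1 (false ∷ u) = trans (H-false 1 u) (lem (+ ones u) (+ zeros u) (+ inv u))
    where
    lem : ∀ k z i → k ℤ.* z ℤ.- + 2 ℤ.* i ℤ.+ 1ℤ ℤ.* k ≡ k ℤ.* (1ℤ ℤ.+ z) ℤ.- + 2 ℤ.* i
    lem = solve-∀

-- The factor p^(wk) shifts every grade by wk; D is raised by 2wk to keep the weight D - 2 gr, and
-- with it the commutator, unchanged.
gaussRep : ℕ → ℕ → ℕ → Rep
gaussRep w n k = record
  { X = Word ; _≟X_ = Listₚ.≡-dec Boolₚ._≟_ ; In = IsWord n k ; els = words n k
  ; els-unique = words-unique n k ; els⇒In = words-sound n k ; In⇒els = λ { {u} (refl , refl) → words-complete u }
  ; gr = λ u → w ℕ.* k ℕ.+ inv u ; D = k ℕ.* (n ℕ.∸ k) ℕ.+ 2 ℕ.* (w ℕ.* k) ; E = raise ; F = lower 1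
  ; E-in = λ { {u} (refl , refl) → All.map (λ { (a , b , c) → (a , cong (ℕ._+ ones u) b) , trans (cong (w ℕ.* ones u ℕ.+_) c) (ℕₚ.+-suc _ _) }) (raise-Down u) }
  ; F-in = λ { {u} (refl , refl) → All.map (λ { (a , b , c) → (a , cong (ℕ._+ ones u) b) , trans (cong (w ℕ.* ones u ℕ.+_) c) (ℕₚ.+-suc _ _) }) (lower-Up 1 u) }
  ; comm = λ { v {u} (refl , refl) → trans (commute 1 v u) (cong (λ z → act raise (act (lower 1) v) u ℤ.+ z ℤ.* v u) (weight u)) } }
  where
  weight : ∀ u → bracket 1 u ≡ + (ones u ℕ.* (zeros u ℕ.+ ones u ℕ.∸ ones u) ℕ.+ 2 ℕ.* (w ℕ.* ones u)) ℤ.- + 2 ℤ.* + (w ℕ.* ones u ℕ.+ inv u)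
  weight u = trans (H-1 u) (trans (lem (+ ones u ℤ.* + zeros u) (+ (w ℕ.* ones u)) (+ inv u))
    (cong (ℤ._- + 2 ℤ.* + (w ℕ.* ones u ℕ.+ inv u)) (cong₂ ℤ._+_
      (trans (sym (ℤₚ.pos-* (ones u) (zeros u))) (cong (λ z → + (ones u ℕ.* z)) (sym (ℕₚ.m+n∸n≡m (zeros u) (ones u)))))
      (sym (ℤₚ.pos-* 2 (w ℕ.* ones u))))))
    where
    lem : ∀ a b i → a ℤ.- + 2 ℤ.* i ≡ (a ℤ.+ + 2 ℤ.* b) ℤ.- + 2 ℤ.* (b ℤ.+ i)
    lem = solve-∀

-- Splitting by the first letter matches the recurrence: a leading 0 changes no grade, a leading 1
-- is inverted with all n - k zeros after it and adds w for itself.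
evalE-gauss : ∀ p w n k → evalE p (Rep.grades (gaussRep w n k)) ≡ complements p w n k
evalE-gauss p w zero zero = trans (ℕₚ.+-identityʳ _) (cong (p ^_) (trans (ℕₚ.+-identityʳ (w ℕ.* 0)) (ℕₚ.*-zeroʳ w)))
evalE-gauss p w zero (suc k) = refl
evalE-gauss p w (suc n) zero = trans (evalE-shift p (λ u → w ℕ.* 0 ℕ.+ inv u) (λ u → w ℕ.* 0 ℕ.+ inv u) (false ∷_) 0 (words n 0) (λ _ → refl))
  (trans (ℕₚ.*-identityˡ _) (evalE-gauss p w n zero))
evalE-gauss p w (suc n) (suc k) = begin
  evalE p (List.map gr (List.map (false ∷_) (words n (suc k)) ++ List.map (true ∷_) (words n k)))
    ≡⟨ cong (evalE p) (Listₚ.map-++ gr (List.map (false ∷_) (words n (suc k))) _) ⟩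
  evalE p (List.map gr (List.map (false ∷_) (words n (suc k))) ++ List.map gr (List.map (true ∷_) (words n k)))
    ≡⟨ evalE-++ p (List.map gr (List.map (false ∷_) (words n (suc k)))) _ ⟩
  evalE p (List.map gr (List.map (false ∷_) (words n (suc k)))) ℕ.+ evalE p (List.map gr (List.map (true ∷_) (words n k)))
    ≡⟨ cong₂ ℕ._+_ (trans (evalE-shift p gr gr (false ∷_) 0 (words n (suc k)) (λ _ → refl)) (trans (ℕₚ.*-identityˡ _) (evalE-gauss p w n (suc k))))
         (trans (evalE-shift p gr (λ u → w ℕ.* k ℕ.+ inv u) (true ∷_) (w ℕ.+ n ℕ.∸ k) (words n k) shift)
           (trans (ℕₚ.*-comm (p ^ (w ℕ.+ n ℕ.∸ k)) _) (cong (ℕ._* p ^ (w ℕ.+ n ℕ.∸ k)) (evalE-gauss p w n k)))) ⟩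
  complements p w n (suc k) ℕ.+ complements p w n k ℕ.* p ^ (w ℕ.+ n ℕ.∸ k) ∎
  where
  open ≡-Reasoning
  gr : Word → ℕ
  gr u = w ℕ.* suc k ℕ.+ inv u
  shift : ∀ {u} → u ∈ˡ words n k → gr (true ∷ u) ≡ (w ℕ.+ n ℕ.∸ k) ℕ.+ (w ℕ.* k ℕ.+ inv u)
  shift {u} h with words-sound n k h
  ... | refl , refl = begin
    w ℕ.* suc (ones u) ℕ.+ (zeros u ℕ.+ inv u)             ≡⟨ cong (ℕ._+ (zeros u ℕ.+ inv u)) (ℕₚ.*-suc w (ones u)) ⟩
    (w ℕ.+ w ℕ.* ones u) ℕ.+ (zeros u ℕ.+ inv u)           ≡⟨ +-interchange w (w ℕ.* ones u) (zeros u) (inv u) ⟩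
    (w ℕ.+ zeros u) ℕ.+ (w ℕ.* ones u ℕ.+ inv u)           ≡⟨ cong (ℕ._+ (w ℕ.* ones u ℕ.+ inv u))
      (trans (sym (ℕₚ.m+n∸n≡m (w ℕ.+ zeros u) (ones u))) (cong (ℕ._∸ ones u) (ℕₚ.+-assoc w (zeros u) (ones u)))) ⟩
    (w ℕ.+ (zeros u ℕ.+ ones u) ℕ.∸ ones u) ℕ.+ (w ℕ.* ones u ℕ.+ inv u) ∎
    where
    +-interchange : ∀ a b c d → (a ℕ.+ b) ℕ.+ (c ℕ.+ d) ≡ (a ℕ.+ c) ℕ.+ (b ℕ.+ d)
    +-interchange = ℕ-solve-∀

-- From lists of exponents to lists of coefficients

private
  same : ℕ → ℕ → ℕ
  same zero    zero    = 1
  same zero    (suc k) = 0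
  same (suc g) zero    = 0
  same (suc g) (suc k) = same g k

count : ℕ → List ℕ → ℕ
count k []      = 0
count k (g ∷ G) = same g k ℕ.+ count k G

private
  same-≡ : ∀ g → same g g ≡ 1
  same-≡ zero    = refl
  same-≡ (suc g) = same-≡ g

  same-≢ : ∀ g k → ¬ (g ≡ k) → same g k ≡ 0
  same-≢ zero    zero    ne = ⊥-elim (ne refl)
  same-≢ zero    (suc k) ne = refl
  same-≢ (suc g) zero    ne = refl
  same-≢ (suc g) (suc k) ne = same-≢ g k (λ e → ne (cong suc e))

length-filter : ∀ {X : Set} (gr : X → ℕ) k xs → length (filter (λ x → gr x ℕ.≟ k) xs) ≡ count k (List.map gr xs)
length-filter gr k []       = refl
length-filter gr k (x ∷ xs) = helper (gr x ℕ.≟ k)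
  where
  helper : Dec (gr x ≡ k) → length (filter (λ x → gr x ℕ.≟ k) (x ∷ xs)) ≡ same (gr x) k ℕ.+ count k (List.map gr xs)
  helper (yes e) = trans (cong length (Listₚ.filter-accept (λ x → gr x ℕ.≟ k) {xs = xs} e))
    (cong₂ ℕ._+_ (sym (trans (cong (λ z → same z k) e) (same-≡ k))) (length-filter gr k xs))
  helper (no ne) = trans (cong length (Listₚ.filter-reject (λ x → gr x ℕ.≟ k) {xs = xs} ne))
    (cong₂ ℕ._+_ (sym (same-≢ (gr x) k ne)) (length-filter gr k xs))

private
  eval-+ : ∀ p B (f g : ℕ → ℕ) → evalPoly (applyUpTo (λ k → f k ℕ.+ g k) B) p ≡ evalPoly (applyUpTo f B) p ℕ.+ evalPoly (applyUpTo g B) p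
  eval-+ p zero    f g = refl
  eval-+ p (suc B) f g = trans (cong (λ z → f 0 ℕ.+ g 0 ℕ.+ p ℕ.* z) (eval-+ p B (f ∘ suc) (g ∘ suc)))
    (lem (f 0) (g 0) p (evalPoly (applyUpTo (f ∘ suc) B) p) (evalPoly (applyUpTo (g ∘ suc) B) p))
    where
    lem : ∀ a b p x y → a ℕ.+ b ℕ.+ p ℕ.* (x ℕ.+ y) ≡ (a ℕ.+ p ℕ.* x) ℕ.+ (b ℕ.+ p ℕ.* y)
    lem = ℕ-solve-∀

  eval-0 : ∀ p B → evalPoly (applyUpTo (λ _ → 0) B) p ≡ 0
  eval-0 p zero    = refl
  eval-0 p (suc B) = trans (cong (p ℕ.*_) (eval-0 p B)) (ℕₚ.*-zeroʳ p)

  eval-same : ∀ p B g → g ℕ.< B → evalPoly (applyUpTo (same g) B) p ≡ p ^ g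
  eval-same p (suc B) zero    _         = cong suc (trans (cong (p ℕ.*_) (eval-0 p B)) (ℕₚ.*-zeroʳ p))
  eval-same p (suc B) (suc g) (ℕ.s≤s h) = cong (p ℕ.*_) (eval-same p B g h)

eval-count : ∀ p B G → All (ℕ._< B) G → evalPoly (applyUpTo (λ k → count k G) B) p ≡ evalE p G
eval-count p B []      []       = eval-0 p B
eval-count p B (g ∷ G) (h ∷ hs) = trans (eval-+ p B (same g) (λ k → count k G)) (cong₂ ℕ._+_ (eval-same p B g h) (eval-count p B G hs))

coeff-applyUpTo : ∀ B (f : ℕ → ℕ) k → k ℕ.< B → coeff (applyUpTo f B) k ≡ f k
coeff-applyUpTo (suc B) f zero    _         = refl
coeff-applyUpTo (suc B) f (suc k) (ℕ.s≤s h) = coeff-applyUpTo B (f ∘ suc) k h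

-- The slack e absorbs the entries already passed in the induction, and later lets the coefficient
-- list be padded.
below-sum : ∀ e G → All (ℕ._< suc (e ℕ.+ ListAction.sum G)) G
below-sum e []      = []
below-sum e (g ∷ G) = ℕ.s≤s (ℕₚ.≤-trans (ℕₚ.m≤m+n g _) (ℕₚ.m≤n+m _ e)) ∷
  subst (λ z → All (ℕ._< suc z) G) (ℕₚ.+-assoc e g _) (below-sum (e ℕ.+ g) G)

polynomial : ∀ G → ∃ λ f → ∀ p → evalPoly f p ≡ evalE p G
polynomial G = applyUpTo (λ k → count k G) (suc (ListAction.sum G)) , λ p → eval-count p (suc (0 ℕ.+ ListAction.sum G)) G (below-sum 0 G)

unimodal-polynomial : ∀ R → ∃ λ f → Unimodal f × (∀ p → evalPoly f p ≡ evalE p (Rep.grades R))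
unimodal-polynomial R = f , (j , j<B′ , increasing , decreasing) , λ p → eval-count p B G (below-sum D G)
  where
  open Rep R using (D; level) renaming (grades to G)
  -- Padding by D puts the peak position inside the coefficient list, even when there are no
  -- exponents at all.
  B = suc (D ℕ.+ ListAction.sum G)
  f = applyUpTo (λ k → count k G) B
  -- i < ⌈D/2⌉ gives 2i < D and i ≥ ⌈D/2⌉ gives D < 2(i + 1), the hypotheses of the two level
  -- lemmas.
  j = ℕ.⌈ D /2⌉
  len : length f ≡ B
  len = Listₚ.length-applyUpTo (λ k → count k G) B
  j<B : j ℕ.< B
  j<B = ℕ.s≤s (ℕₚ.≤-trans (ℕₚ.⌈n/2⌉≤n D) (ℕₚ.m≤m+n D _))
  j<B′ = subst (j ℕ.<_) (sym len) j<B
  coeff-f : ∀ k → k ℕ.< B → coeff f k ≡ length (level k)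
  coeff-f k h = trans (coeff-applyUpTo B (λ k → count k G) k h) (sym (length-filter (Rep.gr R) k (Rep.els R)))
  ⌊⌋+⌈⌉ = ℕₚ.⌊n/2⌋+⌈n/2⌉≡n D
  increasing : ∀ i → i ℕ.< j → coeff f i ℕ.≤ coeff f (suc i)
  increasing i i<j = subst₂ ℕ._≤_ (sym (coeff-f i (ℕₚ.<-trans i<j j<B))) (sym (coeff-f (suc i) (ℕₚ.≤-<-trans i<j j<B)))
    (level-increasing R i 2i<D)
    where
    2i<D : 2 ℕ.* i ℕ.< D
    2i<D = ℕₚ.≤-<-trans (ℕₚ.≤-reflexive (cong (i ℕ.+_) (ℕₚ.+-identityʳ i)))
             (subst (i ℕ.+ i ℕ.<_) ⌊⌋+⌈⌉ (ℕₚ.+-mono-≤-< (ℕₚ.≤-pred (ℕₚ.≤-trans i<j (⌈⌉≤ D))) i<j))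
      where
      ⌈⌉≤ : ∀ n → ℕ.⌈ n /2⌉ ℕ.≤ suc ℕ.⌊ n /2⌋
      ⌈⌉≤ zero          = ℕ.z≤n
      ⌈⌉≤ (suc zero)    = ℕₚ.≤-refl
      ⌈⌉≤ (suc (suc n)) = ℕ.s≤s (⌈⌉≤ n)
  decreasing : ∀ i → j ℕ.≤ i → suc i ℕ.< length f → coeff f (suc i) ℕ.≤ coeff f i
  decreasing i j≤i h = subst₂ ℕ._≤_ (sym (coeff-f (suc i) (subst (suc i ℕ.<_) len h))) (sym (coeff-f i (ℕₚ.<-trans (ℕₚ.n<1+n i) (subst (suc i ℕ.<_) len h))))
    (level-decreasing R i D<)
    where
    D< : D ℕ.< 2 ℕ.* suc i
    D< = ℕₚ.<-≤-trans (ℕ.s≤s (subst (ℕ._≤ i ℕ.+ i) ⌊⌋+⌈⌉ (ℕₚ.+-mono-≤ (ℕₚ.≤-trans (ℕₚ.⌊n/2⌋≤⌈n/2⌉ D) j≤i) j≤i)))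
           (ℕₚ.≤-trans (ℕₚ.n≤1+n _) (ℕₚ.≤-reflexive (lem i)))
      where
      lem : ∀ i → suc (suc (i ℕ.+ i)) ≡ 2 ℕ.* suc i
      lem = ℕ-solve-∀

-- Counting chains

-- The rank sequences that a condition on one subgroup allows. They are distinct, so a subgroup
-- carries a single label and no chain is counted twice.
record Family (N : ℕ) : Set where
  field
    size  : ℕ
    τ     : Fin size → Vec ℕ N
    τ-inj : ∀ {i j} → τ i ≡ τ j → i ≡ j
open Family

-- The last index is the smallest subgroup of the chain; once it is chosen, only its ranks matter
-- for the others.
chainCount : (p s : ℕ) → ∀ {N} → Vec ℕ N → ∀ m → (Fin m → Family N) → ℕ
chainCount p s r zero    fam = 1
chainCount p s r (suc m) fam =
  sumF λ j → aboveCount p s r (τ (fam (fromℕ m)) j) ℕ.* chainCount p s (τ (fam (fromℕ m)) j) m (fam ∘ inject₁)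

module _ {X : Set} where

  snocF : ∀ {m} → (Fin m → X) → X → Fin (suc m) → X
  snocF {zero}  f x zero    = x
  snocF {suc m} f x zero    = f zero
  snocF {suc m} f x (suc i) = snocF (f ∘ suc) x i

  snocF-last : ∀ {m} (f : Fin m → X) x → snocF f x (fromℕ m) ≡ x
  snocF-last {zero}  f x = refl
  snocF-last {suc m} f x = snocF-last (f ∘ suc) x

  snocF-init : ∀ {m} (f : Fin m → X) x i → snocF f x (inject₁ i) ≡ f i
  snocF-init {suc m} f x zero    = refl
  snocF-init {suc m} f x (suc i) = snocF-init (f ∘ suc) x i

last⊎init : ∀ {m} {P : Fin (suc m) → Set} → P (fromℕ m) → (∀ i → P (inject₁ i)) → ∀ i → P i
last⊎init l h i with view i
... | ‵fromℕ     = l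
... | ‵inject₁ j = h j

module Chains (p : ℕ) (pr : Prime p) where
  open Lattice p pr
  open Flags p pr
  open RankSequences p pr

  ChainAbove : ∀ {s} → Subgroup s → (m : ℕ) → (Fin m → Subgroup s → Set) → Set
  ChainAbove A₀ m cond = Σ (Chain _ m cond) λ C → ∀ i {x} → x ∈ A₀ → x ∈ A C i

  _≈ᶜ_ : ∀ {s m cond} {A₀ : Subgroup s} → ChainAbove A₀ m cond → ChainAbove A₀ m cond → Set
  C ≈ᶜ D = ChainEq (proj₁ C) (proj₁ D)

  ⊆G⇒⊑ : ∀ {s} {A B : Subgroup s} → A ⊆G B → A ⊑ B
  ⊆G⇒⊑ h {x} ⟨ a ⟩ = ⟨ h x a ⟩

  ⊑⇒⊆G : ∀ {s} {A B : Subgroup s} → A ⊑ B → A ⊆G B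
  ⊑⇒⊆G h x a = holds (h ⟨ a ⟩)

  module _ {s N : ℕ} where

    -- The interface between the counting and the two parts of the theorem: index and type enter
    -- only through the ranks they allow.
    record Described {m} (cond : Fin m → Subgroup s → Set) (fam : Fin m → Family N) : Set where
      field
        to   : ∀ i {A} → cond i A → ∃ λ j → HasRanks A (τ (fam i) j)
        from : ∀ i {A} j → HasRanks A (τ (fam i) j) → cond i A
    open Described

    private
      module Extend {m} {cond : Fin (suc m) → Subgroup s → Set} {fam : Fin (suc m) → Family N} (desc : Described cond fam)
                    {A₀ : Subgroup s} where

        n = fromℕ m
        F = fam n

        label : ChainAbove A₀ (suc m) cond → Fin (size F)
        label (C , _) = proj₁ (to desc n (conds C n))

        label-ranks : ∀ C → HasRanks (A (proj₁ C) n) (τ F (label C))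
        label-ranks (C , _) = proj₂ (to desc n (conds C n))

        label-unique : ∀ C {j} → HasRanks (A (proj₁ C) n) (τ F j) → label C ≡ j
        label-unique C h = τ-inj F (HasRanks-unique _ _ (label-ranks C) h)

        label-resp : ∀ {C D} → C ≈ᶜ D → label C ≡ label D
        label-resp {C} {D} e = label-unique C (HasRanks-resp (τ F (label D)) (≐-sym (mem⇒≐ (e n))) (label-ranks D))

        Labelled : Fin (size F) → Set
        Labelled j = Σ (ChainAbove A₀ (suc m) cond) λ C → j ≡ label C

        last : ∀ {j} → Labelled j → Above A₀ (τ F j)
        last ((C , above) , refl) = record { sub = A C n ; above = above n ; ranks = label-ranks (C , above) }

        module _ {j} (B : Above A₀ (τ F j)) where

          LastIs : Set
          LastIs = Σ (Labelled j) λ C → B ≐ᵃ last C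

          append : ChainAbove (sub B) m (cond ∘ inject₁) → LastIs
          append (C , above-B) = ((chain , above-A₀) , sym (label-unique (chain , above-A₀) (subst (λ G → HasRanks G (τ F j)) (sym G-last) (ranks B)))) , last≐
            where
            G : Fin (suc m) → Subgroup s
            G = snocF (A C) (sub B)
            G-last : G n ≡ sub B
            G-last = snocF-last (A C) (sub B)
            G-init : ∀ i → G (inject₁ i) ≡ A C i
            G-init = snocF-init (A C) (sub B)
            nest : ∀ i j → i Fin.≤ j → G j ⊆G G i
            nest = last⊎init
              -- The last index is not at most an earlier one, so for it only the reflexive
              -- inclusion remains.
              (last⊎init (λ _ x a → a) (λ j h → ⊥-elim (ℕₚ.<⇒≱ (subst (ℕ._< m) (sym (Finₚ.toℕ-inject₁ j)) (Finₚ.toℕ<n j)) (subst (ℕ._≤ toℕ (inject₁ j)) (Finₚ.toℕ-fromℕ m) h))))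
              (λ i → last⊎init
                (λ _ → subst₂ _⊆G_ (sym G-last) (sym (G-init i)) (⊑⇒⊆G (above-B i)))
                (λ j h → subst₂ _⊆G_ (sym (G-init j)) (sym (G-init i)) (nested C i j (subst₂ ℕ._≤_ (Finₚ.toℕ-inject₁ i) (Finₚ.toℕ-inject₁ j) h))))
            chain : Chain s (suc m) cond
            chain = record { A = G ; nested = nest
              ; conds = last⊎init (subst (cond n) (sym G-last) (from desc n j (ranks B)))
                                  (λ i → subst (cond (inject₁ i)) (sym (G-init i)) (conds C i)) }
            above-A₀ : ∀ i {x} → x ∈ A₀ → x ∈ G i
            above-A₀ = last⊎init (λ {x} h → subst (x ∈_) (sym G-last) (above B h))
                                 (λ i {x} h → subst (x ∈_) (sym (G-init i)) (above-B i (above B h)))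
            last≐′ : ∀ {j′} (e : j′ ≡ label (chain , above-A₀)) → sub B ≐ sub (last ((chain , above-A₀) , e))
            last≐′ refl = subst (sub B ≐_) (sym G-last) ≐-refl
            last≐ = last≐′ (sym (label-unique (chain , above-A₀) (subst (λ G → HasRanks G (τ F j)) (sym G-last) (ranks B))))

          append-resp : ∀ {C D} → C ≈ᶜ D → proj₁ (proj₁ (append C)) ≈ᶜ proj₁ (proj₁ (append D))
          append-resp {C , _} {D , _} e = last⊎init
            (λ x → cong (λ G → mem G x) (trans (snocF-last (A C) (sub B)) (sym (snocF-last (A D) (sub B)))))
            (λ i x → trans (cong (λ G → mem G x) (snocF-init (A C) (sub B) i)) (trans (e i x) (cong (λ G → mem G x) (sym (snocF-init (A D) (sub B) i)))))

          append-inj : ∀ {C D} → proj₁ (proj₁ (append C)) ≈ᶜ proj₁ (proj₁ (append D)) → C ≈ᶜ D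
          append-inj {C , _} {D , _} e i x = trans (cong (λ G → mem G x) (sym (snocF-init (A C) (sub B) i)))
            (trans (e (inject₁ i) x) (cong (λ G → mem G x) (snocF-init (A D) (sub B) i)))

          append-surj : ∀ (y : LastIs) → ∃ λ C → proj₁ (proj₁ (append C)) ≈ᶜ proj₁ (proj₁ y)
          append-surj (((D , above-D) , refl) , e) = (init , above-B) , last⊎init
              (λ x → trans (cong (λ G → mem G x) (snocF-last (A init) (sub B))) (≐⇒mem e x))
              (λ i x → cong (λ G → mem G x) (snocF-init (A init) (sub B) i))
            where
            init : Chain s m (cond ∘ inject₁)
            init = record { A = A D ∘ inject₁
              ; nested = λ i j h → nested D (inject₁ i) (inject₁ j) (subst₂ ℕ._≤_ (sym (Finₚ.toℕ-inject₁ i)) (sym (Finₚ.toℕ-inject₁ j)) h)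
              ; conds = λ i → conds D (inject₁ i) }
            above-B : ∀ i {x} → x ∈ sub B → x ∈ A D (inject₁ i)
            above-B i h = ⊆G⇒⊑ (nested D (inject₁ i) n (subst₂ ℕ._≤_ (sym (Finₚ.toℕ-inject₁ i)) (sym (Finₚ.toℕ-fromℕ m)) (ℕₚ.<⇒≤ (Finₚ.toℕ<n i)))) (fwd e h)

    restrict : ∀ {m cond fam} → Described {suc m} cond fam → Described (cond ∘ inject₁) (fam ∘ inject₁)
    restrict d = record { to = λ i → to d (inject₁ i) ; from = λ i → from d (inject₁ i) }

    -- Chains are sorted first by the label of their smallest group and then by that group B itself;
    -- over B they are the shorter chains above B, counted with the ranks of B as the new lower
    -- bound.
    count-chains : ∀ m {cond fam} → Described {m} cond fam → ∀ {A₀ : Subgroup s} (r : Vec ℕ N) → RankSeq A₀ r →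
                   HasCard (ChainAbove A₀ m cond) _≈ᶜ_ (chainCount p s r m fam)
    count-chains zero desc r hr = hc-singleton {_≈_ = _≈ᶜ_} (record { A = λ () ; nested = λ () ; conds = λ () } , λ ()) (λ C ())
    count-chains (suc m) {cond} {fam} desc {A₀} r hr =
      hc-Σ {_≈_ = _≈ᶜ_} {_~_ = _≡_} sym trans ((λ j → j) , (λ i j e → e) , λ j → j , refl) label
        (λ {C} {D} → label-resp {C} {D}) λ j →
        subst (HasCard (Labelled j) (λ C D → proj₁ C ≈ᶜ proj₁ D)) (sumF-const (aboveCount p s r (τ F j)) (chainCount p s (τ F j) m (fam ∘ inject₁)))
          (hc-Σ {_≈_ = λ C D → proj₁ C ≈ᶜ proj₁ D} {_~_ = _≐ᵃ_} ≐-sym ≐-trans (base j) last (λ {C} {D} → last-resp {C = C} {D}) (λ i → fibre j (proj₁ (base j) i)))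
      where
      open Extend desc {A₀}
      base : ∀ j → HasCard (Above A₀ (τ F j)) _≐ᵃ_ (aboveCount p s r (τ F j))
      base j = count-above r (τ F j) hr
      last-resp : ∀ {j} {C D : Labelled j} → proj₁ C ≈ᶜ proj₁ D → last C ≐ᵃ last D
      last-resp {C = (C , _) , refl} {(D , _) , e′} e = go e′
        where
        go : ∀ {j above} (e′ : j ≡ label (D , above)) → A C n ≐ sub (last ((D , above) , e′))
        go refl = mem⇒≐ (e n)
      fibre : ∀ j (B : Above A₀ (τ F j)) → HasCard (LastIs B) (λ C D → proj₁ (proj₁ C) ≈ᶜ proj₁ (proj₁ D)) (chainCount p s (τ F j) m (fam ∘ inject₁))
      fibre j B = hc-map {_~_ = λ C D → proj₁ (proj₁ C) ≈ᶜ proj₁ (proj₁ D)}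
        (count-chains m (restrict desc) (τ F j) (HasRanks⇒RankSeq (τ F j) (ranks B))) (append B)
        (λ {C} {D} → append-resp B {C} {D}) (λ {C} {D} → append-inj B {C} {D})
        (λ e f i x → trans (e i x) (f i x)) (append-surj B)

    -- The lattice is torsion-free, so 0 : p = 0 and every rank is that of the zero subgroup.
    trivial-ranks : ∀ N′ {A₀ : Subgroup s} → (∀ {x} → x ∈ A₀ → x ≡ 0ᵥ) → RankSeq A₀ (replicate N′ 0)
    trivial-ranks zero     h = tt
    trivial-ranks (suc N′) h =
      stop (∩-fst , λ a → to-∩ a (subst (_∈ pL) (sym (h a)) 0-∈)) ,
      trivial-ranks N′ (λ x → q*-injective (trans (h (from-colon x)) (sym (*ᵥ-0 q))))

    numChains : ∀ m {cond fam} → Described {m} cond fam → NumChains s m cond (chainCount p s (replicate N 0) m fam)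
    numChains m desc = hc-map {_~_ = ChainEq} (count-chains m desc {trivial} (replicate N 0) (trivial-ranks N trivial⇒0))
      proj₁ (λ e → e) (λ e → e) (λ e f i x → trans (e i x) (f i x))
      (λ C → (C , λ i a → subst (_∈ A C i) (sym (trivial⇒0 a)) 0-∈) , λ i x → refl)

-- Graded sets and exponent lists with the required counts

localRep : ℕ → (r₀ t₀ t₁ : ℕ) → Rep
localRep s r₀ t₀ t₁ with r₀ ℕ.≤? t₀
... | yes _ = gaussRep (s ℕ.∸ t₁) (t₁ ℕ.∸ r₀) (t₀ ℕ.∸ r₀)
... | no  _ = emptyRep

aboveRep : ℕ → ∀ {N} → Vec ℕ N → Vec ℕ N → Rep
aboveRep s []       []       = unitRep
aboveRep s (r ∷ rs) (t ∷ ts) = aboveRep s rs ts ⊗ localRep s r t (headOr s ts)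

evalE-local : ∀ p s r₀ t₀ t₁ → evalE p (Rep.grades (localRep s r₀ t₀ t₁)) ≡ localCount p s r₀ t₀ t₁
evalE-local p s r₀ t₀ t₁ with r₀ ℕ.≤? t₀
... | yes _ = evalE-gauss p (s ℕ.∸ t₁) (t₁ ℕ.∸ r₀) (t₀ ℕ.∸ r₀)
... | no  _ = refl

evalE-above : ∀ p s {N} (r t : Vec ℕ N) → evalE p (Rep.grades (aboveRep s r t)) ≡ aboveCount p s r t
evalE-above p s []       []       = refl
evalE-above p s (r ∷ rs) (t ∷ ts) = trans (evalE-⊗ p (aboveRep s rs ts) (localRep s r t (headOr s ts)))
  (cong₂ ℕ._*_ (evalE-above p s rs ts) (evalE-local p s r t (headOr s ts)))

concatF : ∀ {n} → (Fin n → List ℕ) → List ℕ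
concatF {zero}  G = []
concatF {suc n} G = G zero ++ concatF (G ∘ suc)

evalE-concatF : ∀ p {n} (G : Fin n → List ℕ) (c : Fin n → ℕ) → (∀ i → evalE p (G i) ≡ c i) → evalE p (concatF G) ≡ sumF c
evalE-concatF p {zero}  G c h = refl
evalE-concatF p {suc n} G c h = trans (evalE-++ p (G zero) _) (cong₂ ℕ._+_ (h zero) (evalE-concatF p (G ∘ suc) (c ∘ suc) (h ∘ suc)))

evalE-* : ∀ p G H → evalE p (cartesianProductWith ℕ._+_ G H) ≡ evalE p G ℕ.* evalE p H
evalE-* p []      H = refl
evalE-* p (g ∷ G) H = trans (evalE-++ p (List.map (g ℕ.+_) H) _)
  (trans (cong₂ ℕ._+_ (shift H) (evalE-* p G H)) (sym (ℕₚ.*-distribʳ-+ (evalE p H) (p ^ g) (evalE p G))))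
  where
  shift : ∀ H → evalE p (List.map (g ℕ.+_) H) ≡ p ^ g ℕ.* evalE p H
  shift []      = sym (ℕₚ.*-zeroʳ (p ^ g))
  shift (h ∷ H) = trans (cong₂ ℕ._+_ (ℕₚ.^-distribˡ-+-* p g h) (shift H)) (sym (ℕₚ.*-distribˡ-+ (p ^ g) (p ^ h) (evalE p H)))

-- For prescribed indices one sums over rank sequences; the summands may have different D, so only
-- their exponents are collected.
chainExps : (s : ℕ) → ∀ {N} → Vec ℕ N → ∀ m → (Fin m → Family N) → List ℕ
chainExps s r zero    fam = 0 ∷ []
chainExps s r (suc m) fam = concatF λ j →
  cartesianProductWith ℕ._+_ (Rep.grades (aboveRep s r (τ (fam (fromℕ m)) j))) (chainExps s (τ (fam (fromℕ m)) j) m (fam ∘ inject₁))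

evalE-chainExps : ∀ p s {N} (r : Vec ℕ N) m fam → evalE p (chainExps s r m fam) ≡ chainCount p s r m fam
evalE-chainExps p s r zero    fam = refl
evalE-chainExps p s r (suc m) fam = evalE-concatF p _ _ λ j →
  trans (evalE-* p (Rep.grades (aboveRep s r (τ (fam (fromℕ m)) j))) (chainExps s (τ (fam (fromℕ m)) j) m (fam ∘ inject₁)))
    (cong₂ ℕ._*_ (evalE-above p s r (τ (fam (fromℕ m)) j)) (evalE-chainExps p s (τ (fam (fromℕ m)) j) m (fam ∘ inject₁)))

singleton : ∀ {N} → Vec ℕ N → Family N
singleton t = record { size = 1 ; τ = λ _ → t ; τ-inj = λ { {zero} {zero} _ → refl } }

-- A prescribed type allows one rank sequence per place, so the count is a pure product and has a
-- tensor product behind it.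
chainRep : (s : ℕ) → ∀ {N} → Vec ℕ N → ∀ m → (Fin m → Vec ℕ N) → Rep
chainRep s r zero    t = unitRep
chainRep s r (suc m) t = aboveRep s r (t (fromℕ m)) ⊗ chainRep s (t (fromℕ m)) m (t ∘ inject₁)

evalE-chainRep : ∀ p s {N} (r : Vec ℕ N) m t → evalE p (Rep.grades (chainRep s r m t)) ≡ chainCount p s r m (singleton ∘ t)
evalE-chainRep p s r zero    t = refl
evalE-chainRep p s r (suc m) t = trans (evalE-⊗ p (aboveRep s r (t (fromℕ m))) (chainRep s (t (fromℕ m)) m (t ∘ inject₁)))
  (trans (cong₂ ℕ._*_ (evalE-above p s r (t (fromℕ m))) (evalE-chainRep p s (t (fromℕ m)) m (t ∘ inject₁))) (sym (ℕₚ.+-identityʳ _)))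

-- Index and type as conditions on the ranks

vec-card : ∀ k N → ∃ λ n → HasCard (Vec (Fin k) N) _≡_ n
vec-card k zero    = 1 , hc-singleton {_≈_ = _≡_} [] (λ { [] → refl })
vec-card k (suc N) = let n , h = vec-card k N in
  _ , hc-Σ {_≈_ = _≡_} {_~_ = _≡_} {k = λ _ → n} sym trans ((λ i → i) , (λ i j e → e) , λ i → i , refl) Vec.head (cong Vec.head)
    (λ i → hc-map {_~_ = λ x y → proj₁ x ≡ proj₁ y} h (λ v → i ∷ v , refl) (cong (i ∷_)) Vecₚ.∷-injectiveʳ trans (λ { (_ ∷ v , refl) → v , refl }))

module _ (s N a : ℕ) where

  private
    Deficit : Vec (Fin (suc s)) N → Set
    Deficit t = deficit s (map toℕ t) ≡ a

    sequences : ∃ λ n → HasCard (Σ (Vec (Fin (suc s)) N) Deficit) (λ x y → proj₁ x ≡ proj₁ y) n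
    sequences = hc-filter {_≈_ = _≡_} (λ t → deficit s (map toℕ t) ℕ.≟ a) (subst Deficit) sym (proj₂ (vec-card (suc s) N))

    map-toℕ-injective : ∀ {k n} (x y : Vec (Fin k) n) → map toℕ x ≡ map toℕ y → x ≡ y
    map-toℕ-injective []      []      e = refl
    map-toℕ-injective (x ∷ xs) (y ∷ ys) e = cong₂ _∷_ (Finₚ.toℕ-injective (Vecₚ.∷-injectiveˡ e)) (map-toℕ-injective xs ys (Vecₚ.∷-injectiveʳ e))

  -- All sequences with entries at most s and deficit a. The enumeration knows nothing of p, so
  -- neither does the polynomial.
  indexFamily : Family N
  indexFamily = record
    { size = proj₁ sequences ; τ = λ j → map toℕ (proj₁ (proj₁ (proj₂ sequences) j))
    ; τ-inj = λ {i} {j} e → proj₁ (proj₂ (proj₂ sequences)) i j (map-toℕ-injective _ _ e) }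

  indexFamily-deficit : ∀ j → deficit s (τ indexFamily j) ≡ a
  indexFamily-deficit j = proj₂ (proj₁ (proj₂ sequences) j)

  indexFamily-complete : ∀ t → deficit s (map toℕ t) ≡ a → ∃ λ j → τ indexFamily j ≡ map toℕ t
  indexFamily-complete t e = let j , e′ = proj₂ (proj₂ (proj₂ sequences)) (t , e) in j , cong (map toℕ) e′

module _ (p : ℕ) (pr : Prime p) where
  open Flags p pr
  open RankSequences p pr
  open Types p pr
  open TypeRanks p pr
  open Chains p pr

  private
    -- By `colon-flag` each rank has a non-negative complement to s, so the sequence occurs in the
    -- finite enumeration.
    bounded : ∀ {s N} {A : Subgroup s} (t : Vec ℕ N) → HasRanks A t → ∃ λ (t′ : Vec (Fin (suc s)) N) → map toℕ t′ ≡ t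
    bounded []       h = [] , refl
    bounded {s} (t ∷ ts) h@(_ , h′) = helper (colon-flag t ts h) (bounded ts h′)
      where
      helper : ∀ {P : ℕ → Set} → (∃ λ d → t ℕ.+ d ≡ s × P d) → (∃ λ (t′ : Vec (Fin (suc s)) _) → map toℕ t′ ≡ ts) →
               ∃ λ (t′ : Vec (Fin (suc s)) _) → map toℕ t′ ≡ t ∷ ts
      helper (d , e , _) (ts′ , e′) = fromℕ< t<s ∷ ts′ , cong₂ _∷_ (Finₚ.toℕ-fromℕ< t<s) e′
        where
        t<s : t ℕ.< suc s
        t<s = ℕ.s≤s (subst (t ℕ.≤_) e (ℕₚ.m≤m+n t d))

  index-described : ∀ s N {m} (a : Fin m → ℕ) → (∀ i → a i ℕ.≤ N) →
                    Described {s} {N} (λ i A → HasIndex A (p ^ a i)) (λ i → indexFamily s N (a i))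
  index-described s N a a≤N = record
    { to = λ i {A} h → go i (index⇒ranks h (a≤N i))
    ; from = λ i {A} j h → subst (λ z → HasIndex A (p ^ z)) (indexFamily-deficit s N (a i) j) (ranks⇒index _ h) }
    where
    go : ∀ i {A} → (∃ λ (t : Vec ℕ N) → HasRanks A t × deficit s t ≡ a i) → ∃ λ j → HasRanks A (τ (indexFamily s N (a i)) j)
    go i {A} (t , h , e) with bounded t h
    ... | t′ , refl = let j , e′ = indexFamily-complete s N (a i) t′ e in j , subst (HasRanks A) (sym e′) h

  type-described : ∀ s N {m} (l : Fin m → List ℕ) → (∀ i → IsPartition (l i)) → (∀ i → length (l i) ℕ.≤ s) → (∀ i → Vec.sum (fromList (l i)) ℕ.≤ N) →
                   Described {s} {N} (λ i A → HasType p A (l i)) (λ i → singleton (ranksOf s N (fromList (l i))))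
  type-described s N l part len sum≤N = record
    { to = λ i T → zero , HasType⇒ranks N (l i) (sum≤N i) T
    ; from = λ i j h → ranks⇒HasType N (l i) (proj₂ (part i)) (len i) (sum≤N i) h }

lookup≤sum : ∀ {m} (as : Vec ℕ m) i → lookup as i ℕ.≤ Vec.sum as
lookup≤sum (a ∷ as) zero    = ℕₚ.m≤m+n a _
lookup≤sum (a ∷ as) (suc i) = ℕₚ.≤-trans (lookup≤sum as i) (ℕₚ.m≤n+m _ a)

theorem1p14 : (s m : ℕ) → .{{NonZero s}} → .{{NonZero m}} →
    ((as : Vec ℕ m) → (∀ i j → i Fin.< j → lookup as i < lookup as j) →
    ∃ λ f → ∀ p → Prime p →
    NumChains s m (λ i A → HasIndex A (p ^ lookup as i)) (evalPoly f p))
    ×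
    ((ls : Vec (List ℕ) m) →
    (∀ i → IsPartition (lookup ls i)) →
    (∀ i → length (lookup ls i) ≤ s) →
    (∀ i j → i Fin.≤ j → lookup ls i ⊆P lookup ls j) →
    ∃ λ f → Unimodal f × (∀ p → Prime p →
    NumChains s m (λ i A → HasType p A (lookup ls i)) (evalPoly f p)))
theorem1p14 s m = index-part , type-part
  where
  index-part : (as : Vec ℕ m) → (∀ i j → i Fin.< j → lookup as i < lookup as j) →
    ∃ λ f → ∀ p → Prime p → NumChains s m (λ i A → HasIndex A (p ^ lookup as i)) (evalPoly f p)
  index-part as _ = proj₁ poly , λ p pr → subst (NumChains s m _)
      (sym (trans (proj₂ poly p) (evalE-chainExps p s (replicate N 0) m fam)))
      (Chains.numChains p pr m (index-described p pr s N (lookup as) (lookup≤sum as)))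
    where
    -- One length for all rank sequences: a subgroup of index p^a contains p^a times the lattice, so
    -- N ≥ a suffices.
    N = Vec.sum as
    fam : Fin m → Family N
    fam i = indexFamily s N (lookup as i)
    poly = polynomial (chainExps s (replicate N 0) m fam)

  type-part : (ls : Vec (List ℕ) m) → (∀ i → IsPartition (lookup ls i)) → (∀ i → length (lookup ls i) ≤ s) →
    (∀ i j → i Fin.≤ j → lookup ls i ⊆P lookup ls j) →
    ∃ λ f → Unimodal f × (∀ p → Prime p → NumChains s m (λ i A → HasType p A (lookup ls i)) (evalPoly f p))
  type-part ls part len _ = proj₁ poly , proj₁ (proj₂ poly) , λ p pr → subst (NumChains s m _)
      (sym (trans (proj₂ (proj₂ poly) p) (evalE-chainRep p s (replicate N 0) m t)))
      (Chains.numChains p pr m (type-described p pr s N (lookup ls) part len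
        (λ i → subst (ℕ._≤ N) (Vecₚ.lookup-map i (Vec.sum ∘ fromList) ls) (lookup≤sum sums i))))
    where
    sums = map (λ l → Vec.sum (fromList l)) ls
    -- The total of all parts bounds the size of each partition, so sequences of this length reach
    -- the end of every conjugate.
    N = Vec.sum sums
    t : Fin m → Vec ℕ N
    t i = ranksOf s N (fromList (lookup ls i))
    poly = unimodal-polynomial (chainRep s (replicate N 0) m t)
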